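{- Let $K$ be a field and let $K^\times \hookrightarrow U$ be an extension of abelian groups such that $(U/K^\times)[\ell^\infty]=1$ if $\operatorname{char} K=\ell>0$. Then the universal algebra $K\langle U\rangle$ is a field if and only if the extension $K^\times\hookrightarrow U$ is essential and, moreover, in case $U$ contains an element of order $4$ not in $K^\times$, one has $-4\notin U^4$ (i.e. there is no $x\in U$ with $x^4=-4$). In this case (i.e. when $K\langle U\rangle$ is a field): - if $U/K^\times$ is a $p$-group for a prime $p\ge 3$, then $(K\langle U\rangle^\times/K^\times)[p^\infty]=U/K^\times$; - if $U/K^\times$ is a $2$-group and $U$ contains no element of order $4$ not in $K$, then $(K\langle U\rangle^\times/K^\times)[2^\infty]=U/K^\times$.
   Context: All rings are commutative; $R^\times$ is the group of units of a ring $R$. For a multiplicatively written abelian group $G$ and a prime $p$, $G[p^\infty]=\{x\in G: x^{p^k}=1 \text{ for some } k\ge 1\}$. An extension $H\subseteq G$ of abelian groups is essential if every subgroup $F\subseteq G$ with $F\cap H=1$ is trivial. Universal algebra: let $K^\times\hookrightarrow U$ be an extension of abelian groups ($U$ an abelian group containing $K^\times$ as a subgroup), and put $D=U/K^\times$ (written additively). Choose representatives $x_d\in U$ of the classes $d\in D$. Then $K\langle U\rangle:=\bigoplus_{d\in D}Kx_d$ is the $K$-algebra with $K$-basis $(x_d)_{d\in D}$ and multiplication $x_dx_e=a_{d,e}x_{d+e}$, where $a_{d,e}\in K^\times$ is determined by this equation in $U$ (equivalently, $K\langle U\rangle=K\otimes_{\mathbb Z[K^\times]}\mathbb Z[U]$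 with group rings). It does not depend on the choices, is $D$-graded, and $U$ is identified with its group of homogeneous units via $u=ax_d\mapsto ax_d$ ($a\in K^\times$); in particular $U\subseteq K\langle U\rangle^\times$. -}

module Defs where

open import Algebra.Bundles using (AbelianGroup; CommutativeMonoid; CommutativeRing)
open import Algebra.Morphism.Structures using (module GroupMorphisms)
open import Algebra.Structures using (IsCommutativeMonoid)
import Algebra.Definitions.RawMonoid as RawMonoidDefinitions
import Algebra.Properties.AbelianGroup as AbelianGroupProperties
import Algebra.Properties.CommutativeSemigroup as CommutativeSemigroupProperties
import Algebra.Properties.Ring as RingProperties
open import Data.List.Base using (List; []; _∷_; _++_; map)
open import Data.List.Properties using (++-assoc; ++-identityʳ; map-++)
open import Data.Nat.Base as ℕ using (ℕ)
open import Data.Nat.Divisibility using (_∣_)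
open import Data.Product.Base using (_×_; _,_; ∃; ∃-syntax; proj₁)
open import Function.Bundles using (_⇔_)
open import Level using (Level; _⊔_; suc)
open import Relation.Binary.Core using (Rel)
open import Relation.Binary.Bundles using (Setoid)
open import Relation.Binary.Structures using (IsEquivalence)
import Relation.Binary.PropositionalEquality.Core as ≡
import Relation.Binary.Reasoning.Setoid as SetoidReasoning
open import Relation.Nullary.Negation.Core using (¬_)
open import Relation.Unary using (Pred; _∈_)

private
  variable
    a b c u ℓ ℓ₁ ℓ₂ ℓu : Level

-- Abelian groups are written multiplicatively.
module _ (G : AbelianGroup a ℓ) where
  open AbelianGroup G

  infixl 8 _^_
  _^_ : Carrier → ℕ → Carrier
  x ^ n = RawMonoidDefinitions._×_ rawMonoid n x

  -- x has order n; n = 0 encodes infinite order.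
  HasOrder : Carrier → ℕ → Set ℓ
  HasOrder x n = ∀ m → x ^ m ≈ ε ⇔ n ∣ m

  infix 9 _[_^∞]
  _[_^∞] : ℕ → Pred Carrier ℓ
  _[_^∞] p x = ∃[ k ] (1 ℕ.≤ k × x ^ (p ℕ.^ k) ≈ ε)

  IsTrivial : Pred Carrier b → Set _
  IsTrivial F = ∀ x → x ∈ F → x ≈ ε

  IsPGroup : ℕ → Set _
  IsPGroup p = ∀ x → ∃[ k ] x ^ (p ℕ.^ k) ≈ ε

  record IsSubgroup (F : Pred Carrier b) : Set (a ⊔ ℓ ⊔ b) where
    field
      resp      : ∀ {x y} → x ≈ y → x ∈ F → y ∈ F
      ε-closed  : ε ∈ F
      ∙-closed  : ∀ {x y} → x ∈ F → y ∈ F → x ∙ y ∈ F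
      ⁻¹-closed : ∀ {x} → x ∈ F → x ⁻¹ ∈ F

module _ (H : AbelianGroup a ℓ₁) (G : AbelianGroup b ℓ₂) where
  private
    module H = AbelianGroup H
    module G = AbelianGroup G

  IsHomomorphism IsMonomorphism : (H.Carrier → G.Carrier) → Set _
  IsHomomorphism = GroupMorphisms.IsGroupHomomorphism H.rawGroup G.rawGroup
  IsMonomorphism = GroupMorphisms.IsGroupMonomorphism H.rawGroup G.rawGroup

  Image : (H.Carrier → G.Carrier) → Pred G.Carrier _
  Image f x = ∃[ h ] x G.≈ f h

  -- For an embedding f of H in G. The level of F is large enough to
  -- include all cyclic subgroups, whose predicate has level ℓ₂.
  IsEssential : (H.Carrier → G.Carrier) → Set _
  IsEssential f = (F : Pred G.Carrier (b ⊔ ℓ₂)) → IsSubgroup G F →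
    IsTrivial G (λ x → x ∈ F × x ∈ Image f) → IsTrivial G F

  -- G / f(H): the carrier of G, with x ≈ y when x = f(h)y for some h.
  quotient : (f : H.Carrier → G.Carrier) → IsHomomorphism f →
             AbelianGroup b (a ⊔ ℓ₂)
  quotient f f-hom = record
    { Carrier = G.Carrier
    ; _≈_ = _~_
    ; _∙_ = G._∙_
    ; ε = G.ε
    ; _⁻¹ = G._⁻¹
    ; isAbelianGroup = record
      { isGroup = record
        { isMonoid = record
          { isSemigroup = record
            { isMagma = record
              { isEquivalence = record
                { refl = ≈⇒~ G.refl ; sym = ~-sym ; trans = ~-trans }
              ; ∙-cong = ~-∙-cong
              }
            ; assoc = λ x y z → ≈⇒~ (G.assoc x y z)
            }
          ; identity = (λ x → ≈⇒~ (G.identityˡ x)) , (λ x → ≈⇒~ (G.identityʳ x))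
          }
        ; inverse = (λ x → ≈⇒~ (G.inverseˡ x)) , (λ x → ≈⇒~ (G.inverseʳ x))
        ; ⁻¹-cong = ~-⁻¹-cong
        }
      ; comm = λ x y → ≈⇒~ (G.comm x y)
      }
    }
    where
    open GroupMorphisms.IsGroupHomomorphism f-hom
    open SetoidReasoning G.setoid
    open CommutativeSemigroupProperties G.commutativeSemigroup using (interchange)

    _~_ : Rel G.Carrier _
    x ~ y = ∃[ h ] x G.≈ f h G.∙ y

    ≈⇒~ : ∀ {x y} → x G.≈ y → x ~ y
    ≈⇒~ {x} {y} x≈y = H.ε , (begin
      x               ≈⟨ x≈y ⟩
      y               ≈⟨ G.identityˡ y ⟨
      G.ε G.∙ y       ≈⟨ G.∙-congʳ ε-homo ⟨
      f H.ε G.∙ y     ∎)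

    ~-sym : ∀ {x y} → x ~ y → y ~ x
    ~-sym {x} {y} (h , p) = h H.⁻¹ , (begin
      y                             ≈⟨ G.identityˡ y ⟨
      G.ε G.∙ y                     ≈⟨ G.∙-congʳ (G.inverseˡ (f h)) ⟨
      (f h G.⁻¹ G.∙ f h) G.∙ y      ≈⟨ G.assoc _ _ _ ⟩
      f h G.⁻¹ G.∙ (f h G.∙ y)      ≈⟨ G.∙-cong (⁻¹-homo h) p ⟨
      f (h H.⁻¹) G.∙ x              ∎)

    ~-trans : ∀ {x y z} → x ~ y → y ~ z → x ~ z
    ~-trans {x} {y} {z} (h , p) (k , q) = h H.∙ k , (begin
      x                       ≈⟨ p ⟩
      f h G.∙ y               ≈⟨ G.∙-congˡ q ⟩
      f h G.∙ (f k G.∙ z)     ≈⟨ G.assoc _ _ _ ⟨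
      (f h G.∙ f k) G.∙ z     ≈⟨ G.∙-congʳ (homo h k) ⟨
      f (h H.∙ k) G.∙ z       ∎)

    ~-∙-cong : ∀ {x y v w} → x ~ y → v ~ w → (x G.∙ v) ~ (y G.∙ w)
    ~-∙-cong {x} {y} {v} {w} (h , p) (k , q) = h H.∙ k , (begin
      x G.∙ v                           ≈⟨ G.∙-cong p q ⟩
      (f h G.∙ y) G.∙ (f k G.∙ w)       ≈⟨ interchange _ _ _ _ ⟩
      (f h G.∙ f k) G.∙ (y G.∙ w)       ≈⟨ G.∙-congʳ (homo h k) ⟨
      f (h H.∙ k) G.∙ (y G.∙ w)         ∎)

    ~-⁻¹-cong : ∀ {x y} → x ~ y → (x G.⁻¹) ~ (y G.⁻¹)
    ~-⁻¹-cong {x} {y} (h , p) = h H.⁻¹ , (begin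
      x G.⁻¹                        ≈⟨ G.⁻¹-cong p ⟩
      (f h G.∙ y) G.⁻¹              ≈⟨ AbelianGroupProperties.⁻¹-∙-comm G _ _ ⟨
      f h G.⁻¹ G.∙ y G.⁻¹           ≈⟨ G.∙-congʳ (⁻¹-homo h) ⟨
      f (h H.⁻¹) G.∙ y G.⁻¹         ∎)

module _ (R : CommutativeRing c ℓ) where
  open CommutativeRing R

  IsField : Set _
  IsField = ¬ (1# ≈ 0#) × (∀ x → ¬ (x ≈ 0#) → ∃[ y ] x * y ≈ 1#)

  -- The characteristic is the order of 1 in the additive group, with
  -- n = 0 when that order is infinite.
  HasCharacteristic : ℕ → Set _
  HasCharacteristic = HasOrder +-abelianGroup 1#

  -4# : Carrier
  -4# = - (1# + 1# + 1# + 1#)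

  units : AbelianGroup (c ⊔ ℓ) ℓ
  units = record
    { Carrier = ∃[ x ] ∃[ y ] x * y ≈ 1#
    ; _≈_ = λ x y → proj₁ x ≈ proj₁ y
    ; _∙_ = λ (x , x′ , p) (y , y′ , q) → x * y , x′ * y′ ,
        trans (interchange x y x′ y′) (trans (*-cong p q) (*-identityˡ 1#))
    ; ε = 1# , 1# , *-identityˡ 1#
    ; _⁻¹ = λ (x , x′ , p) → x′ , x , trans (*-comm x′ x) p
    ; isAbelianGroup = record
      { isGroup = record
        { isMonoid = record
          { isSemigroup = record
            { isMagma = record
              { isEquivalence = record { refl = refl ; sym = sym ; trans = trans }
              ; ∙-cong = *-cong
              }
            ; assoc = λ _ _ _ → *-assoc _ _ _
            }
          ; identity = (λ _ → *-identityˡ _) , (λ _ → *-identityʳ _)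
          }
        ; inverse = (λ (x , x′ , p) → trans (*-comm x′ x) p) , (λ (_ , _ , p) → p)
        ; ⁻¹-cong = λ { {x , x′ , p} {y , y′ , q} x≈y → begin
            x′               ≈⟨ *-identityʳ x′ ⟨
            x′ * 1#          ≈⟨ *-congˡ q ⟨
            x′ * (y * y′)    ≈⟨ *-congˡ (*-congʳ x≈y) ⟨
            x′ * (x * y′)    ≈⟨ *-assoc x′ x y′ ⟨
            x′ * x * y′      ≈⟨ *-congʳ (trans (*-comm x′ x) p) ⟩
            1# * y′          ≈⟨ *-identityˡ y′ ⟩
            y′               ∎ }
        }
      ; comm = λ _ _ → *-comm _ _
      }
    }
    where
    open SetoidReasoning setoid
    open CommutativeSemigroupProperties *-commutativeSemigroup using (interchange)

-- K⟨U⟩ as K ⊗_{ℤ[K^×]} ℤ[U], which needs no choice of representatives of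
-- U / K^×: it is the free K-module on U modulo (k a) ⊗ v = k ⊗ (ι a) v
-- for a in K^×. Given representatives x_d, this leaves the basis 1 ⊗ x_d.
module UniversalAlgebra
  (K : CommutativeRing c ℓ) (U : AbelianGroup u ℓu)
  (ι : AbelianGroup.Carrier (units K) → AbelianGroup.Carrier U)
  where

  private
    module K where
      open CommutativeRing K public
      open RingProperties ring public using (-‿distribˡ-*)
      open CommutativeSemigroupProperties *-commutativeSemigroup public using (xy∙z≈xz∙y)
    module U = AbelianGroup U

  Term : Set _
  Term = K.Carrier × U.Carrier

  -- The list (k₁ , u₁) ∷ … ∷ (kₙ , uₙ) ∷ [] stands for the sum of the
  -- pure tensors kᵢ ⊗ uᵢ.
  Sum : Set _
  Sum = List Term

  infix 4 _≋_
  data _≋_ : Rel Sum (c ⊔ ℓ ⊔ u ⊔ ℓu) where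
    refl    : ∀ {xs} → xs ≋ xs
    sym     : ∀ {xs ys} → xs ≋ ys → ys ≋ xs
    trans   : ∀ {xs ys zs} → xs ≋ ys → ys ≋ zs → xs ≋ zs
    prep    : ∀ {k l v w xs ys} → k K.≈ l → v U.≈ w → xs ≋ ys →
              (k , v) ∷ xs ≋ (l , w) ∷ ys
    swap    : ∀ x y {xs} → x ∷ y ∷ xs ≋ y ∷ x ∷ xs
    drop    : ∀ v {xs} → (K.0# , v) ∷ xs ≋ xs
    merge   : ∀ k l v {xs} → (k , v) ∷ (l , v) ∷ xs ≋ (k K.+ l , v) ∷ xs
    balance : ∀ k a v {xs} → (k K.* proj₁ a , v) ∷ xs ≋ (k , ι a U.∙ v) ∷ xs

  infixl 7 _·_ _⊛_
  _⋆_ : Term → Term → Term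
  (k , v) ⋆ (l , w) = k K.* l , v U.∙ w

  _·_ : Term → Sum → Sum
  t · ys = map (t ⋆_) ys

  _⊛_ : Sum → Sum → Sum
  []       ⊛ ys = []
  (x ∷ xs) ⊛ ys = x · ys ++ xs ⊛ ys

  neg : Sum → Sum
  neg = map (λ (k , v) → K.- k , v)

  one : Sum
  one = (K.1# , U.ε) ∷ []

  private
    ≋-isEquivalence : IsEquivalence _≋_
    ≋-isEquivalence = record { refl = refl ; sym = sym ; trans = trans }

    ≋-setoid : Setoid _ _
    ≋-setoid = record { isEquivalence = ≋-isEquivalence }

    open SetoidReasoning ≋-setoid

    ≡⇒≋ : ∀ {xs ys} → xs ≡.≡ ys → xs ≋ ys
    ≡⇒≋ ≡.refl = refl

    cons : ∀ x {xs ys} → xs ≋ ys → x ∷ xs ≋ x ∷ ys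
    cons x = prep K.refl U.refl

    ++-congˡ : ∀ xs {ys zs} → ys ≋ zs → xs ++ ys ≋ xs ++ zs
    ++-congˡ []       p = p
    ++-congˡ (x ∷ xs) p = cons x (++-congˡ xs p)

    ++-congʳ : ∀ zs {xs ys} → xs ≋ ys → xs ++ zs ≋ ys ++ zs
    ++-congʳ zs refl            = refl
    ++-congʳ zs (sym p)         = sym (++-congʳ zs p)
    ++-congʳ zs (trans p q)     = trans (++-congʳ zs p) (++-congʳ zs q)
    ++-congʳ zs (prep k≈l v≈w p) = prep k≈l v≈w (++-congʳ zs p)
    ++-congʳ zs (swap x y)      = swap x y
    ++-congʳ zs (drop v)        = drop v
    ++-congʳ zs (merge k l v)   = merge k l v
    ++-congʳ zs (balance k a v) = balance k a v

    ++-cong : ∀ {xs ys vs ws} → xs ≋ ys → vs ≋ ws → xs ++ vs ≋ ys ++ ws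
    ++-cong {ys = ys} {vs} p q = trans (++-congʳ vs p) (++-congˡ ys q)

    shift : ∀ x xs ys → x ∷ xs ++ ys ≋ xs ++ x ∷ ys
    shift x []       ys = refl
    shift x (y ∷ xs) ys = trans (swap x y) (cons y (shift x xs ys))

    ++-comm : ∀ xs ys → xs ++ ys ≋ ys ++ xs
    ++-comm []       ys = ≡⇒≋ (≡.sym (++-identityʳ ys))
    ++-comm (x ∷ xs) ys = trans (cons x (++-comm xs ys)) (shift x ys xs)

    ++-isCommutativeMonoid : IsCommutativeMonoid _≋_ _++_ []
    ++-isCommutativeMonoid = record
      { isMonoid = record
        { isSemigroup = record
          { isMagma = record { isEquivalence = ≋-isEquivalence ; ∙-cong = ++-cong }
          ; assoc = λ xs ys zs → ≡⇒≋ (++-assoc xs ys zs)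
          }
        ; identity = (λ _ → refl) , (λ xs → ≡⇒≋ (++-identityʳ xs))
        }
      ; comm = ++-comm
      }

    ++-commutativeMonoid : CommutativeMonoid _ _
    ++-commutativeMonoid = record { isCommutativeMonoid = ++-isCommutativeMonoid }

    open CommutativeSemigroupProperties
      (CommutativeMonoid.commutativeSemigroup ++-commutativeMonoid)
      using (x∙yz≈y∙xz)

    neg-cong : ∀ {xs ys} → xs ≋ ys → neg xs ≋ neg ys
    neg-cong refl             = refl
    neg-cong (sym p)          = sym (neg-cong p)
    neg-cong (trans p q)      = trans (neg-cong p) (neg-cong q)
    neg-cong (prep k≈l v≈w p) = prep (K.-‿cong k≈l) v≈w (neg-cong p)
    neg-cong (swap x y)       = swap _ _
    neg-cong (drop v)         =
      trans (prep (RingProperties.-0#≈0# K.ring) U.refl refl) (drop v)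
    neg-cong (merge k l v)    =
      trans (merge _ _ v) (prep (RingProperties.-‿+-comm K.ring k l) U.refl refl)
    neg-cong (balance k a v)  =
      trans (prep (K.-‿distribˡ-* k (proj₁ a)) U.refl refl) (balance _ a v)

    neg-inverseˡ : ∀ xs → neg xs ++ xs ≋ []
    neg-inverseˡ []             = refl
    neg-inverseˡ ((k , v) ∷ xs) = begin
      (K.- k , v) ∷ neg xs ++ (k , v) ∷ xs      ≈⟨ cons _ (shift _ (neg xs) xs) ⟨
      (K.- k , v) ∷ (k , v) ∷ neg xs ++ xs      ≈⟨ merge _ _ v ⟩
      (K.- k K.+ k , v) ∷ neg xs ++ xs          ≈⟨ prep (K.-‿inverseˡ k) U.refl (neg-inverseˡ xs) ⟩
      (K.0# , v) ∷ []                           ≈⟨ drop v ⟩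
      []                                        ∎

    ·-cong : ∀ t {xs ys} → xs ≋ ys → t · xs ≋ t · ys
    ·-cong t refl             = refl
    ·-cong t (sym p)          = sym (·-cong t p)
    ·-cong t (trans p q)      = trans (·-cong t p) (·-cong t q)
    ·-cong t (prep k≈l v≈w p) = prep (K.*-congˡ k≈l) (U.∙-congˡ v≈w) (·-cong t p)
    ·-cong t (swap x y)       = swap _ _
    ·-cong (m , t) (drop v)   = trans (prep (K.zeroʳ m) U.refl refl) (drop _)
    ·-cong (m , t) (merge k l v) =
      trans (merge _ _ _) (prep (K.sym (K.distribˡ m k l)) U.refl refl)
    ·-cong (m , t) (balance k a v) =
      trans (prep (K.sym (K.*-assoc m k (proj₁ a))) U.refl refl)
     (trans (balance (m K.* k) a (t U.∙ v))
            (prep K.refl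
              (CommutativeSemigroupProperties.x∙yz≈y∙xz U.commutativeSemigroup (ι a) t v)
              refl))

    ⊛-congˡ : ∀ xs {ys zs} → ys ≋ zs → xs ⊛ ys ≋ xs ⊛ zs
    ⊛-congˡ []       p = refl
    ⊛-congˡ (x ∷ xs) p = ++-cong (·-cong x p) (⊛-congˡ xs p)

    ⊛-zeroʳ : ∀ xs → xs ⊛ [] ≋ []
    ⊛-zeroʳ []       = refl
    ⊛-zeroʳ (x ∷ xs) = ⊛-zeroʳ xs

    ⊛-consʳ : ∀ ys x xs → ys ⊛ (x ∷ xs) ≋ x · ys ++ ys ⊛ xs
    ⊛-consʳ []       x xs = refl
    ⊛-consʳ (y ∷ ys) x xs = prep (K.*-comm _ _) (U.comm _ _) (begin
      y · xs ++ ys ⊛ (x ∷ xs)            ≈⟨ ++-congˡ (y · xs) (⊛-consʳ ys x xs) ⟩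
      y · xs ++ (x · ys ++ ys ⊛ xs)      ≈⟨ x∙yz≈y∙xz (y · xs) (x · ys) (ys ⊛ xs) ⟩
      x · ys ++ (y · xs ++ ys ⊛ xs)      ∎)

    ⊛-comm : ∀ xs ys → xs ⊛ ys ≋ ys ⊛ xs
    ⊛-comm []       ys = sym (⊛-zeroʳ ys)
    ⊛-comm (x ∷ xs) ys =
      trans (++-congˡ (x · ys) (⊛-comm xs ys)) (sym (⊛-consʳ ys x xs))

    ⊛-cong : ∀ {xs ys vs ws} → xs ≋ ys → vs ≋ ws → xs ⊛ vs ≋ ys ⊛ ws
    ⊛-cong {xs} {ys} {vs} {ws} p q = begin
      xs ⊛ vs    ≈⟨ ⊛-congˡ xs q ⟩
      xs ⊛ ws    ≈⟨ ⊛-comm xs ws ⟩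
      ws ⊛ xs    ≈⟨ ⊛-congˡ ws p ⟩
      ws ⊛ ys    ≈⟨ ⊛-comm ws ys ⟩
      ys ⊛ ws    ∎

    ⊛-distribʳ : ∀ zs xs ys → (xs ++ ys) ⊛ zs ≋ xs ⊛ zs ++ ys ⊛ zs
    ⊛-distribʳ zs []       ys = refl
    ⊛-distribʳ zs (x ∷ xs) ys = trans
      (++-congˡ (x · zs) (⊛-distribʳ zs xs ys))
      (≡⇒≋ (≡.sym (++-assoc (x · zs) (xs ⊛ zs) (ys ⊛ zs))))

    ⊛-distribˡ : ∀ zs xs ys → zs ⊛ (xs ++ ys) ≋ zs ⊛ xs ++ zs ⊛ ys
    ⊛-distribˡ zs xs ys = begin
      zs ⊛ (xs ++ ys)         ≈⟨ ⊛-comm zs (xs ++ ys) ⟩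
      (xs ++ ys) ⊛ zs         ≈⟨ ⊛-distribʳ zs xs ys ⟩
      xs ⊛ zs ++ ys ⊛ zs      ≈⟨ ++-cong (⊛-comm xs zs) (⊛-comm ys zs) ⟩
      zs ⊛ xs ++ zs ⊛ ys      ∎

    ·-assoc : ∀ s t zs → (s ⋆ t) · zs ≋ s · (t · zs)
    ·-assoc s t []       = refl
    ·-assoc s t (z ∷ zs) = prep (K.*-assoc _ _ _) (U.assoc _ _ _) (·-assoc s t zs)

    ·-⊛-assoc : ∀ t ys zs → (t · ys) ⊛ zs ≋ t · (ys ⊛ zs)
    ·-⊛-assoc t []       zs = refl
    ·-⊛-assoc t (y ∷ ys) zs = trans
      (++-cong (·-assoc t y zs) (·-⊛-assoc t ys zs))
      (≡⇒≋ (≡.sym (map-++ (t ⋆_) (y · zs) (ys ⊛ zs))))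

    ⊛-assoc : ∀ xs ys zs → (xs ⊛ ys) ⊛ zs ≋ xs ⊛ (ys ⊛ zs)
    ⊛-assoc []       ys zs = refl
    ⊛-assoc (x ∷ xs) ys zs = trans
      (⊛-distribʳ zs (x · ys) (xs ⊛ ys))
      (++-cong (·-⊛-assoc x ys zs) (⊛-assoc xs ys zs))

    ·-identity : ∀ ys → (K.1# , U.ε) · ys ≋ ys
    ·-identity []       = refl
    ·-identity (y ∷ ys) = prep (K.*-identityˡ _) (U.identityˡ _) (·-identity ys)

    ⊛-identityˡ : ∀ ys → one ⊛ ys ≋ ys
    ⊛-identityˡ ys = trans (≡⇒≋ (++-identityʳ _)) (·-identity ys)

  algebra : CommutativeRing (c ⊔ u) (c ⊔ ℓ ⊔ u ⊔ ℓu)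
  algebra = record
    { Carrier = Sum
    ; _≈_ = _≋_
    ; _+_ = _++_
    ; _*_ = _⊛_
    ; -_ = neg
    ; 0# = []
    ; 1# = one
    ; isCommutativeRing = record
      { isRing = record
        { +-isAbelianGroup = record
          { isGroup = record
            { isMonoid = IsCommutativeMonoid.isMonoid ++-isCommutativeMonoid
            ; inverse = neg-inverseˡ , λ xs → trans (++-comm xs (neg xs)) (neg-inverseˡ xs)
            ; ⁻¹-cong = neg-cong
            }
          ; comm = ++-comm
          }
        ; *-cong = ⊛-cong
        ; *-assoc = ⊛-assoc
        ; *-identity = ⊛-identityˡ , λ xs → trans (⊛-comm xs one) (⊛-identityˡ xs)
        ; distrib = ⊛-distribˡ , ⊛-distribʳ
        }
      ; *-comm = ⊛-comm
      }
    }

  homogeneous : U.Carrier → AbelianGroup.Carrier (units algebra)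
  homogeneous v = ((K.1# , v) ∷ []) , ((K.1# , v U.⁻¹) ∷ []) ,
    prep (K.*-identityˡ K.1#) (U.inverseʳ v) refl

  homogeneous-isHomomorphism : IsHomomorphism U (units algebra) homogeneous
  homogeneous-isHomomorphism = record
    { isMonoidHomomorphism = record
      { isMagmaHomomorphism = record
        { isRelHomomorphism = record { cong = λ v≈w → prep K.refl v≈w refl }
        ; homo = λ v w → prep (K.sym (K.*-identityˡ K.1#)) U.refl refl
        }
      ; ε-homo = refl
      }
    ; ⁻¹-homo = λ v → refl
    }

  -- K^× → K⟨U⟩^×, a ↦ a ⊗ 1.
  scalar : AbelianGroup.Carrier (units K) → AbelianGroup.Carrier (units algebra)
  scalar (a , a⁻¹ , p) = ((a , U.ε) ∷ []) , ((a⁻¹ , U.ε) ∷ []) ,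
    prep p (U.identityˡ U.ε) refl

  scalar-isHomomorphism : IsHomomorphism (units K) (units algebra) scalar
  scalar-isHomomorphism = record
    { isMonoidHomomorphism = record
      { isMagmaHomomorphism = record
        { isRelHomomorphism = record { cong = λ a≈b → prep a≈b U.refl refl }
        ; homo = λ a b → prep K.refl (U.sym (U.identityˡ U.ε)) refl
        }
      ; ε-homo = refl
      }
    ; ⁻¹-homo = λ a → refl
    }

module Extension
  (K : CommutativeRing c ℓ) (U : AbelianGroup u ℓu)
  (ι : AbelianGroup.Carrier (units K) → AbelianGroup.Carrier U)
  (ι-mono : IsMonomorphism (units K) U ι)
  where

  private
    module U = AbelianGroup U

  open UniversalAlgebra K U ι public
    using (homogeneous; scalar; scalar-isHomomorphism)
    renaming (algebra to K⟨U⟩)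

  U/K^× : AbelianGroup _ _
  U/K^× = quotient (units K) U ι
    (GroupMorphisms.IsGroupMonomorphism.isGroupHomomorphism ι-mono)

  K⟨U⟩^×/K^× : AbelianGroup _ _
  K⟨U⟩^×/K^× = quotient (units K) (units K⟨U⟩) scalar scalar-isHomomorphism

  -- U/K^× as a subset of K⟨U⟩^×/K^×, by the map which u ↦ 1 ⊗ u induces
  -- on quotients.
  U/K^×-in-K⟨U⟩^×/K^× : Pred (AbelianGroup.Carrier K⟨U⟩^×/K^×) _
  U/K^×-in-K⟨U⟩^×/K^× = Image U/K^× K⟨U⟩^×/K^× homogeneous

  -- U has an element of order 4 outside K^×.
  HasNewOrder4 : Set _
  HasNewOrder4 = ∃[ x ] (HasOrder U x 4 × ¬ (x ∈ Image (units K) U ι))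

  -- Here -4 is read in K^× ⊆ U, so this is false in characteristic 2,
  -- where -4 = 0 is not a unit.
  -4∈U⁴ : Set _
  -4∈U⁴ = ∃[ x ] ∃[ a ] (proj₁ a K.≈ -4# K × _^_ U x 4 U.≈ ι a)
    where module K = CommutativeRing K

{-# OPTIONS --safe #-}
-- Necessity: if F ∩ K^× = 1 then K^× embeds in U/F, and K⟨U⟩ → K⟨U/F⟩ is a ring homomorphism
-- which kills x - 1 for x ∈ F; if K⟨U⟩ is a field this forces x = 1. A fourth root of -4 in a
-- field has the form ±1 ± i, which is not homogeneous when i ∉ K.
--
-- Sufficiency: enlarge V ⊇ K^× inside U by steps of prime index. If K⟨V⟩ is a field, x ∉ V and
-- xᵖ ∈ V, then K⟨V⟨x⟩⟩ is a field unless xᵖ = zᵖ with z ∈ K⟨V⟩. In that case let v ∈ V and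
-- w = v⁻¹z, of order n in K⟨V⟩^×/K^×. As U is essential, wⁿ satisfies the Vahlen–Capelli
-- conditions, so Xⁿ - wⁿ is irreducible over K and w has trace 0 over K. But this trace is |V/K^×|
-- times the coefficient of z at v, so all coefficients of z vanish, which is absurd. The same
-- computation of coefficients by traces shows that a unit z of p-power order modulo K^× is
-- homogeneous.
module Submission where

open import Algebra.Bundles using (AbelianGroup; CommutativeRing; RawRing)
open import Algebra.Morphism.Structures using (module GroupMorphisms)
import Algebra.Properties.AbelianGroup
import Algebra.Properties.CommutativeMonoid.Mult
import Algebra.Properties.CommutativeSemigroup
import Algebra.Properties.CommutativeSemiring.Exp
import Algebra.Properties.Group
import Algebra.Properties.Ring
import Algebra.Properties.Semiring.Mult
import Algebra.Properties.Semiring.Sum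
import Algebra.Solver.Ring
open import Algebra.Solver.Ring.AlmostCommutativeRing using (AlmostCommutativeRing; _-Raw-AlmostCommutative⟶_; fromCommutativeRing)
import Algebra.Solver.Ring.NaturalCoefficients.Default
open import Axiom.ExcludedMiddle using (ExcludedMiddle)
open import Data.Fin.Base as Fin using (Fin; fromℕ; fromℕ<; inject₁; punchIn; punchOut; suc; toℕ; zero)
open import Data.Fin.Properties as Fin using (punchIn-injective; punchIn-punchOut; punchInᵢ≢i)
open import Data.List.Base using (List; []; _++_; _∷_; concat; foldr; length; lookup; map; tabulate)
open import Data.List.Relation.Unary.All as All using (All; []; _∷_)
import Data.List.Relation.Unary.All.Properties as All
open import Data.Maybe.Base using (Maybe; just; nothing)
open import Data.Nat.Base as ℕ using (_<_; _≤_; suc; zero; ℕ)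
open import Data.Nat.Coprimality using (Coprime; coprime-Bézout; prime⇒coprime)
open import Data.Nat.DivMod using (_%_; _/_; m%n<n; m≡m%n+[m/n]*n)
open import Data.Nat.Divisibility using (_∣?_; _∣_; _∤_; divides; m∣m*n; ∣-trans; ∣⇒≤)
open import Data.Nat.GCD using (module Bézout)
open import Data.Nat.Induction using (<-wellFounded)
open import Data.Nat.ListAction using (product)
open import Data.Nat.Primality using (Prime; euclidsLemma; prime[2]; prime⇒irreducible; prime⇒nonTrivial; prime⇒nonZero)
open import Data.Nat.Primality.Factorisation using (factorise; module PrimeFactorisation)
import Data.Nat.Properties as ℕ
open import Data.Product.Base using (_,_; _×_; proj₁; proj₂; ∃; ∃-syntax)
open import Data.Sum.Base using (_⊎_; inj₁; inj₂)
open import Data.Vec.Functional using (Vector; init; last; removeAt) renaming (_∷_ to _∷ᶠ_)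
open import Defs
open import Function.Base using (_∘_; id)
open import Function.Bundles using (_⇔_; mk⇔; module Equivalence)
open import Induction.WellFounded using (Acc; acc)
open import Level using (Level; Lift; _⊔_; lift)
open import Relation.Binary.Core using (Rel)
open import Relation.Binary.Definitions using (tri<; tri>; tri≈)
open import Relation.Binary.PropositionalEquality.Core as ≡ using (_≡_; _≢_)
import Relation.Binary.Reasoning.Setoid
open import Relation.Nullary.Decidable.Core using (Dec; decidable-stable; no; yes)
open import Relation.Nullary.Negation.Core using (contradiction; ¬_)
open import Relation.Unary using (Pred; _∈_; _∉_; _≐_; _⊆_)

private
  variable
    a c ℓ ℓ₁ ℓ₂ f g r ℓr r′ ℓr′ u ℓu : Level

-- Coefficients a , b stand for the integer a - b, so that the solver
-- recognises cancellation.
module IntegerCoefficients (R : CommutativeRing c ℓ) where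
  open CommutativeRing R
  open Algebra.Properties.Semiring.Mult semiring using (×-homo-+; ×1-homo-*)
    renaming (_×_ to _·_)
  private
    module N = Algebra.Solver.Ring.NaturalCoefficients.Default commutativeSemiring
    module RP = Algebra.Properties.Ring ring

  target : AlmostCommutativeRing c ℓ
  target = fromCommutativeRing R

  reduce : ℕ → ℕ → ℕ × ℕ
  reduce (suc a) (suc b) = reduce a b
  reduce a b = a , b

  Coeff : RawRing _ _
  Coeff = record
    { Carrier = ℕ × ℕ
    ; _≈_ = _≡_
    ; _+_ = λ (a , b) (c , d) → reduce (a ℕ.+ c) (b ℕ.+ d)
    ; _*_ = λ (a , b) (c , d) → reduce (a ℕ.* c ℕ.+ b ℕ.* d) (a ℕ.* d ℕ.+ b ℕ.* c)
    ; -_ = λ (a , b) → b , a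
    ; 0# = 0 , 0
    ; 1# = 1 , 0
    }

  open Relation.Binary.Reasoning.Setoid setoid

  -- The first two clauses make con (0 , 0) and con (1 , 0) mean 0# and 1# on the nose.
  ⟦_⟧ᶜ : ℕ × ℕ → Carrier
  ⟦ 0 , 0 ⟧ᶜ = 0#
  ⟦ 1 , 0 ⟧ᶜ = 1#
  ⟦ a , b ⟧ᶜ = a · 1# + b · 1# * - 1#

  unfold : ∀ a b → ⟦ a , b ⟧ᶜ ≈ a · 1# + b · 1# * - 1#
  unfold 0 0 = sym (trans (+-identityˡ _) (zeroˡ _))
  unfold 1 0 = sym (trans (+-cong (+-identityʳ 1#) (zeroˡ _)) (+-identityʳ _))
  unfold 0 (suc b) = refl
  unfold 1 (suc b) = refl
  unfold (suc (suc a)) b = refl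

  -1*-1 : - 1# * - 1# ≈ 1#
  -1*-1 = begin
    - 1# * - 1#        ≈⟨ RP.-‿distribˡ-* 1# (- 1#) ⟨
    - (1# * - 1#)      ≈⟨ -‿cong (*-identityˡ _) ⟩
    - (- 1#)           ≈⟨ RP.-‿involutive 1# ⟩
    1#                 ∎

  cancelᶜ : ∀ x → x + x * - 1# ≈ 0#
  cancelᶜ x = begin
    x + x * - 1#           ≈⟨ +-congʳ (*-identityʳ x) ⟨
    x * 1# + x * - 1#      ≈⟨ distribˡ x 1# (- 1#) ⟨
    x * (1# + - 1#)        ≈⟨ *-congˡ (-‿inverseʳ 1#) ⟩
    x * 0#                 ≈⟨ zeroʳ x ⟩
    0#                     ∎

  unfold-reduce : ∀ a b → ⟦ reduce a b ⟧ᶜ ≈ a · 1# + b · 1# * - 1#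
  unfold-reduce 0 b = unfold 0 b
  unfold-reduce (suc a) 0 = unfold (suc a) 0
  unfold-reduce (suc a) (suc b) = begin
    ⟦ reduce a b ⟧ᶜ
      ≈⟨ unfold-reduce a b ⟩
    a · 1# + b · 1# * - 1#
      ≈⟨ +-identityʳ _ ⟨
    a · 1# + b · 1# * - 1# + 0#
      ≈⟨ +-congˡ (cancelᶜ 1#) ⟨
    a · 1# + b · 1# * - 1# + (1# + 1# * - 1#)
      ≈⟨ N.solve 4 (λ a b o m → a N.:+ b N.:* m N.:+ (o N.:+ o N.:* m) N.:=
           (o N.:+ a) N.:+ (o N.:+ b) N.:* m) refl (a · 1#) (b · 1#) 1# (- 1#) ⟩
    suc a · 1# + suc b · 1# * - 1# ∎

  morphism : Coeff -Raw-AlmostCommutative⟶ target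
  morphism = record
    { ⟦_⟧ = ⟦_⟧ᶜ
    ; +-homo = λ (a , b) (c , d) → begin
        ⟦ reduce (a ℕ.+ c) (b ℕ.+ d) ⟧ᶜ
          ≈⟨ unfold-reduce (a ℕ.+ c) (b ℕ.+ d) ⟩
        (a ℕ.+ c) · 1# + (b ℕ.+ d) · 1# * - 1#
          ≈⟨ +-cong (×-homo-+ 1# a c) (*-congʳ (×-homo-+ 1# b d)) ⟩
        (a · 1# + c · 1#) + (b · 1# + d · 1#) * - 1#
          ≈⟨ N.solve 5 (λ a b c d m → (a N.:+ c) N.:+ (b N.:+ d) N.:* m N.:=
               (a N.:+ b N.:* m) N.:+ (c N.:+ d N.:* m)) refl _ _ _ _ _ ⟩
        (a · 1# + b · 1# * - 1#) + (c · 1# + d · 1# * - 1#)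
          ≈⟨ +-cong (unfold a b) (unfold c d) ⟨
        ⟦ a , b ⟧ᶜ + ⟦ c , d ⟧ᶜ ∎
    ; *-homo = λ (a , b) (c , d) → begin
        ⟦ reduce (a ℕ.* c ℕ.+ b ℕ.* d) (a ℕ.* d ℕ.+ b ℕ.* c) ⟧ᶜ
          ≈⟨ unfold-reduce (a ℕ.* c ℕ.+ b ℕ.* d) (a ℕ.* d ℕ.+ b ℕ.* c) ⟩
        (a ℕ.* c ℕ.+ b ℕ.* d) · 1# + (a ℕ.* d ℕ.+ b ℕ.* c) · 1# * - 1#
          ≈⟨ +-cong (trans (×-homo-+ 1# (a ℕ.* c) _) (+-cong (×1-homo-* a c) (×1-homo-* b d)))
               (*-congʳ (trans (×-homo-+ 1# (a ℕ.* d) _) (+-cong (×1-homo-* a d) (×1-homo-* b c)))) ⟩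
        (a · 1# * (c · 1#) + b · 1# * (d · 1#)) + (a · 1# * (d · 1#) + b · 1# * (c · 1#)) * - 1#
          ≈⟨ +-congʳ (+-congˡ (trans (*-congˡ -1*-1) (*-identityʳ _))) ⟨
        (a · 1# * (c · 1#) + b · 1# * (d · 1#) * (- 1# * - 1#)) + (a · 1# * (d · 1#) + b · 1# * (c · 1#)) * - 1#
          ≈⟨ N.solve 5 (λ a b c d m →
               (a N.:* c N.:+ b N.:* d N.:* (m N.:* m)) N.:+ (a N.:* d N.:+ b N.:* c) N.:* m N.:=
               (a N.:+ b N.:* m) N.:* (c N.:+ d N.:* m)) refl _ _ _ _ _ ⟩
        (a · 1# + b · 1# * - 1#) * (c · 1# + d · 1# * - 1#)
          ≈⟨ *-cong (unfold a b) (unfold c d) ⟨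
        ⟦ a , b ⟧ᶜ * ⟦ c , d ⟧ᶜ ∎
    ; -‿homo = λ (a , b) → begin
        ⟦ b , a ⟧ᶜ
          ≈⟨ unfold b a ⟩
        b · 1# + a · 1# * - 1#
          ≈⟨ +-congʳ (trans (*-congˡ -1*-1) (*-identityʳ _)) ⟨
        b · 1# * (- 1# * - 1#) + a · 1# * - 1#
          ≈⟨ N.solve 3 (λ a b m → b N.:* (m N.:* m) N.:+ a N.:* m N.:= m N.:* (a N.:+ b N.:* m)) refl _ _ _ ⟩
        - 1# * (a · 1# + b · 1# * - 1#)
          ≈⟨ RP.-1*x≈-x _ ⟩
        - (a · 1# + b · 1# * - 1#)
          ≈⟨ -‿cong (unfold a b) ⟨
        - ⟦ a , b ⟧ᶜ ∎
    ; 0-homo = refl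
    ; 1-homo = refl
    }

  dec : ∀ x y → Maybe (⟦ x ⟧ᶜ ≈ ⟦ y ⟧ᶜ)
  dec (a , b) (c , d) with a ℕ.+ d ℕ.≟ c ℕ.+ b
  ... | no _ = nothing
  ... | yes a+d≡c+b = just (begin
    ⟦ a , b ⟧ᶜ                                ≈⟨ unfold a b ⟩
    A + B * - 1#                              ≈⟨ +-identityʳ _ ⟨
    A + B * - 1# + 0#                         ≈⟨ +-congˡ (cancelᶜ D) ⟨
    A + B * - 1# + (D + D * - 1#)             ≈⟨ regroup A B D ⟩
    (A + D) + (B * - 1# + D * - 1#)           ≈⟨ +-congʳ A+D≈C+B ⟩
    (C + B) + (B * - 1# + D * - 1#)           ≈⟨ regroup′ C B D ⟩
    C + D * - 1# + (B + B * - 1#)             ≈⟨ +-congˡ (cancelᶜ B) ⟩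
    C + D * - 1# + 0#                         ≈⟨ +-identityʳ _ ⟩
    C + D * - 1#                              ≈⟨ unfold c d ⟨
    ⟦ c , d ⟧ᶜ                                ∎)
    where
    A = a · 1#
    B = b · 1#
    C = c · 1#
    D = d · 1#
    A+D≈C+B : A + D ≈ C + B
    A+D≈C+B = trans (sym (×-homo-+ 1# a d))
      (trans (reflexive (≡.cong (_· 1#) a+d≡c+b)) (×-homo-+ 1# c b))
    regroup : ∀ A B D → A + B * - 1# + (D + D * - 1#) ≈ (A + D) + (B * - 1# + D * - 1#)
    regroup A B D = N.solve 4 (λ A B D m →
      A N.:+ B N.:* m N.:+ (D N.:+ D N.:* m) N.:= (A N.:+ D) N.:+ (B N.:* m N.:+ D N.:* m)) refl A B D (- 1#)
    regroup′ : ∀ C B D → (C + B) + (B * - 1# + D * - 1#) ≈ C + D * - 1# + (B + B * - 1#)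
    regroup′ C B D = N.solve 4 (λ C B D m →
      (C N.:+ B) N.:+ (B N.:* m N.:+ D N.:* m) N.:= C N.:+ D N.:* m N.:+ (B N.:+ B N.:* m)) refl C B D (- 1#)

module IntegerSolver (R : CommutativeRing c ℓ) where
  open Algebra.Solver.Ring
    (IntegerCoefficients.Coeff R) (IntegerCoefficients.target R)
    (IntegerCoefficients.morphism R) (IntegerCoefficients.dec R) public
    using (solve; _:=_; _:+_; _:*_; _:-_; :-_; con; Polynomial)

  :0 :1 : ∀ {n} → Polynomial n
  :0 = con (0 , 0)
  :1 = con (1 , 0)

module Determinant (R : CommutativeRing c ℓ) where
  open CommutativeRing R hiding (zero)
  open IntegerSolver R
  open Algebra.Properties.Ring ring using (-0#≈0#)
  open Algebra.Properties.Semiring.Sum semiring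
  open Algebra.Properties.CommutativeSemiring.Exp commutativeSemiring using () renaming (_^_ to _^ʳ_)
  open Relation.Binary.Reasoning.Setoid setoid

  Matrix : ℕ → ℕ → Set c
  Matrix m n = Fin m → Fin n → Carrier

  infix 4 _≈ᵛ_ _≈ᵐ_
  _≈ᵛ_ : ∀ {n} → Vector Carrier n → Vector Carrier n → Set ℓ
  u ≈ᵛ v = ∀ j → u j ≈ v j

  _≈ᵐ_ : ∀ {m n} → Matrix m n → Matrix m n → Set ℓ
  A ≈ᵐ B = ∀ i → A i ≈ᵛ B i

  alternating : ∀ {n} → Vector Carrier n → Carrier
  alternating {zero}  v = 0#
  alternating {suc n} v = v zero - alternating (v ∘ suc)

  minor : ∀ {n} → Fin (suc n) → Matrix (suc n) (suc n) → Matrix n n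
  minor i A k j = A (punchIn i k) (suc j)

  det : ∀ {n} → Matrix n n → Carrier
  det {zero}  A = 1#
  det {suc n} A = alternating λ i → A i zero * det (minor i A)

  alternating-cong : ∀ {n} {u v : Vector Carrier n} → u ≈ᵛ v → alternating u ≈ alternating v
  alternating-cong {zero}  p = refl
  alternating-cong {suc n} p = +-cong (p zero) (-‿cong (alternating-cong (p ∘ suc)))

  alternating-zero : ∀ {n} {v : Vector Carrier n} → (∀ i → v i ≈ 0#) → alternating v ≈ 0#
  alternating-zero {zero}  p = refl
  alternating-zero {suc n} p =
    trans (+-cong (p zero) (-‿cong (alternating-zero (p ∘ suc)))) (trans (+-identityˡ _) -0#≈0#)

  alternating-linear : ∀ {n} x {u v w : Vector Carrier n} →
    (∀ i → w i ≈ x * u i + v i) → alternating w ≈ x * alternating u + alternating v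
  alternating-linear {zero}  x p = sym (trans (+-identityʳ _) (zeroʳ x))
  alternating-linear {suc n} x {u} {v} {w} p = begin
    w zero - alternating (w ∘ suc)
      ≈⟨ +-cong (p zero) (-‿cong (alternating-linear x (p ∘ suc))) ⟩
    (x * u zero + v zero) - (x * alternating (u ∘ suc) + alternating (v ∘ suc))
      ≈⟨ solve 5 (λ x a b c d → (x :* a :+ b) :- (x :* c :+ d) := x :* (a :- c) :+ (b :- d))
           refl x (u zero) (v zero) _ _ ⟩
    x * (u zero - alternating (u ∘ suc)) + (v zero - alternating (v ∘ suc)) ∎

  alternating-adjacent : ∀ {n} {v : Vector Carrier (suc n)} (i : Fin n) → v (inject₁ i) ≈ v (suc i) →
    (∀ k → k ≢ inject₁ i → k ≢ suc i → v k ≈ 0#) → alternating v ≈ 0#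
  alternating-adjacent {suc n} {v} zero p q = begin
    v zero - (v (suc zero) - alternating {n} (λ k → v (suc (suc k))))
      ≈⟨ +-cong p (-‿cong (+-congˡ (-‿cong (alternating-zero {n} {λ k → v (suc (suc k))} λ k → q (suc (suc k))
        (λ ()) (λ ()))))) ⟩
    v (suc zero) - (v (suc zero) - 0#)
      ≈⟨ solve 1 (λ x → x :- (x :- :0) := :0) refl (v (suc zero)) ⟩
    0# ∎
  alternating-adjacent {suc n} {v} (suc i) p q = begin
    v zero - alternating (v ∘ suc)
      ≈⟨ +-cong (q zero (λ ()) (λ ())) (-‿cong (alternating-adjacent i p
           λ k a b → q (suc k) (a ∘ Fin.suc-injective) (b ∘ Fin.suc-injective))) ⟩
    0# - 0#  ≈⟨ -‿inverseʳ 0# ⟩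
    0# ∎

  det-cong : ∀ {n} {A B : Matrix n n} → A ≈ᵐ B → det A ≈ det B
  det-cong {zero}  p = refl
  det-cong {suc n} p = alternating-cong λ i →
    *-cong (p i zero) (det-cong λ k j → p (punchIn i k) (suc j))

  module _ {m : ℕ} where
    Form : ℕ → Set c
    Form n = Matrix n m → Carrier

    record IsAlternating {n} (D : Form n) : Set (c ⊔ ℓ) where
      field
        cong : ∀ {A B} → A ≈ᵐ B → D A ≈ D B
        linear : ∀ i x {A B C} → (∀ k → k ≢ i → C k ≈ᵛ A k) → (∀ k → k ≢ i → C k ≈ᵛ B k) →
          (∀ j → C i j ≈ x * A i j + B i j) → D C ≈ x * D A + D B

    IsAdjacentFree : ∀ {n} → Form (suc n) → Set (c ⊔ ℓ)
    IsAdjacentFree {n} D = ∀ (i : Fin n) A → A (inject₁ i) ≈ᵛ A (suc i) → D A ≈ 0#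

  det-linear : ∀ {n} i x {A B C : Matrix n n} → (∀ k → k ≢ i → C k ≈ᵛ A k) →
    (∀ k → k ≢ i → C k ≈ᵛ B k) → (∀ j → C i j ≈ x * A i j + B i j) → det C ≈ x * det A + det B
  det-linear {suc n} i x {A} {B} {C} p q r = alternating-linear x term
    where
    term : ∀ k → C k zero * det (minor k C) ≈ x * (A k zero * det (minor k A)) + B k zero * det (minor k B)
    term k with k Fin.≟ i
    ... | yes ≡.refl = begin
      C k zero * det (minor k C)
        ≈⟨ *-congʳ (r zero) ⟩
      (x * A k zero + B k zero) * det (minor k C)
        ≈⟨ solve 4 (λ x a b d → (x :* a :+ b) :* d := x :* (a :* d) :+ b :* d) refl x _ _ _ ⟩
      x * (A k zero * det (minor k C)) + B k zero * det (minor k C)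
        ≈⟨ +-cong (*-congˡ (*-congˡ (det-cong λ l j → p (punchIn k l) (punchInᵢ≢i k l) (suc j))))
                  (*-congˡ (det-cong λ l j → q (punchIn k l) (punchInᵢ≢i k l) (suc j))) ⟩
      x * (A k zero * det (minor k A)) + B k zero * det (minor k B) ∎
    ... | no k≢i = begin
      C k zero * det (minor k C)
        ≈⟨ *-congˡ (det-linear (punchOut k≢i) x (λ l l≢ j → p _ (off l≢) (suc j)) (λ l l≢ j → q _ (off l≢)
          (suc j)) at-i) ⟩
      C k zero * (x * det (minor k A) + det (minor k B))
        ≈⟨ solve 4 (λ c x a b → c :* (x :* a :+ b) := x :* (c :* a) :+ c :* b) refl _ x _ _ ⟩
      x * (C k zero * det (minor k A)) + C k zero * det (minor k B)
        ≈⟨ +-cong (*-congˡ (*-congʳ (p k k≢i zero))) (*-congʳ (q k k≢i zero)) ⟩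
      x * (A k zero * det (minor k A)) + B k zero * det (minor k B) ∎
      where
      off : ∀ {l} → l ≢ punchOut k≢i → punchIn k l ≢ i
      off l≢ eq = l≢ (punchIn-injective k _ _ (≡.trans eq (≡.sym (punchIn-punchOut k≢i))))
      at-i : ∀ j → minor k C (punchOut k≢i) j ≈ x * minor k A (punchOut k≢i) j + minor k B (punchOut k≢i) j
      at-i j rewrite punchIn-punchOut k≢i = r (suc j)

  private
    punchIn-adjacent : ∀ {n} (i : Fin n) (k : Fin n) →
      punchIn (inject₁ i) k ≡ punchIn (suc i) k ⊎ (punchIn (inject₁ i) k ≡ suc i × punchIn (suc i) k ≡ inject₁ i)
    punchIn-adjacent zero zero = inj₂ (≡.refl , ≡.refl)
    punchIn-adjacent zero (suc k) = inj₁ ≡.refl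
    punchIn-adjacent (suc i) zero = inj₁ ≡.refl
    punchIn-adjacent (suc i) (suc k) with punchIn-adjacent i k
    ... | inj₁ p = inj₁ (≡.cong suc p)
    ... | inj₂ (p , q) = inj₂ (≡.cong suc p , ≡.cong suc q)

    adjacent-preimage : ∀ {n} (k : Fin (suc (suc n))) (i : Fin (suc n)) → k ≢ inject₁ i → k ≢ suc i →
      ∃[ j ] (punchIn k (inject₁ j) ≡ inject₁ i × punchIn k (suc j) ≡ suc i)
    adjacent-preimage zero zero a b = contradiction ≡.refl a
    adjacent-preimage zero (suc i) a b = i , ≡.refl , ≡.refl
    adjacent-preimage (suc zero) zero a b = contradiction ≡.refl b
    adjacent-preimage {suc n} (suc (suc k)) zero a b = zero , ≡.refl , ≡.refl
    adjacent-preimage {suc n} (suc k) (suc i) a b =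
      let j , p , q = adjacent-preimage k i (a ∘ ≡.cong suc) (b ∘ ≡.cong suc)
      in suc j , ≡.cong suc p , ≡.cong suc q

  det-adjacent : ∀ {n} (i : Fin n) (A : Matrix (suc n) (suc n)) → A (inject₁ i) ≈ᵛ A (suc i) → det A ≈ 0#
  det-adjacent {suc n} i A p = alternating-adjacent i (*-cong (p zero) (det-cong minors)) other
    where
    minors : minor (inject₁ i) A ≈ᵐ minor (suc i) A
    minors k j with punchIn-adjacent i k
    ... | inj₁ eq = reflexive (≡.cong (λ l → A l (suc j)) eq)
    ... | inj₂ (eq , eq′) rewrite eq | eq′ = sym (p (suc j))
    other : ∀ k → k ≢ inject₁ i → k ≢ suc i → A k zero * det (minor k A) ≈ 0#
    other k a b with adjacent-preimage k i a b
    ... | j , eq , eq′ = trans (*-congˡ (det-adjacent j (minor k A) rows)) (zeroʳ _)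
      where
      rows : minor k A (inject₁ j) ≈ᵛ minor k A (suc j)
      rows l rewrite eq | eq′ = p (suc l)

  module _ {m : ℕ} where
    -- Fixing the first argument of a form gives a form with the same properties,
    -- so alternation is only ever used in the first two arguments.
    Alternating : ∀ {n} → Form {m} n → Set (c ⊔ ℓ)
    Alternating {zero}        D = IsAlternating D
    Alternating {suc n} D = IsAlternating D × IsAdjacentFree D

    isAlternating : ∀ {n} {D : Form {m} n} → Alternating D → IsAlternating D
    isAlternating {zero} d = d
    isAlternating {suc n} (d , _) = d

    ∷ᶠ-cong : ∀ {n} {v : Vector Carrier m} {A B : Matrix n m} → A ≈ᵐ B → (v ∷ᶠ A) ≈ᵐ (v ∷ᶠ B)
    ∷ᶠ-cong p zero j = refl
    ∷ᶠ-cong p (suc i) j = p i j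

    fix-first : ∀ {n} {D : Form {m} (suc n)} → Alternating D → ∀ v → Alternating (λ A → D (v ∷ᶠ A))
    fix-first {n} {D} (d , free) v = go n ≡.refl
      where
      open IsAlternating d
      lin : IsAlternating (λ A → D (v ∷ᶠ A))
      lin = record
        { cong = λ p → cong (∷ᶠ-cong p)
        ; linear = λ i x p q r → linear (suc i) x
            (λ { zero _ _ → refl ; (suc k) a → p k (a ∘ ≡.cong suc) })
            (λ { zero _ _ → refl ; (suc k) a → q k (a ∘ ≡.cong suc) }) r
        }
      go : ∀ n′ → (eq : n′ ≡ n) → Alternating (λ A → D (v ∷ᶠ A))
      go zero ≡.refl = lin
      go (suc n′) ≡.refl = lin , λ i A p → free (suc i) (v ∷ᶠ A) p

    split-first : ∀ {n} {D : Form {m} (suc n)} → Alternating D → ∀ x u v A →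
      D ((λ j → x * u j + v j) ∷ᶠ A) ≈ x * D (u ∷ᶠ A) + D (v ∷ᶠ A)
    split-first (d , _) x u v A = IsAlternating.linear d zero x
      (λ { zero a → contradiction ≡.refl a ; (suc k) _ _ → refl })
      (λ { zero a → contradiction ≡.refl a ; (suc k) _ _ → refl }) (λ _ → refl)

    swap-first : ∀ {n} {D : Form {m} (suc (suc n))} → Alternating D → ∀ u v A →
      D (u ∷ᶠ v ∷ᶠ A) ≈ - D (v ∷ᶠ u ∷ᶠ A)
    swap-first {D = D} alt@(d , free) u v A = begin
      D (u ∷ᶠ v ∷ᶠ A)
        ≈⟨ solve 2 (λ p q → p := (p :+ q) :- q) refl _ (D (v ∷ᶠ u ∷ᶠ A)) ⟩
      (D (u ∷ᶠ v ∷ᶠ A) + D (v ∷ᶠ u ∷ᶠ A)) - D (v ∷ᶠ u ∷ᶠ A)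
        ≈⟨ +-congʳ sum-zero ⟩
      0# - D (v ∷ᶠ u ∷ᶠ A)
        ≈⟨ +-identityˡ _ ⟩
      - D (v ∷ᶠ u ∷ᶠ A) ∎
      where
      w : Vector Carrier m
      w j = 1# * u j + v j
      diag : ∀ a → D (a ∷ᶠ a ∷ᶠ A) ≈ 0#
      diag a = free zero (a ∷ᶠ a ∷ᶠ A) (λ _ → refl)
      second : ∀ a → D (a ∷ᶠ w ∷ᶠ A) ≈ 1# * D (a ∷ᶠ u ∷ᶠ A) + D (a ∷ᶠ v ∷ᶠ A)
      second a = split-first (fix-first alt a) 1# u v A
      sum-zero : D (u ∷ᶠ v ∷ᶠ A) + D (v ∷ᶠ u ∷ᶠ A) ≈ 0#
      sum-zero = begin
        D (u ∷ᶠ v ∷ᶠ A) + D (v ∷ᶠ u ∷ᶠ A)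
          ≈⟨ solve 2 (λ p q → p :+ q := :1 :* (:1 :* :0 :+ p) :+ (:1 :* q :+ :0)) refl _ _ ⟩
        1# * (1# * 0# + D (u ∷ᶠ v ∷ᶠ A)) + (1# * D (v ∷ᶠ u ∷ᶠ A) + 0#)
          ≈⟨ +-cong (*-congˡ (+-congʳ (*-congˡ (diag u)))) (+-congˡ (diag v)) ⟨
        1# * (1# * D (u ∷ᶠ u ∷ᶠ A) + D (u ∷ᶠ v ∷ᶠ A)) + (1# * D (v ∷ᶠ u ∷ᶠ A) + D (v ∷ᶠ v ∷ᶠ A))
          ≈⟨ +-cong (*-congˡ (second u)) (second v) ⟨
        1# * D (u ∷ᶠ w ∷ᶠ A) + D (v ∷ᶠ w ∷ᶠ A)
          ≈⟨ split-first alt 1# u v (w ∷ᶠ A) ⟨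
        D (w ∷ᶠ w ∷ᶠ A)
          ≈⟨ diag w ⟩
        0# ∎

    expand : ∀ {n} {D : Form {m} (suc n)} → Alternating D →
      ∀ (a : Vector Carrier (suc n)) e (A : Matrix (suc n) m) →
      D (λ i j → a i * e j + A i j) ≈ D A + alternating (λ i → a i * D (e ∷ᶠ removeAt A i))
    expand {zero} {D} alt a e A = begin
      D (λ i j → a i * e j + A i j)
        ≈⟨ cong (λ { zero _ → refl }) ⟩
      D ((λ j → a zero * e j + A zero j) ∷ᶠ A ∘ suc)
        ≈⟨ split-first alt (a zero) e (A zero) (A ∘ suc) ⟩
      a zero * D (e ∷ᶠ A ∘ suc) + D (A zero ∷ᶠ A ∘ suc)
        ≈⟨ +-cong (*-congˡ (cong (λ { zero _ → refl }))) (cong (λ { zero _ → refl })) ⟩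
      a zero * D (e ∷ᶠ removeAt A zero) + D A
        ≈⟨ solve 2 (λ p q → p :+ q := q :+ (p :- :0)) refl _ _ ⟩
      D A + (a zero * D (e ∷ᶠ removeAt A zero) - 0#) ∎
      where open IsAlternating (isAlternating alt)
    expand {suc n} {D} alt@(d , free) a e A = begin
      D (λ i j → a i * e j + A i j)
        ≈⟨ cong (λ { zero _ → refl ; (suc _) _ → refl }) ⟩
      D ((λ j → a zero * e j + A zero j) ∷ᶠ rest)
        ≈⟨ split-first alt (a zero) e (A zero) rest ⟩
      a zero * D (e ∷ᶠ rest) + D (A zero ∷ᶠ rest)
        ≈⟨ +-cong (*-congˡ (expand (fix-first alt e) (a ∘ suc) e (A ∘ suc)))
                  (expand (fix-first alt (A zero)) (a ∘ suc) e (A ∘ suc)) ⟩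
      a zero * (D (e ∷ᶠ A ∘ suc) + alternating (λ i → a (suc i) * D (e ∷ᶠ e ∷ᶠ removeAt (A ∘ suc) i))) +
      (D (A zero ∷ᶠ A ∘ suc) + alternating (λ i → a (suc i) * D (A zero ∷ᶠ e ∷ᶠ removeAt (A ∘ suc) i)))
        ≈⟨ +-cong (*-congˡ (+-congˡ (alternating-zero {suc n} λ i →
                     trans (*-congˡ (free zero (e ∷ᶠ e ∷ᶠ removeAt (A ∘ suc) i) λ _ → refl)) (zeroʳ (a (suc i))))))
                  (+-cong (cong λ { zero _ → refl ; (suc _) _ → refl })
                     (alternating-linear {suc n} (- 1#) λ i → trans
                       (*-congˡ (trans (swap-first alt (A zero) e (removeAt (A ∘ suc) i))
                       (-‿cong (cong {e ∷ᶠ A zero ∷ᶠ removeAt (A ∘ suc) i} {e ∷ᶠ removeAt A (suc i)}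
                         λ { zero _ → refl ; (suc zero) _ → refl ; (suc (suc _)) _ → refl }))))
                       (solve 2 (λ a d → a :* (:- d) := (:- :1) :* (a :* d) :+ :0) refl (a (suc i)) _))) ⟩
      a zero * (D (e ∷ᶠ A ∘ suc) + 0#) + (D A + (- 1# * α + alternating (λ (_ : Fin (suc n)) → 0#)))
        ≈⟨ +-congˡ (+-congˡ (+-congˡ (alternating-zero {n = suc n} λ _ → refl))) ⟩
      a zero * (D (e ∷ᶠ A ∘ suc) + 0#) + (D A + (- 1# * α + 0#))
        ≈⟨ solve 4 (λ a x y z → a :* (x :+ :0) :+ (y :+ ((:- :1) :* z :+ :0)) := y :+ (a :* x :- z)) refl _ _ _ _ ⟩
      D A + (a zero * D (e ∷ᶠ A ∘ suc) - α) ∎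
      where
      open IsAlternating d
      rest : Matrix (suc n) m
      rest i j = a (suc i) * e j + A (suc i) j
      α = alternating (λ i → a (suc i) * D (e ∷ᶠ removeAt A (suc i)))

  infixl 7 _⊡_
  _⊡_ : ∀ {l m n} → Matrix l m → Matrix m n → Matrix l n
  (A ⊡ B) i k = ∑[ j < _ ] (A i j * B j k)

  module _ {m : ℕ} where
    few-generators : ∀ {n k} → k ℕ.< n → {D : Form {m} n} → Alternating D →
      ∀ (A : Matrix n k) (E : Matrix k m) → D (A ⊡ E) ≈ 0#
    few-generators {suc n} {zero} k<n {D} (d , _) A E = begin
      D (A ⊡ E)
        ≈⟨ linear zero (- 1#) (λ _ _ _ → refl) (λ _ _ _ → refl)
             (λ j → solve 0 (:0 := (:- :1) :* :0 :+ :0) refl) ⟩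
      - 1# * D (A ⊡ E) + D (A ⊡ E)
        ≈⟨ solve 1 (λ x → (:- :1) :* x :+ x := :0) refl _ ⟩
      0# ∎
      where
      open IsAlternating d
    few-generators {suc n} {suc k} k<n {D} alt A E = begin
      D (A ⊡ E)
        ≈⟨ expand alt (λ i → A i zero) (E zero) ((λ i → A i ∘ suc) ⊡ (E ∘ suc)) ⟩
      D ((λ i → A i ∘ suc) ⊡ (E ∘ suc)) + alternating
        (λ i → A i zero * D (E zero ∷ᶠ removeAt ((λ i → A i ∘ suc) ⊡ (E ∘ suc)) i))
        ≈⟨ +-cong (few-generators (ℕ.<-trans (ℕ.n<1+n k) k<n) alt _ _)
             (alternating-zero {suc n} λ i → trans (*-congˡ (few-generators (ℕ.s<s⁻¹ k<n) (fix-first alt (E zero))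
               (λ l → A (punchIn i l) ∘ suc) (E ∘ suc))) (zeroʳ (A i zero))) ⟩
      0# + 0#
        ≈⟨ +-identityˡ 0# ⟩
      0# ∎

    form-⊡ : ∀ {n} {D : Form {m} n} → Alternating D →
      ∀ (A : Matrix n n) (E : Matrix n m) → D (A ⊡ E) ≈ det A * D E
    form-⊡ {zero} alt A E = trans (IsAlternating.cong alt λ ()) (sym (*-identityˡ _))
    form-⊡ {suc n} {D} alt A E = begin
      D (A ⊡ E)
        ≈⟨ expand alt (λ i → A i zero) (E zero) A′E ⟩
      D A′E + alternating (λ i → A i zero * D (E zero ∷ᶠ removeAt A′E i))
        ≈⟨ +-cong (few-generators (ℕ.n<1+n n) alt _ _) (alternating-linear {suc n} (D E) λ i →
             trans (*-congˡ (form-⊡ (fix-first alt (E zero)) (minor i A) (E ∘ suc)))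
             (trans (*-congˡ (*-congˡ (cong λ { zero _ → refl ; (suc _) _ → refl })))
               (solve 3 (λ a d e → a :* (d :* e) := e :* (a :* d) :+ :0) refl (A i zero) (det (minor i A)) (D E)))) ⟩
      0# + (D E * det A + alternating (λ (_ : Fin (suc n)) → 0#))
        ≈⟨ +-congˡ (+-congˡ (alternating-zero {n = suc n} λ _ → refl)) ⟩
      0# + (D E * det A + 0#)
        ≈⟨ solve 2 (λ d e → :0 :+ (e :* d :+ :0) := d :* e) refl _ _ ⟩
      det A * D E ∎
      where
      open IsAlternating (isAlternating alt)
      A′E = (λ i → A i ∘ suc) ⊡ (E ∘ suc)

  det-alternating : ∀ {n} → Alternating (det {n})
  det-alternating {zero} = record { cong = det-cong ; linear = det-linear }
  det-alternating {suc n} = record { cong = det-cong ; linear = det-linear } , det-adjacent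

  det-⊡ : ∀ {n} (A B : Matrix n n) → det (A ⊡ B) ≈ det A * det B
  det-⊡ = form-⊡ det-alternating

  δ : ∀ {n} → Fin n → Fin n → Carrier
  δ zero    zero    = 1#
  δ zero    (suc j) = 0#
  δ (suc i) zero    = 0#
  δ (suc i) (suc j) = δ i j

  scalarMatrix : ∀ {n} → Carrier → Matrix n n
  scalarMatrix x i j = x * δ i j

  det-scalar : ∀ n x → det (scalarMatrix {n} x) ≈ x ^ʳ n
  det-scalar zero x = refl
  det-scalar (suc n) x = begin
    x * 1# * det (scalarMatrix {n} x) - alternating (λ (i : Fin n) → x * 0# * det (minor (suc i) (scalarMatrix x)))
      ≈⟨ +-cong (*-cong (*-identityʳ x) (det-scalar n x))
           (-‿cong (alternating-zero {n} λ i → trans (*-congʳ (zeroʳ x))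
             (zeroˡ (det (minor (suc i) (scalarMatrix x)))))) ⟩
    x * x ^ʳ n - 0#
      ≈⟨ solve 1 (λ y → y :- :0 := y) refl _ ⟩
    x * x ^ʳ n ∎

  lastEntry : ∀ {n} → Carrier → Vector Carrier (suc n)
  lastEntry {zero}  x _       = x
  lastEntry {suc n} x zero    = 0#
  lastEntry {suc n} x (suc i) = lastEntry x i

  -- The matrix of multiplication by y in the basis 1 , y , … , yⁿ when yⁿ⁺¹ = x.
  companion : ∀ {n} → Carrier → Matrix (suc n) (suc n)
  companion x i zero    = lastEntry x i
  companion x i (suc j) = δ (inject₁ j) i

  companion-row : ∀ {n} x (v : Vector Carrier (suc n)) (i : Fin (suc n)) → v (fromℕ n) ≈ x →
    lastEntry x i + ∑[ j < n ] (δ (inject₁ j) i * v (inject₁ j)) ≈ v i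
  companion-row {zero} x v zero p = trans (+-identityʳ x) (sym p)
  companion-row {suc n} x v zero p = begin
    0# + (1# * v zero + ∑[ j < n ] (0# * v (suc (inject₁ j))))
      ≈⟨ +-congˡ (+-congˡ (*-distribˡ-sum {n} 0# λ j → v (suc (inject₁ j)))) ⟨
    0# + (1# * v zero + 0# * sum {n} (λ j → v (suc (inject₁ j))))
      ≈⟨ solve 2 (λ a b → :0 :+ (:1 :* a :+ :0 :* b) := a) refl _ _ ⟩
    v zero ∎
  companion-row {suc n} x v (suc i) p =
    trans (+-congˡ (trans (+-congʳ (zeroˡ _)) (+-identityˡ _))) (companion-row x (v ∘ suc) i p)

  signed : ℕ → Carrier → Carrier
  signed zero x = x
  signed (suc n) x = - signed n x

  alternating-lastEntry : ∀ {n} (v : Vector Carrier (suc n)) x → v ≈ᵛ lastEntry x → alternating v ≈ signed n x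
  alternating-lastEntry {zero} v x p = trans (+-cong (p zero) -0#≈0#) (+-identityʳ x)
  alternating-lastEntry {suc n} v x p =
    trans (+-cong (p zero) (-‿cong (alternating-lastEntry (v ∘ suc) x (p ∘ suc)))) (+-identityˡ _)

  det-companion : ∀ n x → det (companion {n} x) ≈ signed n x
  det-companion n x = alternating-lastEntry {n} _ x (entries {n} x)
    where
    δ-punchIn : ∀ {n} (k j : Fin n) → δ (inject₁ j) (punchIn (fromℕ n) k) ≈ δ k j
    δ-punchIn zero zero = refl
    δ-punchIn zero (suc j) = refl
    δ-punchIn (suc k) zero = refl
    δ-punchIn (suc k) (suc j) = δ-punchIn k j
    entries : ∀ {n} x (i : Fin (suc n)) → lastEntry x i * det (minor i (companion x)) ≈ lastEntry x i
    entries {n} x i = lemma n i x (det (minor i (companion x))) λ { ≡.refl → begin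
      det (minor (fromℕ n) (companion x))
        ≈⟨ det-cong {n} (λ k j → trans (δ-punchIn k j) (sym (*-identityˡ _))) ⟩
      det (scalarMatrix {n} 1#)
        ≈⟨ det-scalar n 1# ⟩
      1# ^ʳ n
        ≈⟨ 1^ n ⟩
      1# ∎ }
      where
      1^ : ∀ n → 1# ^ʳ n ≈ 1#
      1^ zero = refl
      1^ (suc n) = trans (*-identityˡ _) (1^ n)
      lemma : ∀ n (i : Fin (suc n)) x y → (i ≡ fromℕ n → y ≈ 1#) → lastEntry x i * y ≈ lastEntry x i
      lemma zero zero x y p = trans (*-congˡ (p ≡.refl)) (*-identityʳ x)
      lemma (suc n) zero x y p = zeroˡ y
      lemma (suc n) (suc i) x y p = lemma n i x y (p ∘ ≡.cong suc)

module Powers (G : AbelianGroup a ℓ) where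
  open AbelianGroup G
  open Algebra.Properties.Group group using (⁻¹-anti-homo-∙; ε⁻¹≈ε)
  open Algebra.Properties.AbelianGroup G using (⁻¹-∙-comm)
  private
    module M = Algebra.Properties.CommutativeMonoid.Mult commutativeMonoid
  open Relation.Binary.Reasoning.Setoid setoid

  infixl 8 _↑_
  _↑_ : Carrier → ℕ → Carrier
  _↑_ = _^_ G

  ↑-cong : ∀ n {x y} → x ≈ y → x ↑ n ≈ y ↑ n
  ↑-cong n = M.×-congʳ n

  ↑-+ : ∀ x m n → x ↑ (m ℕ.+ n) ≈ x ↑ m ∙ x ↑ n
  ↑-+ = M.×-homo-+

  ↑-* : ∀ x m n → x ↑ (m ℕ.* n) ≈ (x ↑ n) ↑ m
  ↑-* x m n = sym (M.×-assocˡ x m n)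

  ↑-*′ : ∀ x m n → x ↑ (m ℕ.* n) ≈ (x ↑ m) ↑ n
  ↑-*′ x m n = trans (reflexive (≡.cong (x ↑_) (ℕ.*-comm m n))) (↑-* x n m)

  ↑-∙ : ∀ x y n → (x ∙ y) ↑ n ≈ x ↑ n ∙ y ↑ n
  ↑-∙ = M.×-distrib-+

  ↑-1 : ∀ x → x ↑ 1 ≈ x
  ↑-1 x = identityʳ x

  ε↑ : ∀ n → ε ↑ n ≈ ε
  ε↑ zero = refl
  ε↑ (suc n) = trans (identityˡ _) (ε↑ n)

  ⁻¹-↑ : ∀ x n → (x ⁻¹) ↑ n ≈ (x ↑ n) ⁻¹
  ⁻¹-↑ x zero = sym ε⁻¹≈ε
  ⁻¹-↑ x (suc n) = trans (∙-congˡ (⁻¹-↑ x n)) (⁻¹-∙-comm x (x ↑ n))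

  module _ {S : Pred Carrier g} (S-sub : IsSubgroup G S) where
    open IsSubgroup S-sub

    ↑-closed : ∀ {x} n → x ∈ S → x ↑ n ∈ S
    ↑-closed zero    p = ε-closed
    ↑-closed (suc n) p = ∙-closed p (↑-closed n p)

    ∙-cancelˡ-closed : ∀ {x y} → x ∈ S → x ∙ y ∈ S → y ∈ S
    ∙-cancelˡ-closed {x} {y} p q = resp eq (∙-closed (⁻¹-closed p) q)
      where
      eq : x ⁻¹ ∙ (x ∙ y) ≈ y
      eq = trans (sym (assoc _ _ _)) (trans (∙-congʳ (inverseˡ x)) (identityˡ y))

    ∙-cancelʳ-closed : ∀ {x y} → y ∈ S → x ∙ y ∈ S → x ∈ S
    ∙-cancelʳ-closed p q = ∙-cancelˡ-closed p (resp (comm _ _) q)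

    coprime-powers : ∀ {m n} → Coprime m n → ∀ {x} → x ↑ m ∈ S → x ↑ n ∈ S → x ∈ S
    coprime-powers {m} {n} cop {x} p q with coprime-Bézout cop
    ... | Bézout.+- i j eq = ∙-cancelʳ-closed (resp (sym (↑-* x j n)) (↑-closed j q))
      (resp (trans (sym (↑-* x i m)) (reflexive (≡.cong (x ↑_) (≡.sym eq)))) (↑-closed i p))
    ... | Bézout.-+ i j eq = ∙-cancelʳ-closed (resp (sym (↑-* x i m)) (↑-closed i p))
      (resp (trans (sym (↑-* x j n)) (reflexive (≡.cong (x ↑_) (≡.sym eq)))) (↑-closed j q))

module Subrings (R : CommutativeRing c ℓ) where
  open CommutativeRing R hiding (zero)
  open IntegerSolver R
  open Algebra.Properties.Semiring.Sum semiring
  open Algebra.Properties.CommutativeSemiring.Exp commutativeSemiring public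
    renaming (_^_ to _^ʳ_)
  open Determinant R
  open Relation.Binary.Reasoning.Setoid setoid

  record IsSubring (F : Pred Carrier f) : Set (c ⊔ ℓ ⊔ f) where
    field
      resp     : ∀ {x y} → x ≈ y → x ∈ F → y ∈ F
      0-closed : 0# ∈ F
      1-closed : 1# ∈ F
      +-closed : ∀ {x y} → x ∈ F → y ∈ F → x + y ∈ F
      *-closed : ∀ {x y} → x ∈ F → y ∈ F → x * y ∈ F
      -‿closed : ∀ {x} → x ∈ F → - x ∈ F

    ∑-closed : ∀ {n} {v : Vector Carrier n} → (∀ i → v i ∈ F) → sum v ∈ F
    ∑-closed {zero}  p = 0-closed
    ∑-closed {suc n} p = +-closed (p zero) (∑-closed (p ∘ suc))

    ^-closed : ∀ {x} n → x ∈ F → x ^ʳ n ∈ F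
    ^-closed zero    p = 1-closed
    ^-closed (suc n) p = *-closed p (^-closed n p)

    alternating-closed : ∀ {n} {v : Vector Carrier n} → (∀ i → v i ∈ F) → alternating v ∈ F
    alternating-closed {zero}  p = 0-closed
    alternating-closed {suc n} p = +-closed (p zero) (-‿closed (alternating-closed (p ∘ suc)))

    det-closed : ∀ {n} {A : Matrix n n} → (∀ i j → A i j ∈ F) → det A ∈ F
    det-closed {zero}  p = 1-closed
    det-closed {suc n} p =
      alternating-closed λ i → *-closed (p i zero) (det-closed λ k j → p (punchIn i k) (suc j))

    δ-closed : ∀ {n} (i j : Fin n) → δ i j ∈ F
    δ-closed zero zero = 1-closed
    δ-closed zero (suc j) = 0-closed
    δ-closed (suc i) zero = 0-closed
    δ-closed (suc i) (suc j) = δ-closed i j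

    lastEntry-closed : ∀ {n x} → x ∈ F → (i : Fin (suc n)) → lastEntry x i ∈ F
    lastEntry-closed {zero} p i = p
    lastEntry-closed {suc n} p zero = 0-closed
    lastEntry-closed {suc n} p (suc i) = lastEntry-closed p i

  HasInverses : Pred Carrier f → Set _
  HasInverses F = ∀ {x} → x ∈ F → ¬ (x ≈ 0#) → ∃[ y ] (y ∈ F × x * y ≈ 1#)

  linear : ∀ {n} → Vector Carrier n → Vector Carrier n → Carrier
  linear q b = sum λ i → q i * b i

  linear-δ : ∀ {n} (k : Fin n) (b : Vector Carrier n) → linear (δ k) b ≈ b k
  linear-δ {suc n} zero b = trans (+-congˡ (sym (*-distribˡ-sum {n} 0# (b ∘ suc))))
    (solve 2 (λ x y → :1 :* x :+ :0 :* y := x) refl _ _)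
  linear-δ {suc n} (suc k) b = trans (+-cong (zeroˡ _) (linear-δ k (b ∘ suc))) (+-identityˡ _)

  powers : ∀ {n} → Carrier → Vector Carrier n
  powers x i = x ^ʳ toℕ i

  Independent : Pred Carrier f → ∀ {n} → Vector Carrier n → Set _
  Independent F b = ∀ q → (∀ i → q i ∈ F) → linear q b ≈ 0# → ∀ i → q i ≈ 0#

  Span : Pred Carrier f → ∀ {n} → Vector Carrier n → Pred Carrier _
  Span F b y = ∃[ q ] ((∀ i → q i ∈ F) × y ≈ linear q b)

  record IsCongruence (F : Pred Carrier f) (z : Carrier) (_∼_ : Rel Carrier r) : Set (c ⊔ ℓ ⊔ f ⊔ r) where
    field
      reflexive∼ : ∀ {x y} → x ≈ y → x ∼ y
      sym∼       : ∀ {x y} → x ∼ y → y ∼ x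
      trans∼     : ∀ {x y w} → x ∼ y → y ∼ w → x ∼ w
      +-cong∼    : ∀ {x y v w} → x ∼ y → v ∼ w → (x + v) ∼ (y + w)
      scale∼     : ∀ {q x y} → q ∈ F → x ∼ y → (q * x) ∼ (q * y)
      mul∼       : ∀ {x y} → x ∼ y → (z * x) ∼ (z * y)

    ∑-cong∼ : ∀ {n} {v w : Vector Carrier n} → (∀ i → v i ∼ w i) → sum v ∼ sum w
    ∑-cong∼ {zero}  p = reflexive∼ refl
    ∑-cong∼ {suc n} p = +-cong∼ (p zero) (∑-cong∼ (p ∘ suc))

  ≈-isCongruence : ∀ (F : Pred Carrier f) z → IsCongruence F z _≈_
  ≈-isCongruence F z = record
    { reflexive∼ = λ p → p ; sym∼ = sym ; trans∼ = trans ; +-cong∼ = +-cong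
    ; scale∼ = λ _ → *-congˡ ; mul∼ = *-congˡ }

  linear-⊡ : ∀ {m n} (q : Vector Carrier m) (A : Matrix m n) (b : Vector Carrier n) →
    linear q (λ i → linear (A i) b) ≈ linear (λ k → linear q (λ i → A i k)) b
  linear-⊡ {m} {n} q A b = begin
    ∑[ i < m ] (q i * ∑[ k < n ] (A i k * b k))
      ≈⟨ sum-cong-≋ (λ i → trans (*-distribˡ-sum {n} (q i) (λ k → A i k * b k))
           (sum-cong-≋ {n} λ k → sym (*-assoc (q i) (A i k) (b k)))) ⟩
    ∑[ i < m ] ∑[ k < n ] (q i * A i k * b k)
      ≈⟨ ∑-comm (λ i k → q i * A i k * b k) ⟩
    ∑[ k < n ] ∑[ i < m ] (q i * A i k * b k)
      ≈⟨ sum-cong-≋ (λ k → *-distribʳ-sum {m} (b k) (λ i → q i * A i k)) ⟨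
    ∑[ k < n ] (∑[ i < m ] (q i * A i k) * b k) ∎

  linear-* : ∀ {n} x (q b : Vector Carrier n) → x * linear q b ≈ linear q (λ i → x * b i)
  linear-* {n} x q b = trans (*-distribˡ-sum {n} x (λ i → q i * b i))
    (sum-cong-≋ {n} λ i → solve 3 (λ x q b → x :* (q :* b) := q :* (x :* b)) refl x (q i) (b i))

  linear-*ˡ : ∀ {n} x (q b : Vector Carrier n) → x * linear q b ≈ linear (λ i → x * q i) b
  linear-*ˡ {n} x q b = trans (*-distribˡ-sum {n} x (λ i → q i * b i))
    (sum-cong-≋ {n} λ i → sym (*-assoc x (q i) (b i)))

  linear-- : ∀ {n} (p q b : Vector Carrier n) → linear (λ i → p i - q i) b ≈ linear p b - linear q b
  linear-- {n} p q b = begin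
    ∑[ i < n ] ((p i - q i) * b i)
      ≈⟨ sum-cong-≋ {n} (λ i → solve 3 (λ p q b → (p :- q) :* b := p :* b :+ (:- :1) :* (q :* b)) refl (p i) (q i)
        (b i)) ⟩
    ∑[ i < n ] (p i * b i + - 1# * (q i * b i))
      ≈⟨ ∑-distrib-+ {n} (λ i → p i * b i) (λ i → - 1# * (q i * b i)) ⟩
    linear p b + ∑[ i < n ] (- 1# * (q i * b i))
      ≈⟨ +-congˡ (*-distribˡ-sum {n} (- 1#) (λ i → q i * b i)) ⟨
    linear p b + - 1# * linear q b
      ≈⟨ solve 2 (λ x y → x :+ (:- :1) :* y := x :- y) refl _ _ ⟩
    linear p b - linear q b ∎

  -- The norm argument: if z is represented by the matrix Z modulo ∼, then zᵖ is
  -- represented by Zᵖ, and determinants are multiplicative.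
  module Representation {F : Pred Carrier f} (F-sub : IsSubring F) {z : Carrier} {_∼_ : Rel Carrier r}
    (cong∼ : IsCongruence F z _∼_) {d : ℕ} (b : Vector Carrier d)
    (indep : ∀ q → (∀ i → q i ∈ F) → linear q b ∼ 0# → ∀ i → q i ≈ 0#) where

    open IsSubring F-sub
    open IsCongruence cong∼

    Represents : Matrix d d → Carrier → Set _
    Represents Z t = (∀ i j → Z i j ∈ F) × (∀ i → (t * b i) ∼ linear (Z i) b)

    represents-unique : ∀ {Y Z t} → Represents Y t → Represents Z t → ∀ i j → Y i j ≈ Z i j
    represents-unique {Y} {Z} {t} (Y∈F , p) (Z∈F , q) i j = begin
      Y i j                      ≈⟨ solve 2 (λ y z → y := (y :- z) :+ z) refl _ (Z i j) ⟩
      (Y i j - Z i j) + Z i j    ≈⟨ +-congʳ (indep (λ j → Y i j - Z i j) (λ j → +-closed (Y∈F i j)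
        (-‿closed (Z∈F i j))) difference j) ⟩
      0# + Z i j                 ≈⟨ +-identityˡ _ ⟩
      Z i j                      ∎
      where
      rows∼ : linear (Y i) b ∼ linear (Z i) b
      rows∼ = trans∼ (sym∼ (p i)) (q i)
      difference : linear (λ j → Y i j - Z i j) b ∼ 0#
      difference = trans∼ (reflexive∼ (linear-- (Y i) (Z i) b))
        (trans∼ (+-cong∼ rows∼ (reflexive∼ refl)) (reflexive∼ (-‿inverseʳ _)))

    represents-power : ∀ {Z} → Represents Z z → ∀ n → ∃[ Y ] (Represents Y (z ^ʳ n) × det Y ≈ det Z ^ʳ n)
    represents-power rep zero = scalarMatrix 1# ,
      ((λ i j → *-closed 1-closed (δ-closed i j)) ,
       λ i → reflexive∼ (trans (*-identityˡ _) (sym (trans (sum-cong-≋ {d} λ j → *-congʳ (*-identityˡ (δ i j)))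
                                                       (linear-δ i b))))) ,
      trans (det-scalar d 1#) (1^ d)
      where
      1^ : ∀ n → 1# ^ʳ n ≈ 1#
      1^ zero = refl
      1^ (suc n) = trans (*-identityˡ _) (1^ n)
    represents-power {Z} rep@(Z∈F , p) (suc n) =
      let Y , (Y∈F , q) , eq = represents-power rep n in
      Y ⊡ Z ,
      ((λ i k → ∑-closed {d} λ j → *-closed (Y∈F i j) (Z∈F j k)) ,
       λ i → trans∼ (reflexive∼ (*-assoc z (z ^ʳ n) (b i)))
            (trans∼ (mul∼ (q i))
            (trans∼ (reflexive∼ (linear-* z (Y i) b))
            (trans∼ (∑-cong∼ {d} λ j → scale∼ (Y∈F i j) (p j))
                    (reflexive∼ (linear-⊡ (Y i) Z b)))))) ,
      trans (det-⊡ Y Z) (trans (*-congʳ eq) (*-comm _ _))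

    det-power : ∀ {Z} → Represents Z z → ∀ n {Y} → Represents Y (z ^ʳ n) → det Y ≈ det Z ^ʳ n
    det-power rep n rep′ =
      let Y , rep″ , eq = represents-power rep n in
      trans (det-cong (represents-unique rep′ rep″)) eq

  last-power : ∀ {n} x → powers {suc n} x (fromℕ n) ≡ x ^ʳ n
  last-power {n} x = ≡.cong (x ^ʳ_) (Fin.toℕ-fromℕ n)

  module _ {F : Pred Carrier f} {E : Pred Carrier g} (F-sub : IsSubring F) (E-sub : IsSubring E) (F⊆E : F ⊆ E) where
    private
      module F = IsSubring F-sub
      module E = IsSubring E-sub

    root-of-generator : ∀ {m x t} → x ∈ E → t ∈ F → x ^ʳ suc m ≈ t →
      Independent F (powers {suc m} x) → E ⊆ Span F (powers {suc m} x) →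
      ∀ n {w} → w ∈ E → w ^ʳ n ≈ x → ∃[ e ] (e ∈ F × e ^ʳ n ≈ signed m t)
    root-of-generator {m} {x} {t} x∈E t∈F x^m≈t indep span n {w} w∈E w^n≈x =
      det W , F.det-closed W∈F , trans (sym (det-power repW n repX)) (det-companion m t)
      where
      open Representation F-sub (≈-isCongruence F w) (powers {suc m} x) indep
      rows : ∀ i → Span F (powers {suc m} x) (w * x ^ʳ toℕ {suc m} i)
      rows i = span (E.*-closed w∈E (E.^-closed (toℕ i) x∈E))
      W : Matrix (suc m) (suc m)
      W i = proj₁ (rows i)
      W∈F : ∀ i j → W i j ∈ F
      W∈F i = proj₁ (proj₂ (rows i))
      repW : Represents W w
      repW = W∈F , λ i → proj₂ (proj₂ (rows i))
      repX : Represents (companion t) (w ^ʳ n)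
      repX = (λ { i zero → F.lastEntry-closed t∈F i ; i (suc j) → F.δ-closed (inject₁ j) i }) , λ i → begin
        w ^ʳ n * x ^ʳ toℕ i
          ≈⟨ *-congʳ w^n≈x ⟩
        x ^ʳ suc (toℕ i)
          ≈⟨ companion-row t (λ i → x ^ʳ suc (toℕ i)) i
               (trans (reflexive (≡.cong (x *_) (last-power {m} x))) x^m≈t) ⟨
        lastEntry t i + ∑[ j < m ] (δ (inject₁ j) i * x ^ʳ suc (toℕ (inject₁ j)))
          ≈⟨ +-cong (sym (*-identityʳ _)) (sum-cong-≋ {m} λ j → *-congˡ
            (reflexive (≡.cong (λ k → x ^ʳ suc k) (Fin.toℕ-inject₁ j)))) ⟩
        lastEntry t i * 1# + ∑[ j < m ] (δ (inject₁ j) i * x ^ʳ suc (toℕ j)) ∎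

module UnitPowers (R : CommutativeRing c ℓ) where
  open CommutativeRing R hiding (zero)
  open Subrings R using (_^ʳ_)
  open Powers (units R)

  proj₁-↑ : ∀ x n → proj₁ (x ↑ n) ≡ proj₁ x ^ʳ n
  proj₁-↑ x zero = ≡.refl
  proj₁-↑ x (suc n) = ≡.cong (proj₁ x *_) (proj₁-↑ x n)

least : (∀ {e} → ExcludedMiddle e) → ∀ (P : ℕ → Set a) n →
  (∃[ d ] (d ℕ.< n × P d × (∀ j → j ℕ.< d → ¬ P j))) ⊎ (∀ j → j ℕ.< n → ¬ P j)
least em P zero = inj₂ λ _ ()
least em P (suc n) with least em P n
... | inj₁ (d , d<n , p) = inj₁ (d , ℕ.m<n⇒m<1+n d<n , p)
... | inj₂ none with em {P = P n}
... | yes p = inj₁ (n , ℕ.n<1+n n , p , none)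
... | no ¬p = inj₂ λ j j<1+n → λ q → case j (ℕ.m<1+n⇒m<n∨m≡n j<1+n) q
  where
  case : ∀ j → j ℕ.< n ⊎ j ≡ n → ¬ P j
  case j (inj₁ j<n) = none j j<n
  case j (inj₂ ≡.refl) = ¬p

module FieldExtension (em : ∀ {e} → ExcludedMiddle e) (R : CommutativeRing c ℓ) where
  open CommutativeRing R hiding (zero)
  open IntegerSolver R
  open Algebra.Properties.Semiring.Sum semiring
  open Determinant R
  open Subrings R
  open UnitPowers R
  open Powers (units R)
  open Relation.Binary.Reasoning.Setoid setoid

  module _ {F : Pred Carrier f} {E : Pred Carrier g} (F-sub : IsSubring F) (E-sub : IsSubring E) (F⊆E : F ⊆ E)
    (F-inv : HasInverses F) where
    private
      module F = IsSubring F-sub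
      module E = IsSubring E-sub

    module _ {p : ℕ} (p-prime : Prime p) {x t t⁻¹ : Carrier} (x∈E : x ∈ E) (t∈F : t ∈ F) (t⁻¹∈F : t⁻¹ ∈ F)
      (t*t⁻¹ : t * t⁻¹ ≈ 1#) (x^p≈t : x ^ʳ p ≈ t) (no-root : ∀ {e} → e ∈ F → ¬ (e ^ʳ p ≈ t))
      (indep : Independent F (powers {p} x)) (span : E ⊆ Span F (powers {p} x)) where

      private
        root : Pred (AbelianGroup.Carrier (units R)) _
        root y = ∃[ e ] ∃[ e⁻¹ ] (e ∈ F × e⁻¹ ∈ F × e * e⁻¹ ≈ 1# × e ^ʳ p ≈ proj₁ y)

        root-isSubgroup : IsSubgroup (units R) root
        root-isSubgroup = record
          { resp = λ { x≈y (e , e′ , a , b , q , s) → e , e′ , a , b , q , trans s x≈y }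
          ; ε-closed = 1# , 1# , F.1-closed , F.1-closed , *-identityˡ 1# , 1^ p
          ; ∙-closed = λ { (e , e′ , a , b , q , s) (d , d′ , a′ , b′ , q′ , s′) →
              e * d , e′ * d′ , F.*-closed a a′ , F.*-closed b b′ ,
              trans (solve 4 (λ e d e′ d′ → (e :* d) :* (e′ :* d′) := (e :* e′) :* (d :* d′)) refl e d e′ d′)
                (trans (*-cong q q′) (*-identityˡ 1#)) ,
              trans (^-distrib-* e d p) (*-cong s s′) }
          ; ⁻¹-closed = λ { {y , y′ , yy′} (e , e′ , a , b , q , s) →
              e′ , e , b , a , trans (*-comm e′ e) q , (begin
                e′ ^ʳ p                       ≈⟨ *-identityʳ _ ⟨
                e′ ^ʳ p * 1#                  ≈⟨ *-congˡ yy′ ⟨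
                e′ ^ʳ p * (y * y′)            ≈⟨ *-congˡ (*-congʳ s) ⟨
                e′ ^ʳ p * (e ^ʳ p * y′)       ≈⟨ *-assoc _ _ _ ⟨
                e′ ^ʳ p * e ^ʳ p * y′         ≈⟨ *-congʳ (^-distrib-* e′ e p) ⟨
                (e′ * e) ^ʳ p * y′            ≈⟨ *-congʳ (^-congˡ p (trans (*-comm e′ e) q)) ⟩
                1# ^ʳ p * y′                  ≈⟨ *-congʳ (1^ p) ⟩
                1# * y′                       ≈⟨ *-identityˡ y′ ⟩
                y′                            ∎) }
          }
          where
          1^ : ∀ n → 1# ^ʳ n ≈ 1#
          1^ zero = refl
          1^ (suc n) = trans (*-identityˡ _) (1^ n)

        τ : AbelianGroup.Carrier (units R)
        τ = t , t⁻¹ , t*t⁻¹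

        instance
          p≢0 = prime⇒nonZero p-prime

        no-root-power : ∀ {d e} → 0 ℕ.< d → d ℕ.< p → e ∈ F → ¬ (e ^ʳ p ≈ t ^ʳ d)
        no-root-power {d} {e} 0<d d<p e∈F q =
          let e′ , _ , a , _ , _ , s = coprime-powers root-isSubgroup
                (prime⇒coprime p-prime {{ℕ.>-nonZero 0<d}} d<p) {τ}
                (t , t⁻¹ , t∈F , t⁻¹∈F , t*t⁻¹ , reflexive (≡.sym (proj₁-↑ τ p))) (at-d p ≡.refl)
          in no-root a s
          where
          1^ : ∀ n → 1# ^ʳ n ≈ 1#
          1^ zero = refl
          1^ (suc n) = trans (*-identityˡ _) (1^ n)
          at-d : ∀ p′ → p ≡ p′ → root (τ ↑ d)
          at-d zero eq = contradiction (≡.trans eq ≡.refl) (ℕ.≢-nonZero⁻¹ p)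
          at-d (suc p′) ≡.refl = e , e ^ʳ p′ * t⁻¹ ^ʳ d , e∈F ,
            F.*-closed (F.^-closed p′ e∈F) (F.^-closed d t⁻¹∈F) ,
            (begin
              e * (e ^ʳ p′ * t⁻¹ ^ʳ d)    ≈⟨ *-assoc _ _ _ ⟨
              e ^ʳ suc p′ * t⁻¹ ^ʳ d      ≈⟨ *-congʳ q ⟩
              t ^ʳ d * t⁻¹ ^ʳ d           ≈⟨ ^-distrib-* t t⁻¹ d ⟨
              (t * t⁻¹) ^ʳ d              ≈⟨ ^-congˡ d t*t⁻¹ ⟩
              1# ^ʳ d                     ≈⟨ 1^ d ⟩
              1#                          ∎) ,
            trans q (reflexive (≡.sym (proj₁-↑ τ d)))

      -- Let d be least such that xᵈ is an F-combination of lower powers modulo the ideal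
      -- generated by y. Then 1 , … , xᵈ⁻¹ is a basis of the quotient, and the norm of x
      -- makes tᵈ a pth power unless d = 0 or d = p.
      adjoin-root : HasInverses E
      adjoin-root {y} y∈E y≉0 = conclude (least em Dependent p)
        where
        infix 4 _∼_
        _∼_ : Rel Carrier _
        v ∼ w = ∃[ e ] (e ∈ E × v ≈ w + y * e)

        ∼-isCongruence : IsCongruence F x _∼_
        ∼-isCongruence = record
          { reflexive∼ = λ {v} {w} q → 0# , E.0-closed , trans q (solve 2 (λ w y → w := w :+ y :* :0) refl w y)
          ; sym∼ = λ { {v} {w} (e , e∈E , q) → - e , E.-‿closed e∈E , (begin
              w                       ≈⟨ solve 3 (λ w y e → w := (w :+ y :* e) :+ y :* (:- e)) refl w y e ⟩
              w + y * e + y * - e     ≈⟨ +-congʳ q ⟨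
              v + y * - e             ∎) }
          ; trans∼ = λ { {v} {w} {u} (e , e∈E , q) (d , d∈E , s) → d + e , E.+-closed d∈E e∈E ,
              trans q (trans (+-congʳ s)
                (solve 4 (λ u y d e → u :+ y :* d :+ y :* e := u :+ y :* (d :+ e)) refl u y d e)) }
          ; +-cong∼ = λ { {v} {w} {v′} {w′} (e , e∈E , q) (d , d∈E , s) → e + d , E.+-closed e∈E d∈E ,
              trans (+-cong q s)
                (solve 5 (λ w w′ y e d → (w :+ y :* e) :+ (w′ :+ y :* d) := (w :+ w′) :+ y :*
                  (e :+ d)) refl w w′ y e d) }
          ; scale∼ = λ { {z} {v} {w} z∈F (e , e∈E , q) → z * e , E.*-closed (F⊆E z∈F) e∈E ,
              trans (*-congˡ q) (solve 4 (λ z w y e → z :* (w :+ y :* e) := z :* w :+ y :* (z :* e)) refl z w y e) }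
          ; mul∼ = λ { {v} {w} (e , e∈E , q) → x * e , E.*-closed x∈E e∈E ,
              trans (*-congˡ q) (solve 4 (λ z w y e → z :* (w :+ y :* e) := z :* w :+ y :* (z :* e)) refl x w y e) }
          }
        open IsCongruence ∼-isCongruence

        Dependent : ℕ → Set _
        Dependent d = ∃[ q ] ((∀ (i : Fin d) → q i ∈ F) × x ^ʳ d ∼ linear q (powers x))

        independent∼ : ∀ d → (∀ j → j ℕ.< d → ¬ Dependent j) →
          ∀ (q : Vector Carrier d) → (∀ i → q i ∈ F) → linear q (powers x) ∼ 0# → ∀ i → q i ≈ 0#
        independent∼ zero _ q q∈F _ ()
        independent∼ (suc d) none q q∈F relation = all-zero
          where
          top = last {n = d} q
          rest = init {n = d} q
          split : linear q (powers x) ≈ linear rest (powers x) + top * x ^ʳ d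
          split = trans (sum-init-last {d} (λ i → q i * powers x i)) (+-cong
            (sum-cong-≋ {d} λ i → *-congˡ (reflexive (≡.cong (x ^ʳ_) (Fin.toℕ-inject₁ i))))
            (*-congˡ (reflexive (last-power {d} x))))
          relation′ : (linear rest (powers x) + top * x ^ʳ d) ∼ 0#
          relation′ = trans∼ (reflexive∼ (sym split)) relation
          top-zero : top ≈ 0#
          top-zero with em {P = top ≈ 0#}
          ... | yes z = z
          ... | no nz =
            let s , s∈F , top*s = F-inv (q∈F (fromℕ d)) nz
                e , e∈E , eq = scale∼ s∈F relation′
            in contradiction ((λ i → - s * rest i) , (λ i → F.*-closed (F.-‿closed s∈F) (q∈F (inject₁ i))) ,
                e , e∈E , (begin
                  x ^ʳ d
                    ≈⟨ *-identityˡ _ ⟨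
                  1# * x ^ʳ d
                    ≈⟨ *-congʳ top*s ⟨
                  top * s * x ^ʳ d
                    ≈⟨ solve 4 (λ l a s z → a :* s :* z := (:- s) :* l :+ s :* (l :+ a :* z)) refl
                      (linear rest (powers x)) top s (x ^ʳ d) ⟩
                  - s * linear rest (powers x) + s * (linear rest (powers x) + top * x ^ʳ d)
                    ≈⟨ +-cong (linear-*ˡ (- s) rest (powers x)) eq ⟩
                  linear (λ i → - s * rest i) (powers x) + (s * 0# + y * e)
                    ≈⟨ solve 4 (λ l s y e → l :+ (s :* :0 :+ y :* e) := l :+ y :* e) refl _ s y e ⟩
                  linear (λ i → - s * rest i) (powers x) + y * e ∎)) (none d (ℕ.n<1+n d))
          rest-zero : ∀ i → rest i ≈ 0#
          rest-zero = independent∼ d (λ j j<d → none j (ℕ.m<n⇒m<1+n j<d)) rest (λ i → q∈F (inject₁ i))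
            (trans∼ (reflexive∼ (trans (solve 2 (λ l z → l := l :+ :0 :* z) refl (linear rest (powers x)) (x ^ʳ d))
              (+-congˡ (*-congʳ (sym top-zero))))) relation′)
          all-zero : ∀ i → q i ≈ 0#
          all-zero i with i Fin.≟ fromℕ d
          ... | yes ≡.refl = top-zero
          ... | no i≢ = ≡.subst (λ k → q k ≈ 0#) (Fin.inject₁-lower₁ i (d≢ i≢)) (rest-zero (Fin.lower₁ i (d≢ i≢)))
            where
            d≢ : ∀ {i} → i ≢ fromℕ d → d ≢ toℕ i
            d≢ i≢ eq = i≢ (Fin.toℕ-injective (≡.trans (≡.sym eq) (≡.sym (Fin.toℕ-fromℕ d))))

        conclude : (∃[ d ] (d ℕ.< p × Dependent d × (∀ j → j ℕ.< d → ¬ Dependent j))) ⊎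
                   (∀ j → j ℕ.< p → ¬ Dependent j) →
                   ∃[ e ] (e ∈ E × y * e ≈ 1#)
        conclude (inj₂ none) = contradiction
          (let q , q∈F , y≈ = span y∈E
               zeros = independent∼ p none q q∈F (1# , E.1-closed ,
                 trans (sym y≈) (solve 1 (λ y → y := :0 :+ y :* :1) refl y))
           in trans y≈ (trans (sum-cong-≋ {p} λ i → trans (*-congʳ (zeros i)) (zeroˡ (powers x i))) (sum-replicate-zero p))) y≉0
        conclude (inj₁ (zero , _ , (q , _ , e , e∈E , eq) , _)) = e , e∈E , sym (trans eq (+-identityˡ _))
        conclude (inj₁ (d@(suc d-1) , d<p , (q , q∈F , x^d∼) , none)) = contradiction
          (trans (sym (det-power repZ p repT)) (det-scalar d t)) (no-root-power ℕ.z<s d<p (F.det-closed (proj₁ repZ)))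
          where
          open Representation F-sub ∼-isCongruence (powers {d} x) (independent∼ d none)
          row : ∀ (i : Fin d) → ∃[ z ] ((∀ j → z j ∈ F) × (x * powers {d} x i) ∼ linear z (powers {d} x))
          row i with suc (toℕ i) ℕ.<? d
          ... | yes i+1<d = δ (fromℕ< i+1<d) , F.δ-closed (fromℕ< i+1<d) ,
            reflexive∼ (sym (trans (linear-δ (fromℕ< i+1<d) (powers x))
              (reflexive (≡.cong (x ^ʳ_) (Fin.toℕ-fromℕ< i+1<d)))))
          ... | no i+1≮d = q , q∈F , trans∼ (reflexive∼ (reflexive (≡.cong (x ^ʳ_)
              (ℕ.≤-antisym (Fin.toℕ<n i) (ℕ.≮⇒≥ i+1≮d))))) x^d∼
          Z : Matrix d d
          Z i = proj₁ (row i)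
          repZ : Represents Z x
          repZ = (λ i → proj₁ (proj₂ (row i))) , λ i → proj₂ (proj₂ (row i))
          repT : Represents (scalarMatrix t) (x ^ʳ p)
          repT = (λ i j → F.*-closed t∈F (F.δ-closed i j)) , λ i → reflexive∼ (begin
            x ^ʳ p * powers {d} x i                              ≈⟨ *-congʳ x^p≈t ⟩
            t * powers {d} x i                                   ≈⟨ *-congˡ (linear-δ i (powers x)) ⟨
            t * linear (δ i) (powers {d} x)                      ≈⟨ linear-*ˡ t (δ i) (powers x) ⟩
            linear (λ j → t * δ i j) (powers {d} x)              ∎)

-- s and h are the embeddings of K and of U, and coeff v x is the coefficient of x at the class
-- of v, relative to the basis element h v of that class.
record Graded (K : CommutativeRing c ℓ) (U : AbelianGroup u ℓu)
  (ι : AbelianGroup.Carrier (units K) → AbelianGroup.Carrier U)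
  (R : CommutativeRing r ℓr) : Set (c ⊔ ℓ ⊔ u ⊔ ℓu ⊔ r ⊔ ℓr) where
  private
    module K = CommutativeRing K
    module U = AbelianGroup U
    module R = CommutativeRing R
  field
    s : K.Carrier → R.Carrier
    s-cong : ∀ {k l} → k K.≈ l → s k R.≈ s l
    s-+ : ∀ k l → s (k K.+ l) R.≈ s k R.+ s l
    s-* : ∀ k l → s (k K.* l) R.≈ s k R.* s l
    s-1 : s K.1# R.≈ R.1#
    h : U.Carrier → R.Carrier
    h-cong : ∀ {v w} → v U.≈ w → h v R.≈ h w
    h-∙ : ∀ v w → h (v U.∙ w) R.≈ h v R.* h w
    h-ε : h U.ε R.≈ R.1#
    h-ι : ∀ a → h (ι a) R.≈ s (proj₁ a)
    coeff : U.Carrier → R.Carrier → K.Carrier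
    coeff-cong : ∀ {v w x y} → v U.≈ w → x R.≈ y → coeff v x K.≈ coeff w y
    coeff-+ : ∀ v x y → coeff v (x R.+ y) K.≈ coeff v x K.+ coeff v y
    coeff-* : ∀ v k x → coeff v (s k R.* x) K.≈ k K.* coeff v x
    coeff-same : ∀ v → coeff v (h v) K.≈ K.1#
    coeff-other : ∀ {v w} → ¬ (∃[ a ] w U.≈ ι a U.∙ v) → coeff v (h w) K.≈ K.0#

  eval : List (K.Carrier × U.Carrier) → R.Carrier
  eval = foldr (λ (k , v) x → s k R.* h v R.+ x) R.0#

  field
    spans : ∀ x → ∃[ ts ] x R.≈ eval ts

module GradedProperties (em : ∀ {e} → ExcludedMiddle e)
  {K : CommutativeRing c ℓ} {U : AbelianGroup u ℓu} {ι : AbelianGroup.Carrier (units K) → AbelianGroup.Carrier U}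
  {R : CommutativeRing r ℓr}
  (K-field : IsField K) (ι-mono : IsMonomorphism (units K) U ι) (G : Graded K U ι R) where

  module K where
    open CommutativeRing K public
    open Algebra.Properties.Semiring.Sum semiring public using (sum)
    open Subrings K public using (_^ʳ_)
  module U where
    open AbelianGroup U public
    open Powers U public
    open Algebra.Properties.CommutativeSemigroup commutativeSemigroup public using (interchange; x∙yz≈y∙xz)
    open Algebra.Properties.Group group public using (⁻¹-anti-homo-∙; ⁻¹-involutive)
  module ι = GroupMorphisms.IsGroupMonomorphism ι-mono
  open CommutativeRing R hiding (zero)
  open IntegerSolver R
  open Algebra.Properties.Ring ring using (x+x≈x⇒x≈0)
  open Algebra.Properties.Semiring.Sum semiring
  open Subrings R
  open Graded G public
  open Relation.Binary.Reasoning.Setoid setoid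

  s-0 : s K.0# ≈ 0#
  s-0 = x+x≈x⇒x≈0 _ (trans (sym (s-+ _ _)) (s-cong (K.+-identityˡ _)))

  s-‿- : ∀ k → s (K.- k) ≈ - s k
  s-‿- k = begin
    s (K.- k)                     ≈⟨ solve 2 (λ x y → x := (x :+ y) :- y) refl _ (s k) ⟩
    s (K.- k) + s k - s k         ≈⟨ +-congʳ (s-+ _ _) ⟨
    s (K.- k K.+ k) - s k         ≈⟨ +-congʳ (trans (s-cong (K.-‿inverseˡ k)) s-0) ⟩
    0# - s k                      ≈⟨ +-identityˡ _ ⟩
    - s k                         ∎

  s-^ : ∀ k n → s (k K.^ʳ n) ≈ s k ^ʳ n
  s-^ k zero = s-1
  s-^ k (suc n) = trans (s-* _ _) (*-congˡ (s-^ k n))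

  h-↑ : ∀ v n → h (v U.↑ n) ≈ h v ^ʳ n
  h-↑ v zero = h-ε
  h-↑ v (suc n) = trans (h-∙ _ _) (*-congˡ (h-↑ v n))

  h-inverse : ∀ v → h v * h (v U.⁻¹) ≈ 1#
  h-inverse v = trans (sym (h-∙ _ _)) (trans (h-cong (U.inverseʳ v)) h-ε)

  coeff-0 : ∀ v → coeff v 0# K.≈ K.0#
  coeff-0 v = K.trans (coeff-cong U.refl (sym (trans (*-congʳ s-0) (zeroˡ 0#))))
    (K.trans (coeff-* v K.0# 0#) (K.zeroˡ _))

  coeff-sum : ∀ {n} v (x : Vector Carrier n) → coeff v (sum x) K.≈ K.sum (coeff v ∘ x)
  coeff-sum {zero} v x = coeff-0 v
  coeff-sum {suc n} v x = K.trans (coeff-+ v _ _) (K.+-congˡ (coeff-sum v (x ∘ suc)))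

  coeff-h : ∀ {v w} a → w U.≈ ι a U.∙ v → coeff v (h w) K.≈ proj₁ a
  coeff-h {v} {w} a p = K.trans (coeff-cong U.refl (trans (h-cong p) (trans (h-∙ _ _) (*-congʳ (h-ι a)))))
    (K.trans (coeff-* v (proj₁ a) (h v)) (K.trans (K.*-congˡ (coeff-same v)) (K.*-identityʳ _)))

  coeff-ε-1 : coeff U.ε 1# K.≈ K.1#
  coeff-ε-1 = K.trans (coeff-cong U.refl (sym h-ε)) (coeff-same U.ε)

  coeff-ε-s : ∀ k → coeff U.ε (s k) K.≈ k
  coeff-ε-s k = K.trans (coeff-cong U.refl (sym (*-identityʳ _)))
    (K.trans (coeff-* _ _ _) (K.trans (K.*-congˡ coeff-ε-1) (K.*-identityʳ k)))

  s-injective : ∀ {k l} → s k ≈ s l → k K.≈ l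
  s-injective {k} {l} p = K.trans (K.sym (coeff-ε-s k)) (K.trans (coeff-cong U.refl p) (coeff-ε-s l))

  1≉0 : ¬ (1# ≈ 0#)
  1≉0 p = proj₁ K-field (s-injective (trans s-1 (trans p (sym s-0))))

  unit : ∀ {k} → ¬ (k K.≈ K.0#) → AbelianGroup.Carrier (units K)
  unit {k} k≉0 = k , proj₂ K-field k k≉0

  infix 4 _~_
  _~_ : Rel U.Carrier _
  w ~ v = ∃[ a ] w U.≈ ι a U.∙ v

  h-injective : ∀ {v w} → h v ≈ h w → v U.≈ w
  h-injective {v} {w} p with em {P = v ~ w}
  ... | no v≁w = contradiction (K.trans (K.sym (coeff-same w)) (K.trans (coeff-cong U.refl (sym p))
    (coeff-other v≁w))) (proj₁ K-field)
  ... | yes (a , q) = U.trans q (U.trans (U.∙-congʳ (U.trans (ι.⟦⟧-cong a≈1) ι.ε-homo)) (U.identityˡ w))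
    where
    a≈1 : proj₁ a K.≈ K.1#
    a≈1 = K.trans (K.sym (coeff-h a q)) (K.trans (coeff-cong U.refl p) (coeff-same w))

  coeff-shift : ∀ v w x → coeff (v U.∙ w) (h v * x) K.≈ coeff w x
  coeff-shift v w x = let ts , p = spans x in
    K.trans (coeff-cong U.refl (*-congˡ p)) (K.trans (go ts) (coeff-cong U.refl (sym p)))
    where
    single : ∀ t → coeff (v U.∙ w) (h v * h t) K.≈ coeff w (h t)
    single t with em {P = t ~ w}
    ... | yes (a , q) = K.trans (coeff-cong U.refl (sym (h-∙ v t))) (K.trans
            (coeff-h a (U.trans (U.∙-congˡ q) (U.x∙yz≈y∙xz _ _ _))) (K.sym (coeff-h a q)))
    ... | no t≁w = K.trans (coeff-cong U.refl (sym (h-∙ v t))) (K.trans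
            (coeff-other λ { (a , q) → t≁w (a , U.trans (cancel t) (U.trans (U.∙-congˡ q)
               (U.trans (U.∙-congˡ (U.x∙yz≈y∙xz _ _ _)) (U.sym (cancel _))))) }) (K.sym (coeff-other t≁w)))
      where
      cancel : ∀ t → t U.≈ v U.⁻¹ U.∙ (v U.∙ t)
      cancel t = U.sym (U.trans (U.sym (U.assoc _ _ _)) (U.trans (U.∙-congʳ (U.inverseˡ v)) (U.identityˡ t)))
    go : ∀ ts → coeff (v U.∙ w) (h v * eval ts) K.≈ coeff w (eval ts)
    go [] = K.trans (coeff-cong U.refl (zeroʳ _)) (K.trans (coeff-0 _) (K.sym (coeff-0 _)))
    go ((k , t) ∷ ts) = K.trans
      (coeff-cong U.refl (solve 4 (λ v k t x → v :* (k :* t :+ x) := k :* (v :* t) :+ v :* x) refl _ _ _ _))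
      (K.trans (coeff-+ _ _ _)
        (K.trans (K.+-cong (K.trans (coeff-* _ _ _) (K.trans (K.*-congˡ (single t)) (K.sym (coeff-* _ _ _)))) (go ts))
        (K.sym (coeff-+ _ _ _))))

  collect : ∀ v ts → ∃[ k ] ∃[ rest ] (eval ts ≈ s k * h v + eval rest × coeff v
    (eval rest) K.≈ K.0# × length rest ℕ.≤ length ts)
  collect v [] = K.0# , [] , trans (sym (trans (*-congʳ s-0) (zeroˡ _))) (sym (+-identityʳ _)) , coeff-0 v , ℕ.z≤n
  collect v ((k , w) ∷ ts) with collect v ts | em {P = w ~ v}
  ... | l , rest , p , q , le | yes (a , w~v) = k K.* proj₁ a K.+ l , rest , (begin
      s k * h w + eval ts
        ≈⟨ +-cong (*-congˡ (trans (h-cong w~v) (trans (h-∙ _ _) (*-congʳ (h-ι a))))) p ⟩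
      s k * (s (proj₁ a) * h v) + (s l * h v + eval rest)
        ≈⟨ solve 5 (λ k a v l e → k :* (a :* v) :+ (l :* v :+ e) := (k :* a :+ l) :* v :+ e) refl _ _ _ _ _ ⟩
      (s k * s (proj₁ a) + s l) * h v + eval rest
        ≈⟨ +-congʳ (*-congʳ (trans (s-+ _ _) (+-congʳ (s-* _ _)))) ⟨
      s (k K.* proj₁ a K.+ l) * h v + eval rest ∎) , q , ℕ.m≤n⇒m≤1+n le
  ... | l , rest , p , q , le | no w≁v = l , (k , w) ∷ rest ,
      trans (+-congˡ p) (solve 3 (λ x y z → x :+ (y :+ z) := y :+ (x :+ z)) refl _ _ _) ,
      K.trans (coeff-+ _ _ _)
        (K.trans (K.+-cong (K.trans (coeff-* _ _ _) (K.trans (K.*-congˡ (coeff-other w≁v)) (K.zeroʳ k))) q)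
          (K.+-identityˡ _)) ,
      ℕ.s≤s le

  coeff-zero⇒zero : ∀ {x} → (∀ v → coeff v x K.≈ K.0#) → x ≈ 0#
  coeff-zero⇒zero {x} z = let ts , p = spans x in
    trans p (go (length ts) ts ℕ.≤-refl λ v → K.trans (coeff-cong U.refl (sym p)) (z v))
    where
    go : ∀ n ts → length ts ℕ.≤ n → (∀ v → coeff v (eval ts) K.≈ K.0#) → eval ts ≈ 0#
    go n [] le z = refl
    go (suc n) ((k , v) ∷ ts) (ℕ.s≤s le) z with collect v ts
    ... | l , rest , p , q , le′ = trans total (go n rest (ℕ.≤-trans le′ le) λ w → K.trans
      (coeff-cong U.refl (sym total)) (z w))
      where
      combined : s k * h v + eval ts ≈ s (k K.+ l) * h v + eval rest
      combined = begin
        s k * h v + eval ts                      ≈⟨ +-congˡ p ⟩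
        s k * h v + (s l * h v + eval rest)      ≈⟨ solve 4 (λ k v l e → k :* v :+ (l :* v :+ e) :=
          (k :+ l) :* v :+ e) refl _ _ _ _ ⟩
        (s k + s l) * h v + eval rest            ≈⟨ +-congʳ (*-congʳ (s-+ k l)) ⟨
        s (k K.+ l) * h v + eval rest            ∎
      k+l≈0 : k K.+ l K.≈ K.0#
      k+l≈0 = K.trans (K.sym
        (K.trans (K.+-cong (K.trans (coeff-* _ _ _) (K.trans (K.*-congˡ (coeff-same v)) (K.*-identityʳ _))) q)
          (K.+-identityʳ _)))
        (K.trans (K.sym (coeff-+ _ _ _)) (K.trans (coeff-cong U.refl (sym combined)) (z v)))
      total : s k * h v + eval ts ≈ eval rest
      total = trans combined (trans (+-congʳ (trans (*-congʳ (trans (s-cong k+l≈0) s-0)) (zeroˡ _))) (+-identityˡ _))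

  data Supp (V : Pred U.Carrier f) : Pred Carrier (c ⊔ u ⊔ r ⊔ ℓr ⊔ f) where
    none : ∀ {x} → x ≈ 0# → x ∈ Supp V
    term : ∀ {x y} k {v} → v ∈ V → y ∈ Supp V → x ≈ s k * h v + y → x ∈ Supp V

  Supp-mono : ∀ {V : Pred U.Carrier f} {W : Pred U.Carrier g} → V ⊆ W → Supp V ⊆ Supp W
  Supp-mono V⊆W (none p) = none p
  Supp-mono V⊆W (term k v∈V y p) = term k (V⊆W v∈V) (Supp-mono V⊆W y) p

  record IsExtension (V : Pred U.Carrier f) : Set (c ⊔ ℓ ⊔ u ⊔ ℓu ⊔ f) where
    field
      isSubgroup : IsSubgroup U V
      contains : ∀ a → ι a ∈ V
    open IsSubgroup isSubgroup public

    ~-closed : ∀ {v w} → w ~ v → w ∈ V → v ∈ V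
    ~-closed (a , p) w∈V = U.∙-cancelˡ-closed isSubgroup (contains a) (resp p w∈V)

  scalars : Pred U.Carrier _
  scalars = Image (units K) U ι

  scalars-isExtension : IsExtension scalars
  scalars-isExtension = record
    { isSubgroup = record
      { resp = λ { p (a , q) → a , U.trans (U.sym p) q }
      ; ε-closed = AbelianGroup.ε (units K) , U.sym ι.ε-homo
      ; ∙-closed = λ { (a , p) (b , q) → AbelianGroup._∙_ (units K) a b , U.trans (U.∙-cong p q)
        (U.sym (ι.∙-homo a b)) }
      ; ⁻¹-closed = λ { (a , p) → AbelianGroup._⁻¹ (units K) a , U.trans (U.⁻¹-cong p) (U.sym (ι.⁻¹-homo a)) }
      }
    ; contains = λ a → a , U.refl
    }

  module _ {V : Pred U.Carrier f} (V-ext : IsExtension V) where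
    private module V = IsExtension V-ext

    Supp-resp : ∀ {x y} → x ≈ y → x ∈ Supp V → y ∈ Supp V
    Supp-resp p (none q) = none (trans (sym p) q)
    Supp-resp p (term k v∈V y q) = term k v∈V y (trans (sym p) q)

    Supp-+ : ∀ {x y} → x ∈ Supp V → y ∈ Supp V → x + y ∈ Supp V
    Supp-+ (none p) y = Supp-resp (sym (trans (+-congʳ p) (+-identityˡ _))) y
    Supp-+ (term k v∈V z p) y = term k v∈V (Supp-+ z y) (trans (+-congʳ p) (+-assoc _ _ _))

    Supp-term : ∀ k {v x} → v ∈ V → x ∈ Supp V → s k * h v * x ∈ Supp V
    Supp-term k v∈V (none p) = none (trans (*-congˡ p) (zeroʳ _))
    Supp-term k {v} v∈V (term {y = y} l {w} w∈V z p) = term (k K.* l) (V.∙-closed v∈V w∈V) (Supp-term k v∈V z)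
      (trans (*-congˡ p) (trans (solve 5 (λ k v l w y → k :* v :* (l :* w :+ y) := (k :* l) :*
        (v :* w) :+ k :* v :* y) refl (s k) (h v) (s l) (h w) y)
        (+-congʳ (*-cong (sym (s-* k l)) (sym (h-∙ v w))))))

    Supp-* : ∀ {x y} → x ∈ Supp V → y ∈ Supp V → x * y ∈ Supp V
    Supp-* (none p) y = none (trans (*-congʳ p) (zeroˡ _))
    Supp-* (term k v∈V z p) y = Supp-resp (trans (sym (distribʳ _ _ _)) (*-congʳ (sym p)))
      (Supp-+ (Supp-term k v∈V y) (Supp-* z y))

    Supp-h : ∀ {v} → v ∈ V → h v ∈ Supp V
    Supp-h v∈V = term K.1# v∈V (none refl) (sym (trans (+-identityʳ _) (trans (*-congʳ s-1) (*-identityˡ _))))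

    Supp-s : ∀ k → s k ∈ Supp V
    Supp-s k = term k V.ε-closed (none refl) (sym (trans (+-identityʳ _) (trans (*-congˡ h-ε) (*-identityʳ _))))

    Supp-isSubring : IsSubring (Supp V)
    Supp-isSubring = record
      { resp = Supp-resp
      ; 0-closed = none refl
      ; 1-closed = Supp-resp h-ε (Supp-h V.ε-closed)
      ; +-closed = Supp-+
      ; *-closed = Supp-*
      ; -‿closed = λ {x} x∈ → Supp-resp (trans (*-congʳ (trans (s-‿- _) (-‿cong s-1)))
          (solve 1 (λ x → (:- :1) :* x := :- x) refl x)) (Supp-* (Supp-s (K.- K.1#)) x∈)
      }

    coeff-off : ∀ {x v} → x ∈ Supp V → v ∉ V → coeff v x K.≈ K.0#
    coeff-off (none p) v∉V = K.trans (coeff-cong U.refl p) (coeff-0 _)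
    coeff-off (term k w∈V y p) v∉V = K.trans (coeff-cong U.refl p) (K.trans (coeff-+ _ _ _)
      (K.trans (K.+-cong (K.trans (coeff-* _ _ _)
        (K.trans (K.*-congˡ (coeff-other λ w~v → v∉V (V.~-closed w~v w∈V))) (K.zeroʳ _))) (coeff-off y v∉V))
        (K.+-identityˡ _)))

    Adjoin : U.Carrier → Pred U.Carrier _
    Adjoin x w = ∃[ j ] ∃[ v ] (v ∈ V × w U.≈ v U.∙ x U.↑ j)

    V⊆Adjoin : ∀ x → V ⊆ Adjoin x
    V⊆Adjoin x {v} v∈V = 0 , v , v∈V , U.sym (U.identityʳ v)

    x∈Adjoin : ∀ x → x ∈ Adjoin x
    x∈Adjoin x = 1 , U.ε , V.ε-closed , U.sym (U.trans (U.identityˡ _) (U.↑-1 x))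

    module _ {x : U.Carrier} {m : ℕ} (x^m∈V : x U.↑ suc m ∈ V) where

      Adjoin-isExtension : IsExtension (Adjoin x)
      Adjoin-isExtension = record
        { isSubgroup = record
          { resp = λ { p (j , v , v∈V , q) → j , v , v∈V , U.trans (U.sym p) q }
          ; ε-closed = V⊆Adjoin x V.ε-closed
          ; ∙-closed = λ { (i , v , v∈V , p) (j , w , w∈V , q) → i ℕ.+ j , v U.∙ w , V.∙-closed v∈V w∈V ,
              U.trans (U.∙-cong p q) (U.trans (U.interchange _ _ _ _) (U.∙-congˡ (U.sym (U.↑-+ x i j)))) }
          ; ⁻¹-closed = λ { {w} (j , v , v∈V , p) → j ℕ.* m , (v U.∙ (x U.↑ suc m) U.↑ j) U.⁻¹ ,
              V.⁻¹-closed (V.∙-closed v∈V (U.↑-closed V.isSubgroup j x^m∈V)) ,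
              U.sym (inverse w v j p) }
          }
        ; contains = λ a → V⊆Adjoin x (V.contains a)
        }
        where
        inverse : ∀ w v j → w U.≈ v U.∙ x U.↑ j → (v U.∙ (x U.↑ suc m) U.↑ j) U.⁻¹ U.∙ x U.↑ (j ℕ.* m) U.≈ w U.⁻¹
        inverse w v j p = U.trans (U.∙-congʳ (U.trans (U.⁻¹-cong step) (U.trans (U.⁻¹-anti-homo-∙ _ _) (U.comm _ _))))
          (U.trans (U.assoc _ _ _) (U.trans (U.∙-congˡ (U.inverseˡ _)) (U.identityʳ _)))
          where
          step : v U.∙ (x U.↑ suc m) U.↑ j U.≈ w U.∙ x U.↑ (j ℕ.* m)
          step = U.trans (U.∙-congˡ (U.trans (U.sym (U.↑-* x j (suc m)))
            (U.trans (U.reflexive (≡.cong (x U.↑_) (ℕ.*-suc j m))) (U.↑-+ x j (j ℕ.* m)))))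
            (U.trans (U.sym (U.assoc _ _ _)) (U.∙-congʳ (U.sym p)))

      Adjoin-span : Supp (Adjoin x) ⊆ Span (Supp V) (powers {suc m} (h x))
      Adjoin-span (none p) = (λ _ → 0#) , (λ _ → none refl) ,
        trans p (sym (trans (sum-cong-≋ {suc m} λ i → zeroˡ (powers (h x) i)) (sum-replicate-zero (suc m))))
      Adjoin-span {y} (term {y = y′} k {w} (j , v , v∈V , p) z q) =
        let qs , qs∈ , eq = Adjoin-span z in
        (λ i → t * δ′ i + qs i) ,
        (λ i → Supp-+ (Supp-* t∈ (IsSubring.δ-closed Supp-isSubring r̂ i)) (qs∈ i)) , (begin
          y
            ≈⟨ q ⟩
          s k * h w + y′
            ≈⟨ +-cong homog eq ⟩
          t * linear δ′ (powers {suc m} (h x)) + linear qs (powers (h x))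
            ≈⟨ +-congʳ (linear-*ˡ t δ′ (powers (h x))) ⟩
          linear (λ i → t * δ′ i) (powers {suc m} (h x)) + linear qs (powers (h x))
            ≈⟨ ∑-distrib-+ {suc m} (λ i → t * δ′ i * powers (h x) i) (λ i → qs i * powers (h x) i) ⟨
          sum {suc m} (λ i → t * δ′ i * powers (h x) i + qs i * powers (h x) i)
            ≈⟨ sum-cong-≋ {suc m} (λ i → distribʳ (powers (h x) i) (t * δ′ i) (qs i)) ⟨
          linear (λ i → t * δ′ i + qs i) (powers {suc m} (h x)) ∎)
        where
        open Determinant R using (δ)
        r̂ : Fin (suc m)
        r̂ = fromℕ< (m%n<n j (suc m))
        δ′ : Vector Carrier (suc m)
        δ′ = δ r̂
        v′ = v U.∙ (x U.↑ suc m) U.↑ (j / suc m)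
        t = s k * h v′
        t∈ : t ∈ Supp V
        t∈ = Supp-* (Supp-s k) (Supp-h (V.∙-closed v∈V (U.↑-closed V.isSubgroup (j / suc m) x^m∈V)))
        split : w U.≈ v′ U.∙ x U.↑ (j % suc m)
        split = U.trans p (U.trans (U.∙-congˡ (U.trans (U.reflexive (≡.cong (x U.↑_) (m≡m%n+[m/n]*n j (suc m))))
          (U.trans (U.↑-+ x (j % suc m) _) (U.trans (U.comm _ _) (U.∙-congʳ (U.↑-* x (j / suc m) (suc m)))))))
          (U.sym (U.assoc _ _ _)))
        homog : s k * h w ≈ t * linear δ′ (powers {suc m} (h x))
        homog = begin
          s k * h w
            ≈⟨ *-congˡ (trans (h-cong split) (trans (h-∙ _ _) (*-congˡ (h-↑ x (j % suc m))))) ⟩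
          s k * (h v′ * h x ^ʳ (j % suc m))
            ≈⟨ *-assoc _ _ _ ⟨
          t * h x ^ʳ (j % suc m)
            ≈⟨ *-congˡ (trans (linear-δ r̂ (powers (h x)))
              (reflexive (≡.cong (h x ^ʳ_) (Fin.toℕ-fromℕ< (m%n<n j (suc m)))))) ⟨
          t * linear δ′ (powers {suc m} (h x)) ∎

      sum-single : ∀ {n} (i : Fin n) (v : Vector K.Carrier n) → (∀ j → j ≢ i → v j K.≈ K.0#) → K.sum v K.≈ v i
      sum-single zero v z = K.trans (K.+-congˡ (zeros (v ∘ suc) λ j → z (suc j) λ ())) (K.+-identityʳ _)
        where
        zeros : ∀ {n} (v : Vector K.Carrier n) → (∀ j → v j K.≈ K.0#) → K.sum v K.≈ K.0#
        zeros {zero} v z = K.refl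
        zeros {suc n} v z = K.trans (K.+-cong (z zero) (zeros (v ∘ suc) (z ∘ suc))) (K.+-identityˡ _)
      sum-single (suc i) v z = K.trans (K.+-cong (z zero λ ()) (sum-single i (v ∘ suc) λ j j≢i → z (suc j)
        (j≢i ∘ Fin.suc-injective))) (K.+-identityˡ _)

      module _ (order : ∀ {j} → 0 ℕ.< j → j ℕ.< suc m → x U.↑ j ∉ V) where

        quotient∉V : ∀ {i j : Fin (suc m)} → i ≢ j → (x U.↑ toℕ i) U.⁻¹ U.∙ x U.↑ toℕ j ∉ V
        quotient∉V {i} {j} i≢j p with ℕ.<-cmp (toℕ i) (toℕ j)
        ... | tri≈ _ i≡j _ = i≢j (Fin.toℕ-injective i≡j)
        ... | tri< i<j _ _ = order (ℕ.m<n⇒0<n∸m i<j) (ℕ.≤-<-trans (ℕ.m∸n≤m (toℕ j) (toℕ i)) (Fin.toℕ<n j))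
          (V.resp (difference i<j) p)
          where
          difference : ∀ {i j} → i ℕ.< j → (x U.↑ i) U.⁻¹ U.∙ x U.↑ j U.≈ x U.↑ (j ℕ.∸ i)
          difference {i} {j} i<j = U.trans
            (U.∙-congˡ (U.trans (U.reflexive (≡.cong (x U.↑_) (≡.sym (ℕ.m+[n∸m]≡n (ℕ.<⇒≤ i<j)))))
              (U.↑-+ x i (j ℕ.∸ i))))
            (U.trans (U.sym (U.assoc _ _ _)) (U.trans (U.∙-congʳ (U.inverseˡ _)) (U.identityˡ _)))
        ... | tri> _ _ j<i = order (ℕ.m<n⇒0<n∸m j<i) (ℕ.≤-<-trans (ℕ.m∸n≤m (toℕ i) (toℕ j)) (Fin.toℕ<n i))
            (U.∙-cancelˡ-closed V.isSubgroup p
              (V.resp (U.sym (U.trans (U.assoc _ _ _) (U.trans (U.∙-congˡ rejoin) (U.inverseˡ _)))) V.ε-closed))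
          where
          rejoin : x U.↑ toℕ j U.∙ x U.↑ (toℕ i ℕ.∸ toℕ j) U.≈ x U.↑ toℕ i
          rejoin = U.trans (U.sym (U.↑-+ x (toℕ j) _)) (U.reflexive (≡.cong (x U.↑_) (ℕ.m+[n∸m]≡n (ℕ.<⇒≤ j<i))))

        coeff-linear : ∀ (q : Vector Carrier (suc m)) → (∀ i → q i ∈ Supp V) → ∀ i {v} → v ∈ V →
          coeff (x U.↑ toℕ i U.∙ v) (linear q (powers (h x))) K.≈ coeff v (q i)
        coeff-linear q q∈ i {v} v∈V = K.trans (coeff-sum _ (λ j → q j * powers (h x) j))
          (K.trans (sum-single i _ other) (at i v))
          where
          rewritten : ∀ j w → coeff w (q j * powers (h x) j) K.≈ coeff w (h (x U.↑ toℕ j) * q j)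
          rewritten j w = coeff-cong U.refl (trans (*-comm _ _) (*-congʳ (sym (h-↑ x (toℕ j)))))
          at : ∀ j w → coeff (x U.↑ toℕ j U.∙ w) (q j * powers (h x) j) K.≈ coeff w (q j)
          at j w = K.trans (rewritten j _) (coeff-shift _ _ _)
          other : ∀ j → j ≢ i → coeff (x U.↑ toℕ i U.∙ v) (q j * powers (h x) j) K.≈ K.0#
          other j j≢i = K.trans (coeff-cong (U.sym back) refl) (K.trans (at j w)
            (coeff-off (q∈ j) λ w∈V → quotient∉V j≢i (U.∙-cancelʳ-closed V.isSubgroup v∈V w∈V)))
            where
            w = ((x U.↑ toℕ j) U.⁻¹ U.∙ x U.↑ toℕ i) U.∙ v
            back : x U.↑ toℕ j U.∙ w U.≈ x U.↑ toℕ i U.∙ v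
            back = U.trans (U.∙-congˡ (U.assoc _ _ _)) (U.trans (U.sym (U.assoc _ _ _))
              (U.trans (U.∙-congʳ (U.inverseʳ _)) (U.identityˡ _)))

        Adjoin-independent : Independent (Supp V) (powers {suc m} (h x))
        Adjoin-independent q q∈ relation i = coeff-zero⇒zero zeros
          where
          zeros : ∀ v → coeff v (q i) K.≈ K.0#
          zeros v with em {P = v ∈ V}
          ... | no v∉V = coeff-off (q∈ i) v∉V
          ... | yes v∈V = K.trans (K.sym (coeff-linear q q∈ i v∈V)) (K.trans (coeff-cong U.refl relation) (coeff-0 _))

    prime-order : ∀ {p x} → Prime p → x ∉ V → x U.↑ p ∈ V → ∀ {j} → 0 ℕ.< j → j ℕ.< p → x U.↑ j ∉ V
    prime-order p-prime x∉V x^p∈V 0<j j<p x^j∈V =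
      x∉V (U.coprime-powers V.isSubgroup (prime⇒coprime p-prime {{ℕ.>-nonZero 0<j}} j<p) x^p∈V x^j∈V)

prime-divisor : ∀ {n} → 1 ℕ.< n → ∃[ p ] (Prime p × p ∣ n)
prime-divisor {n} 1<n = go factors isFactorisation factorsPrime
  where
  instance
    n≢0 = ℕ.>-nonZero (ℕ.<-trans ℕ.z<s 1<n)
  open PrimeFactorisation (factorise n)
  go : ∀ ps → n ≡ product ps → All Prime ps → ∃[ p ] (Prime p × p ∣ n)
  go [] eq [] = contradiction eq (ℕ.>⇒≢ 1<n)
  go (p ∷ ps) eq (p-prime ∷ _) = p , p-prime , ≡.subst (p ∣_) (≡.sym eq) (m∣m*n (product ps))

parity : ∀ n → (∃[ k ] n ≡ k ℕ.+ k) ⊎ (∃[ k ] n ≡ suc (k ℕ.+ k))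
parity zero = inj₁ (0 , ≡.refl)
parity (suc n) with parity n
... | inj₁ (k , eq) = inj₂ (k , ≡.cong suc eq)
... | inj₂ (k , eq) = inj₁ (suc k , ≡.cong suc (≡.trans eq (≡.sym (ℕ.+-suc k k))))

n+n≡n*2 : ∀ n → n ℕ.+ n ≡ n ℕ.* 2
n+n≡n*2 n = ≡.trans (≡.cong (n ℕ.+_) (≡.sym (ℕ.+-identityʳ n))) (ℕ.*-comm 2 n)

prime-parity : ∀ {p} → Prime p → p ≡ 2 ⊎ ∃[ k ] p ≡ suc (k ℕ.+ k)
prime-parity {p} p-prime with parity p
... | inj₂ odd = inj₂ odd
... | inj₁ (k , eq) with prime⇒irreducible p-prime (divides k (≡.trans eq (n+n≡n*2 k)))
... | inj₂ 2≡p = inj₁ (≡.sym 2≡p)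

module Signs (R : CommutativeRing c ℓ) where
  open CommutativeRing R hiding (zero)
  open IntegerSolver R
  open Determinant R using (signed)
  open Subrings R using (_^ʳ_)
  open Algebra.Properties.Ring ring using (-‿involutive)

  signed-± : ∀ n x → signed n x ≈ x ⊎ signed n x ≈ - x
  signed-± zero x = inj₁ refl
  signed-± (suc n) x with signed-± n x
  ... | inj₁ p = inj₂ (-‿cong p)
  ... | inj₂ p = inj₁ (trans (-‿cong p) (-‿involutive x))

  signed-even : ∀ k x → signed (k ℕ.+ k) x ≈ x
  signed-even zero x = refl
  signed-even (suc k) x rewrite ℕ.+-suc k k = trans (-‿involutive _) (signed-even k x)

  neg-even-power : ∀ k x → (- x) ^ʳ (k ℕ.+ k) ≈ x ^ʳ (k ℕ.+ k)
  neg-even-power zero x = refl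
  neg-even-power (suc k) x rewrite ℕ.+-suc k k = trans
    (solve 2 (λ x y → (:- x) :* ((:- x) :* y) := x :* (x :* y)) refl x _)
    (*-congˡ (*-congˡ (neg-even-power k x)))

  neg-odd-power : ∀ k x → (- x) ^ʳ suc (k ℕ.+ k) ≈ - (x ^ʳ suc (k ℕ.+ k))
  neg-odd-power k x = trans (*-congˡ (neg-even-power k x)) (solve 2 (λ x y → (:- x) :* y := :- (x :* y)) refl x _)

module CyclicExtension (em : ∀ {e} → ExcludedMiddle e)
  {K : CommutativeRing c ℓ} {U : AbelianGroup u ℓu} {ι : AbelianGroup.Carrier (units K) → AbelianGroup.Carrier U}
  {R : CommutativeRing r ℓr}
  (K-field : IsField K) (ι-mono : IsMonomorphism (units K) U ι) (G : Graded K U ι R) where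

  open GradedProperties em K-field ι-mono G
  open CommutativeRing R hiding (zero)
  open IntegerSolver R
  open Subrings R
  open FieldExtension em R
  open Determinant R using (signed)
  open Relation.Binary.Reasoning.Setoid setoid
  private
    module KS = Signs K
    module RS = Signs R
    module KI = IntegerSolver K

  Supp-scalars : ∀ {x} → x ∈ Supp scalars → ∃[ k ] x ≈ s k
  Supp-scalars (none p) = K.0# , trans p (sym s-0)
  Supp-scalars (term k (a , q) y p) = let l , eq = Supp-scalars y in
    k K.* proj₁ a K.+ l ,
    trans p (trans (+-cong (trans (*-congˡ (trans (h-cong q) (h-ι a))) (sym (s-* k (proj₁ a)))) eq) (sym (s-+ _ l)))

  HasInverses-⇔ : ∀ {V : Pred U.Carrier f} {W : Pred U.Carrier g} → V ⊆ W → W ⊆ V →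
    HasInverses (Supp V) → HasInverses (Supp W)
  HasInverses-⇔ V⊆W W⊆V inv x∈ x≉0 = let y , y∈ , eq = inv (Supp-mono W⊆V x∈) x≉0 in y , Supp-mono V⊆W y∈ , eq

  scalars-inverses : HasInverses (Supp scalars)
  scalars-inverses {x} x∈ x≉0 =
    let k , eq = Supp-scalars x∈
        l , kl≈1 = proj₂ K-field k (λ k≈0 → x≉0 (trans eq (trans (s-cong k≈0) s-0)))
    in s l , Supp-s scalars-isExtension l , trans (*-congʳ eq) (trans (sym (s-* k l)) (trans (s-cong kl≈1) s-1))

  signed-s : ∀ n k → signed n (s k) ≈ s (Determinant.signed K n k)
  signed-s zero k = refl
  signed-s (suc n) k = trans (-‿cong (signed-s n k)) (sym (s-‿- _))

  K⟨_⟩ : U.Carrier → Pred U.Carrier _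
  K⟨ v ⟩ = Adjoin scalars-isExtension v

  module _ {V : Pred U.Carrier f} (V-ext : IsExtension V) where
    private module V = IsExtension V-ext

    prime-step : ∀ {p x} → Prime p → x ∉ V → x U.↑ p ∈ V → HasInverses (Supp V) →
      (∀ {z} → z ∈ Supp V → ¬ (z ^ʳ p ≈ h (x U.↑ p))) → HasInverses (Supp (Adjoin V-ext x))
    prime-step {zero} p-prime = contradiction ≡.refl (ℕ.≢-nonZero⁻¹ 0 {{prime⇒nonZero p-prime}})
    prime-step {p@(suc m)} {x} p-prime x∉V x^p∈V V-inv no-root =
      adjoin-root (Supp-isSubring V-ext) (Supp-isSubring ext) (Supp-mono (V⊆Adjoin V-ext x)) V-inv p-prime
        (Supp-h ext (x∈Adjoin V-ext x)) (Supp-h V-ext x^p∈V) (Supp-h V-ext (V.⁻¹-closed x^p∈V))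
        (h-inverse (x U.↑ p)) (sym (h-↑ x p)) no-root
        (Adjoin-independent V-ext {x = x} {m = m} x^p∈V (prime-order V-ext p-prime x∉V x^p∈V))
          (Adjoin-span V-ext {x = x} {m = m} x^p∈V)
      where ext = Adjoin-isExtension V-ext {x = x} {m = m} x^p∈V

    norm-root : ∀ {m x} (x^m∈V : x U.↑ suc m ∈ V) → (∀ {j} → 0 ℕ.< j → j ℕ.< suc m → x U.↑ j ∉ V) →
      ∀ n {z} → z ∈ Supp (Adjoin V-ext x) → z ^ʳ n ≈ h x →
      ∃[ e ] (e ∈ Supp V × e ^ʳ n ≈ signed m (h (x U.↑ suc m)))
    norm-root {m} {x} x^m∈V order n z∈ z^n≈x =
      root-of-generator (Supp-isSubring V-ext) (Supp-isSubring ext) (Supp-mono (V⊆Adjoin V-ext x))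
        (Supp-h ext (x∈Adjoin V-ext x)) (Supp-h V-ext x^m∈V) (sym (h-↑ x (suc m)))
        (Adjoin-independent V-ext {x = x} {m = m} x^m∈V order) (Adjoin-span V-ext {x = x} {m = m} x^m∈V) n z∈ z^n≈x
      where ext = Adjoin-isExtension V-ext {x = x} {m = m} x^m∈V

  signed-cong : ∀ n {x y} → x ≈ y → signed n x ≈ signed n y
  signed-cong zero p = p
  signed-cong (suc n) p = -‿cong (signed-cong n p)

  module _ {β : U.Carrier} {m : ℕ} {a : AbelianGroup.Carrier (units K)} (β^m : β U.↑ suc m U.≈ ι a)
    (order : ∀ {j} → 0 ℕ.< j → j ℕ.< suc m → β U.↑ j ∉ scalars) where

    scalar-root : ∀ n {z} → z ∈ Supp K⟨ β ⟩ → z ^ʳ n ≈ h β → ∃[ e ] e K.^ʳ n K.≈ Determinant.signed K m (proj₁ a)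
    scalar-root n z∈ z^n≈β =
      let e , e∈ , eq = norm-root scalars-isExtension (a , β^m) order n z∈ z^n≈β
          e₀ , eq₀ = Supp-scalars e∈
      in e₀ , s-injective (trans (s-^ e₀ n) (trans (^-congˡ n (sym eq₀)) (trans eq
           (trans (signed-cong m (trans (h-cong β^m) (h-ι a))) (signed-s m (proj₁ a))))))

  -- A square root of β has a norm f in K[γ] with f² = ±γ, where γ² = a; comparing
  -- coefficients in f = c + dγ gives c² + d²a = 0 and 2cd = ±1.
  square-root : ∀ {β k a} → β U.↑ (suc k ℕ.+ suc k) U.≈ ι a →
    (∀ {j} → 0 ℕ.< j → j ℕ.< suc k ℕ.+ suc k → β U.↑ j ∉ scalars) →
    ∀ {z} → z ∈ Supp K⟨ β ⟩ → z ^ʳ 2 ≈ h β → ∃[ e ] proj₁ a K.≈ -4# K K.* e K.^ʳ 4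
  square-root {β} {k} {a} β^m order {z} z∈ z²≈β = from-norm
    (norm-root K⟨γ⟩-ext γ∈ order′ 2
      (Supp-mono (λ { (j , v , v∈ , p) → j , v , V⊆Adjoin scalars-isExtension γ v∈ , p }) z∈) z²≈β)
    where
    γ = β U.↑ suc k
    γ² : γ U.↑ 2 U.≈ ι a
    γ² = U.trans (U.∙-congˡ (U.↑-1 γ)) (U.trans (U.sym (U.↑-+ β (suc k) (suc k))) β^m)
    γ∉ : γ ∉ scalars
    γ∉ = order ℕ.z<s (ℕ.m<m+n (suc k) ℕ.z<s)
    γ-order : ∀ {j} → 0 ℕ.< j → j ℕ.< 2 → γ U.↑ j ∉ scalars
    γ-order {1} _ _ p = γ∉ (IsExtension.resp scalars-isExtension (U.↑-1 γ) p)
    γ-order {suc (suc _)} _ (ℕ.s≤s (ℕ.s≤s ()))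
    K⟨γ⟩-ext = Adjoin-isExtension scalars-isExtension {x = γ} {m = 1} (a , γ²)
    γ∈ : γ ∈ K⟨ γ ⟩
    γ∈ = x∈Adjoin scalars-isExtension γ
    order′ : ∀ {j} → 0 ℕ.< j → j ℕ.< suc k → β U.↑ j ∉ K⟨ γ ⟩
    order′ {j} 0<j j<k (i , v , v∈ , p) = order (ℕ.<-≤-trans 0<j (ℕ.m≤m+n j j)) (ℕ.+-mono-< j<k j<k)
      (resp (U.sym (U.trans (U.↑-+ β j j) (U.trans (U.∙-cong p p) (U.interchange _ _ _ _))))
        (∙-closed (∙-closed v∈ v∈) (resp doubled (U.↑-closed isSubgroup i (a , γ²)))))
      where
      open IsExtension scalars-isExtension
      doubled : (γ U.↑ 2) U.↑ i U.≈ γ U.↑ i U.∙ γ U.↑ i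
      doubled = U.trans (U.↑-cong i (U.∙-congˡ (U.↑-1 γ))) (U.↑-∙ γ γ i)
    from-norm : ∃[ f ] (f ∈ Supp K⟨ γ ⟩ × f ^ʳ 2 ≈ signed k (h γ)) → ∃[ e ] proj₁ a K.≈ -4# K K.* e K.^ʳ 4
    from-norm (f , f∈ , f²) with Adjoin-span scalars-isExtension {x = γ} {m = 1} (a , γ²) f∈
    ... | q , q∈ , f≈ = c₀ , conclusion
      where
      c₀ = proj₁ (Supp-scalars (q∈ zero))
      d₀ = proj₁ (Supp-scalars (q∈ (suc zero)))
      a₀ = proj₁ a
      f≈′ : f ≈ s c₀ + s d₀ * h γ
      f≈′ = trans f≈ (trans (+-cong (*-congʳ (proj₂ (Supp-scalars (q∈ zero))))
        (+-congʳ (*-congʳ (proj₂ (Supp-scalars (q∈ (suc zero)))))))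
        (solve 3 (λ c₀ d₀ g → c₀ :* :1 :+ (d₀ :* (g :* :1) :+ :0) := c₀ :+ d₀ :* g) refl (s c₀) (s d₀) (h γ)))
      hγ² : h γ * h γ ≈ s a₀
      hγ² = trans (sym (h-∙ γ γ)) (trans (h-cong (U.trans (U.∙-congˡ (U.sym (U.↑-1 γ))) γ²)) (h-ι a))
      f²-expanded : f ^ʳ 2 ≈ s (c₀ K.* c₀ K.+ d₀ K.* d₀ K.* a₀) + s (c₀ K.* d₀ K.+ c₀ K.* d₀) * h γ
      f²-expanded = begin
        f ^ʳ 2
          ≈⟨ *-cong f≈′ (trans (*-identityʳ _) f≈′) ⟩
        (s c₀ + s d₀ * h γ) * (s c₀ + s d₀ * h γ)
          ≈⟨ solve 3 (λ c₀ d₀ g → (c₀ :+ d₀ :* g) :* (c₀ :+ d₀ :* g) := (c₀ :* c₀ :+ d₀ :* d₀ :* (g :* g)) :+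
            (c₀ :* d₀ :+ c₀ :* d₀) :* g) refl (s c₀) (s d₀) (h γ) ⟩
        (s c₀ * s c₀ + s d₀ * s d₀ * (h γ * h γ)) + (s c₀ * s d₀ + s c₀ * s d₀) * h γ
          ≈⟨ +-congʳ (+-congˡ (*-congˡ hγ²)) ⟩
        (s c₀ * s c₀ + s d₀ * s d₀ * s a₀) + (s c₀ * s d₀ + s c₀ * s d₀) * h γ
          ≈⟨ +-cong (trans (s-+ _ _) (+-cong (s-* c₀ c₀) (trans (s-* _ a₀) (*-congʳ (s-* d₀ d₀)))))
               (*-congʳ (trans (s-+ _ _) (+-cong (s-* c₀ d₀) (s-* c₀ d₀)))) ⟨
        s (c₀ K.* c₀ K.+ d₀ K.* d₀ K.* a₀) + s (c₀ K.* d₀ K.+ c₀ K.* d₀) * h γ ∎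
      sign : ∃[ ε ] (ε K.* ε K.≈ K.1# × signed k (h γ) ≈ s ε * h γ)
      sign with RS.signed-± k (h γ)
      ... | inj₁ p = K.1# , K.*-identityˡ _ , trans p (sym (trans (*-congʳ s-1) (*-identityˡ _)))
      ... | inj₂ p = K.- K.1# , KI.solve 0 ((KI.:- KI.:1) KI.:* (KI.:- KI.:1) KI.:= KI.:1) K.refl ,
        trans p (trans (solve 1 (λ x → :- x := (:- :1) :* x) refl (h γ))
          (*-congʳ (sym (trans (s-‿- _) (-‿cong s-1)))))
      ε = proj₁ sign
      coefficients : Vector Carrier 2
      coefficients zero = s (c₀ K.* c₀ K.+ d₀ K.* d₀ K.* a₀)
      coefficients (suc zero) = s (c₀ K.* d₀ K.+ c₀ K.* d₀ K.- ε)
      relation : linear coefficients (powers (h γ)) ≈ 0#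
      relation = begin
        s A * 1# + (s (B K.- ε) * (h γ * 1#) + 0#)
          ≈⟨ +-congˡ (+-congʳ (*-congʳ (trans (s-+ B (K.- ε)) (+-congˡ (s-‿- ε))))) ⟩
        s A * 1# + ((s B - s ε) * (h γ * 1#) + 0#)
          ≈⟨ solve 4 (λ A B e g → A :* :1 :+ ((B :- e) :* (g :* :1) :+ :0) := (A :+ B :* g) :- e :* g) refl (s A)
            (s B) (s ε) (h γ) ⟩
        (s A + s B * h γ) - s ε * h γ
          ≈⟨ +-cong (trans (sym f²-expanded) (trans f² (proj₂ (proj₂ sign)))) refl ⟩
        s ε * h γ - s ε * h γ
          ≈⟨ -‿inverseʳ _ ⟩
        0# ∎
        where
        A = c₀ K.* c₀ K.+ d₀ K.* d₀ K.* a₀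
        B = c₀ K.* d₀ K.+ c₀ K.* d₀
      vanish = Adjoin-independent scalars-isExtension {x = γ} {m = 1} (a , γ²) γ-order coefficients
        (λ { zero → Supp-s scalars-isExtension _ ; (suc zero) → Supp-s scalars-isExtension _ }) relation
      first : c₀ K.* c₀ K.+ d₀ K.* d₀ K.* a₀ K.≈ K.0#
      first = s-injective (trans (vanish zero) (sym s-0))
      second : c₀ K.* d₀ K.+ c₀ K.* d₀ K.- ε K.≈ K.0#
      second = s-injective (trans (vanish (suc zero)) (sym s-0))
      module KR = Relation.Binary.Reasoning.Setoid K.setoid
      conclusion : a₀ K.≈ -4# K K.* c₀ K.^ʳ 4
      conclusion = KR.begin
        a₀
          KR.≈⟨ K.trans (K.*-congʳ (proj₁ (proj₂ sign))) (K.*-identityˡ _) ⟨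
        ε K.* ε K.* a₀
          KR.≈⟨ KI.solve 4 (λ a c₀ d₀ e → e KI.:* e KI.:* a KI.:=
             (KI.:- (KI.:1 KI.:+ KI.:1 KI.:+ KI.:1 KI.:+ KI.:1)) KI.:*
               (c₀ KI.:* (c₀ KI.:* (c₀ KI.:* (c₀ KI.:* KI.:1))))
               KI.:+ (c₀ KI.:* c₀ KI.:+ d₀ KI.:* d₀ KI.:* a) KI.:* ((c₀ KI.:+ c₀) KI.:* (c₀ KI.:+ c₀))
               KI.:+ (c₀ KI.:* d₀ KI.:+ c₀ KI.:* d₀ KI.:- e) KI.:*
                 ((KI.:- (c₀ KI.:* d₀ KI.:+ c₀ KI.:* d₀ KI.:+ e)) KI.:* a))
             K.refl a₀ c₀ d₀ ε ⟩
        -4# K K.* c₀ K.^ʳ 4 K.+ (c₀ K.* c₀ K.+ d₀ K.* d₀ K.* a₀) K.* ((c₀ K.+ c₀) K.* (c₀ K.+ c₀))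
          K.+ (c₀ K.* d₀ K.+ c₀ K.* d₀ K.- ε) K.* ((K.- (c₀ K.* d₀ K.+ c₀ K.* d₀ K.+ ε)) K.* a₀)
          KR.≈⟨ K.+-cong (K.+-congˡ (K.trans (K.*-congʳ first) (K.zeroˡ _))) (K.trans (K.*-congʳ second)
            (K.zeroˡ _)) ⟩
        -4# K K.* c₀ K.^ʳ 4 K.+ K.0# K.+ K.0#
          KR.≈⟨ K.trans (K.+-identityʳ _) (K.+-identityʳ _) ⟩
        -4# K K.* c₀ K.^ʳ 4 KR.∎

  record VahlenCapelli (n : ℕ) (v : U.Carrier) (a : AbelianGroup.Carrier (units K)) : Set (c ⊔ ℓ ⊔ ℓu) where
    field
      positive : 0 ℕ.< n
      power : v U.↑ n U.≈ ι a
      order : ∀ {j} → 0 ℕ.< j → j ℕ.< n → v U.↑ j ∉ scalars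
      no-root : ∀ {q} → Prime q → q ∣ n → ∀ e → ¬ (e K.^ʳ q K.≈ proj₁ a)
      no-fourth-root : 4 ∣ n → ∀ e → ¬ (proj₁ a K.≈ -4# K K.* e K.^ʳ 4)

  module _ {v : U.Carrier} {a : AbelianGroup.Carrier (units K)} {n p m-1 : ℕ} (p-prime : Prime p)
    (n≡mp : n ≡ suc m-1 ℕ.* p) (C : VahlenCapelli n v a) where

    open VahlenCapelli C
    open IsExtension scalars-isExtension
    private
      m = suc m-1
      β = v U.↑ p
      instance
        p≢0 = prime⇒nonZero p-prime

    β^m : β U.↑ m U.≈ ι a
    β^m = U.trans (U.sym (U.↑-* v m p)) (U.trans (U.reflexive (≡.cong (v U.↑_) (≡.sym n≡mp))) power)

    β-order : ∀ {j} → 0 ℕ.< j → j ℕ.< m → β U.↑ j ∉ scalars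
    β-order {j} 0<j j<m β^j = order (ℕ.>-nonZero⁻¹ (j ℕ.* p) {{ℕ.m*n≢0 j p {{ℕ.>-nonZero 0<j}}}})
      (≡.subst (j ℕ.* p ℕ.<_) (≡.sym n≡mp) (ℕ.*-monoˡ-< p j<m)) (resp (U.sym (U.↑-* v j p)) β^j)

    m<n : m ℕ.< n
    m<n = ≡.subst (m ℕ.<_) (≡.sym n≡mp) (ℕ.m<m*n m p (ℕ.nonTrivial⇒n>1 p {{prime⇒nonTrivial p-prime}}))

    private
      p∣n : p ∣ n
      p∣n = divides (suc m-1) n≡mp
      m∣n : m ∣ n
      m∣n = ≡.subst (m ∣_) (≡.sym n≡mp) (m∣m*n p)

    reduced : VahlenCapelli m β a
    reduced = record
      { positive = ℕ.z<s ; power = β^m ; order = β-order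
      ; no-root = λ q-prime q∣m → no-root q-prime (∣-trans q∣m m∣n)
      ; no-fourth-root = λ 4∣m → no-fourth-root (∣-trans 4∣m m∣n) }

    no-power : ∀ {z} → z ∈ Supp K⟨ β ⟩ → ¬ (z ^ʳ p ≈ h β)
    no-power {z} z∈ z^p = go (prime-parity p-prime) (scalar-root {β} {m-1} {a} β^m β-order p z∈ z^p)
      where
      odd : ∀ k → p ≡ suc (k ℕ.+ k) → ∀ e → e K.^ʳ p K.≈ K.- proj₁ a → (K.- e) K.^ʳ p K.≈ proj₁ a
      odd k ≡.refl e q = K.trans (KS.neg-odd-power k e) (K.trans (K.-‿cong q)
        (KI.solve 1 (λ x → KI.:- (KI.:- x) KI.:= x) K.refl (proj₁ a)))
      go : p ≡ 2 ⊎ ∃[ k ] p ≡ suc (k ℕ.+ k) → ¬ (∃[ e ] e K.^ʳ p K.≈ Determinant.signed K m-1 (proj₁ a))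
      go (inj₂ (k , eq)) (e , e^p) with KS.signed-± m-1 (proj₁ a)
      ... | inj₁ q = no-root p-prime p∣n e (K.trans e^p q)
      ... | inj₂ q = no-root p-prime p∣n (K.- e) (odd k eq e (K.trans e^p q))
      go (inj₁ p≡2) (e , e^p) = case (parity m-1)
        where
        doubling : ∀ k → (k ℕ.+ k) ℕ.* 2 ≡ k ℕ.* 4
        doubling k = ≡.trans (≡.cong (ℕ._* 2) (n+n≡n*2 k)) (ℕ.*-assoc k 2 2)
        case : ¬ ((∃[ k ] m-1 ≡ k ℕ.+ k) ⊎ (∃[ k ] m-1 ≡ suc (k ℕ.+ k)))
        case (inj₁ (k , eq)) = no-root p-prime p∣n e (K.trans e^p (K.trans
          (K.reflexive (≡.cong (λ m → Determinant.signed K m (proj₁ a)) eq)) (KS.signed-even k (proj₁ a))))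
        case (inj₂ (k , eq)) =
          let e , q = square-root {β} {k} {a} (U.trans (U.reflexive (≡.cong (β U.↑_) (≡.sym eq′))) β^m)
                        (λ {j} 0<j j<k → β-order 0<j (≡.subst (j ℕ.<_) (≡.sym eq′) j<k)) z∈
                        (trans (reflexive (≡.cong (z ^ʳ_) (≡.sym p≡2))) z^p)
          in no-fourth-root (divides (suc k) (≡.trans n≡mp (≡.trans (≡.cong₂ ℕ._*_ eq′ p≡2) (doubling (suc k))))) e q
          where
          eq′ : m ≡ suc k ℕ.+ suc k
          eq′ = ≡.trans (≡.cong suc eq) (≡.cong suc (≡.sym (ℕ.+-suc k k)))

    cyclic-step : HasInverses (Supp K⟨ β ⟩) → HasInverses (Supp K⟨ v ⟩)
    cyclic-step β-inv = HasInverses-⇔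
      (λ { (j , w , (i , w′ , w′∈ , p₁) , p₂) → p ℕ.* i ℕ.+ j , w′ , w′∈ , U.trans p₂ (U.trans (U.∙-congʳ p₁)
           (U.trans (U.assoc _ _ _) (U.∙-congˡ (U.trans (U.∙-congʳ (U.sym (U.↑-*′ v p i)))
             (U.sym (U.↑-+ v (p ℕ.* i) j)))))) })
      (λ { (j , w , w∈ , p) → j , w , V⊆Adjoin scalars-isExtension β w∈ , p })
      (prime-step (Adjoin-isExtension scalars-isExtension {x = β} {m = m-1} (a , β^m)) p-prime v∉
        (x∈Adjoin scalars-isExtension β) β-inv no-power)
      where
      v∉ : v ∉ K⟨ β ⟩
      v∉ (i , w , w∈ , q) = order {m} ℕ.z<s m<n (resp (U.sym (U.trans (U.↑-cong m q) (U.↑-∙ w _ m)))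
        (∙-closed (U.↑-closed isSubgroup m w∈) (resp (U.trans (U.sym (U.↑-*′ β m i)) (U.↑-* β m i))
          (U.↑-closed isSubgroup i (a , β^m)))))

  cyclic-inverses : ∀ n {v a} → VahlenCapelli n v a → HasInverses (Supp K⟨ v ⟩)
  cyclic-inverses n = go n (<-wellFounded n)
    where
    go : ∀ n → Acc ℕ._<_ n → ∀ {v a} → VahlenCapelli n v a → HasInverses (Supp K⟨ v ⟩)
    step : ∀ n → (∀ {m} → m ℕ.< n → Acc ℕ._<_ m) → ∀ {v a} → VahlenCapelli n v a →
      ∃[ p ] (Prime p × p ∣ n) → HasInverses (Supp K⟨ v ⟩)
    go zero _ C = contradiction (VahlenCapelli.positive C) λ ()
    go 1 _ {v} {a} C = HasInverses-⇔ (V⊆Adjoin scalars-isExtension v)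
      (λ { (j , w , w∈ , p) → resp (U.sym p)
        (∙-closed w∈ (U.↑-closed isSubgroup j (a , U.trans (U.sym (U.↑-1 v)) power))) })
      scalars-inverses
      where
      open IsExtension scalars-isExtension
      open VahlenCapelli C
    go (suc (suc n)) (acc rec) C = step (suc (suc n)) rec C (prime-divisor (ℕ.s<s ℕ.z<s))
    step n rec C (p , p-prime , divides zero eq) =
      contradiction (VahlenCapelli.positive C) (ℕ.≤⇒≯ (ℕ.≤-reflexive eq))
    step n rec C (p , p-prime , divides (suc m-1) n≡mp) = cyclic-step {m-1 = m-1} p-prime n≡mp C
      (go (suc m-1) (rec (m<n {m-1 = m-1} p-prime n≡mp C)) (reduced {m-1 = m-1} p-prime n≡mp C))

module Greedy (em : ∀ {e} → ExcludedMiddle e) (R : CommutativeRing c ℓ) where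
  open CommutativeRing R hiding (zero)
  open IntegerSolver R
  open Algebra.Properties.Semiring.Sum semiring
  open Subrings R
  open Relation.Binary.Reasoning.Setoid setoid

  module _ {M : Pred Carrier f} (M-sub : IsSubring M) (M-inv : HasInverses M) where
    open IsSubring M-sub

    Span-step : ∀ {n} {l : Vector Carrier n} b → Span M l ⊆ Span M (b ∷ᶠ l)
    Span-step b (q , q∈ , eq) = (0# ∷ᶠ q) , (λ { zero → 0-closed ; (suc i) → q∈ i }) ,
      trans eq (solve 2 (λ b l → l := :0 :* b :+ l) refl b _)

    Span-head : ∀ {n} {l : Vector Carrier n} b → b ∈ Span M (b ∷ᶠ l)
    Span-head {n} {l} b = (1# ∷ᶠ λ _ → 0#) , (λ { zero → 1-closed ; (suc i) → 0-closed }) ,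
      sym (trans (+-congˡ (sym (*-distribˡ-sum {n} 0# l))) (solve 2 (λ b l → :1 :* b :+ :0 :* l := b) refl b _))

    Independent-step : ∀ {n} {l : Vector Carrier n} {b} → Independent M l → ¬ (b ∈ Span M l) → Independent M (b ∷ᶠ l)
    Independent-step {n} {l} {b} indep b∉ q q∈ relation = λ { zero → q₀≈0 ; (suc i) → indep q′
      (λ i → q∈ (suc i)) relation′ i }
      where
      q₀ = q zero
      q′ : Vector Carrier n
      q′ i = q (suc i)
      q₀≈0 : q₀ ≈ 0#
      q₀≈0 with em {P = q₀ ≈ 0#}
      ... | yes p = p
      ... | no q₀≉0 = let t , t∈ , q₀t≈1 = M-inv (q∈ zero) q₀≉0 in contradiction
        ((λ i → - t * q′ i) , (λ i → *-closed (-‿closed t∈) (q∈ (suc i))) , (begin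
          b
            ≈⟨ *-identityˡ b ⟨
          1# * b
            ≈⟨ *-congʳ q₀t≈1 ⟨
          q₀ * t * b
            ≈⟨ solve 4 (λ q t b l → q :* t :* b := t :* (q :* b :+ l) :+ (:- t) :* l) refl q₀ t b (linear q′ l) ⟩
          t * (q₀ * b + linear q′ l) + - t * linear q′ l
            ≈⟨ +-congʳ (trans (*-congˡ relation) (zeroʳ t)) ⟩
          0# + - t * linear q′ l
            ≈⟨ +-identityˡ _ ⟩
          - t * linear q′ l
            ≈⟨ linear-*ˡ (- t) q′ l ⟩
          linear (λ i → - t * q′ i) l ∎)) b∉
      relation′ : linear q′ l ≈ 0#
      relation′ = trans (sym (trans (+-congʳ (trans (*-congʳ q₀≈0) (zeroˡ b))) (+-identityˡ _))) relation

    extract-basis : ∀ {E : Pred Carrier g} {n} (b : Vector Carrier n) → (∀ i → b i ∈ E) →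
      ∃[ m ] ∃[ l ] ((∀ (i : Fin m) → l i ∈ E) × Independent M l × (∀ i → b i ∈ Span M l))
    extract-basis {E = E} {n = zero} b b∈ = 0 , (λ ()) , (λ ()) , (λ _ _ _ ()) , λ ()
    extract-basis {E = E} {n = suc n} b b∈ with extract-basis {E = E} (b ∘ suc) (b∈ ∘ suc)
    ... | m , l , l∈ , indep , spanned with em {P = b zero ∈ Span M l}
    ...   | yes p = m , l , l∈ , indep , λ { zero → p ; (suc i) → spanned i }
    ...   | no p = suc m , (b zero ∷ᶠ l) , (λ { zero → b∈ zero ; (suc i) → l∈ i }) , Independent-step indep p ,
              λ { zero → Span-head (b zero) ; (suc i) → Span-step (b zero) (spanned i) }

record IsRingHom (R : CommutativeRing c ℓ) (S : CommutativeRing r ℓr)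
  (φ : CommutativeRing.Carrier R → CommutativeRing.Carrier S) : Set (c ⊔ ℓ ⊔ r ⊔ ℓr) where
  private
    module R = CommutativeRing R
    module S = CommutativeRing S
  field
    φ-cong : ∀ {x y} → x R.≈ y → φ x S.≈ φ y
    φ-+ : ∀ x y → φ (x R.+ y) S.≈ φ x S.+ φ y
    φ-* : ∀ x y → φ (x R.* y) S.≈ φ x S.* φ y
    φ-1 : φ R.1# S.≈ S.1#

  φ-0 : φ R.0# S.≈ S.0#
  φ-0 = Algebra.Properties.Ring.x+x≈x⇒x≈0 S.ring _ (S.trans (S.sym (φ-+ _ _)) (φ-cong (R.+-identityˡ _)))

  φ-‿- : ∀ x → φ (R.- x) S.≈ S.- φ x
  φ-‿- x = S.trans (IntegerSolver.solve S 2 (λ x y → x := (x :+ y) :- y) S.refl _ (φ x))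
    (S.trans (S.+-congʳ (S.trans (S.sym (φ-+ _ _)) (S.trans (φ-cong (R.-‿inverseˡ x)) φ-0))) (S.+-identityˡ _))
    where open IntegerSolver S

  φ-^ : ∀ x n → φ (Subrings._^ʳ_ R x n) S.≈ Subrings._^ʳ_ S (φ x) n
  φ-^ x zero = φ-1
  φ-^ x (suc n) = S.trans (φ-* _ _) (S.*-congˡ (φ-^ x n))

  φ-linear : ∀ {n} (q b : Vector R.Carrier n) → φ (Subrings.linear R q b) S.≈ Subrings.linear S (φ ∘ q) (φ ∘ b)
  φ-linear {zero} q b = φ-0
  φ-linear {suc n} q b = S.trans (φ-+ _ _) (S.+-cong (φ-* _ _) (φ-linear (q ∘ suc) (b ∘ suc)))

module Trace (em : ∀ {e} → ExcludedMiddle e)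
  {K : CommutativeRing c ℓ} {U : AbelianGroup u ℓu} {ι : AbelianGroup.Carrier (units K) → AbelianGroup.Carrier U}
  {R : CommutativeRing r ℓr}
  (K-field : IsField K) (ι-mono : IsMonomorphism (units K) U ι) (G : Graded K U ι R) where

  open GradedProperties em K-field ι-mono G
  open CommutativeRing R hiding (zero)
  open IntegerSolver R
  open Algebra.Properties.Semiring.Sum semiring
  open Subrings R
  open Greedy em R
  open Relation.Binary.Reasoning.Setoid setoid
  private
    module ΣK = Algebra.Properties.Semiring.Sum K.semiring
    module Rˣ = AbelianGroup (units R)
  open UnitPowers R
  open Powers (units R)

  scalarUnit : AbelianGroup.Carrier (units K) → Rˣ.Carrier
  scalarUnit (k , l , p) = s k , s l , trans (sym (s-* k l)) (trans (s-cong p) s-1)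

  scalarUnit-mono : IsMonomorphism (units K) (units R) scalarUnit
  scalarUnit-mono = record
    { isGroupHomomorphism = record
      { isMonoidHomomorphism = record
        { isMagmaHomomorphism = record
          { isRelHomomorphism = record { cong = s-cong }
          ; homo = λ _ _ → s-* _ _ }
        ; ε-homo = s-1 }
      ; ⁻¹-homo = λ _ → refl }
    ; injective = s-injective
    }

  IsScalar : Pred Carrier _
  IsScalar x = ∃[ k ] x ≈ s k

  isScalar⇒image : ∀ (w : Rˣ.Carrier) → IsScalar (proj₁ w) → w ∈ Image (units K) (units R) scalarUnit
  isScalar⇒image (w , w⁻¹ , p) (k , w≈k) = unit k≉0 , w≈k
    where
    k≉0 : ¬ (k K.≈ K.0#)
    k≉0 k≈0 = 1≉0 (trans (sym p) (trans (*-congʳ (trans w≈k (trans (s-cong k≈0) s-0))) (zeroˡ _)))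

  Scalars : Pred Rˣ.Carrier _
  Scalars = Image (units K) (units R) scalarUnit

  -- The conditions under which Xⁿ - wⁿ is irreducible over K, where n is the order of w modulo K^×.
  RootsAreScalar : Pred Rˣ.Carrier _
  RootsAreScalar w = ∀ j →
    (∀ {q} → Prime q → ∀ {x e} → (w ↑ j) ↑ q Rˣ.≈ scalarUnit x → proj₁ x K.≈ e K.^ʳ q → w ↑ j ∈ Scalars) ×
    (∀ {x e} → (w ↑ j) ↑ 4 Rˣ.≈ scalarUnit x → proj₁ x K.≈ -4# K K.* e K.^ʳ 4 → w ↑ j ∈ Scalars)

  record HasBasis (V : Pred U.Carrier f) (n : ℕ) (b : Fin n → U.Carrier) : Set (c ⊔ ℓ ⊔ u ⊔ r ⊔ ℓr ⊔ f) where
    field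
      member : ∀ d → b d ∈ V
      expand : ∀ {x} → x ∈ Supp V → x ≈ linear (λ d → s (coeff (b d) x)) (h ∘ b)
      size≉0 : ¬ (K.sum {n} (λ _ → K.1#) K.≈ K.0#)

  module _ {R′ : CommutativeRing r′ ℓr′} (G′ : Graded K (units R) scalarUnit R′)
    {φ : CommutativeRing.Carrier R′ → Carrier} (φ-hom : IsRingHom R′ R φ)
    (φ-s : ∀ k → φ (Graded.s G′ k) ≈ s k) (φ-h : ∀ w → φ (Graded.h G′ w) ≈ proj₁ w) where
    open IsRingHom φ-hom
    private
      module G′ = GradedProperties em K-field scalarUnit-mono G′
      module C′ = CyclicExtension em K-field scalarUnit-mono G′
      module R′ = CommutativeRing R′

    -- K[w] is a field with basis 1 , w , … , wⁿ⁻¹, being the image of a field K⟨W⟩ with W = K^×·⟨w⟩.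
    module Cyclic {w : Rˣ.Carrier} {m : ℕ} (w^n : w ↑ suc m ∈ G′.scalars)
      (order : ∀ {j} → 0 ℕ.< j → j ℕ.< suc m → w ↑ j ∉ G′.scalars)
      (inverses : Subrings.HasInverses R′ (G′.Supp C′.K⟨ w ⟩)) where

      private
        w₀ = proj₁ w
        ext′ = G′.Adjoin-isExtension G′.scalars-isExtension {x = w} {m = m} w^n
        module S′ = Subrings.IsSubring (G′.Supp-isSubring ext′)

      K[w] : Pred Carrier _
      K[w] x = ∃[ y ] (y ∈ G′.Supp C′.K⟨ w ⟩ × x ≈ φ y)

      K[w]-isSubring : IsSubring K[w]
      K[w]-isSubring = record
        { resp = λ { p (y , y∈ , q) → y , y∈ , trans (sym p) q }
        ; 0-closed = R′.0# , S′.0-closed , sym φ-0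
        ; 1-closed = R′.1# , S′.1-closed , sym φ-1
        ; +-closed = λ { (y , y∈ , p) (z , z∈ , q) → y R′.+ z , S′.+-closed y∈ z∈ , trans (+-cong p q)
          (sym (φ-+ y z)) }
        ; *-closed = λ { (y , y∈ , p) (z , z∈ , q) → y R′.* z , S′.*-closed y∈ z∈ , trans (*-cong p q)
          (sym (φ-* y z)) }
        ; -‿closed = λ { (y , y∈ , p) → R′.- y , S′.-‿closed y∈ , trans (-‿cong p) (sym (φ-‿- y)) }
        }

      K[w]-inverses : HasInverses K[w]
      K[w]-inverses (y , y∈ , x≈φy) x≉0 =
        let z , z∈ , yz≈1 = inverses y∈ (λ y≈0 → x≉0 (trans x≈φy (trans (φ-cong y≈0) φ-0)))
        in φ z , (z , z∈ , refl) , trans (*-congʳ x≈φy) (trans (sym (φ-* y z)) (trans (φ-cong yz≈1) φ-1))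

      w∈K[w] : w₀ ∈ K[w]
      w∈K[w] = G′.h w , G′.Supp-h ext′ (G′.x∈Adjoin G′.scalars-isExtension w) , sym (φ-h w)

      scalar∈K[w] : ∀ k → s k ∈ K[w]
      scalar∈K[w] k = G′.s k , G′.Supp-s ext′ k , sym (φ-s k)

      scalars-independent : Independent IsScalar (powers {suc m} w₀)
      scalars-independent q q∈ relation i = trans (proj₂ (q∈ i)) (trans (s-cong (k≈0 (y≈0 em))) s-0)
        where
        k : Fin (suc m) → K.Carrier
        k i = proj₁ (q∈ i)
        y = Subrings.linear R′ (G′.s ∘ k) (Subrings.powers R′ {suc m} (G′.h w))
        y∈ : y ∈ G′.Supp C′.K⟨ w ⟩
        y∈ = S′.∑-closed {suc m} {λ i → G′.s (k i) R′.* Subrings.powers R′ {suc m} (G′.h w) i} λ i → S′.*-closed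
          (G′.Supp-s ext′ (k i))
          (S′.^-closed (toℕ i) (G′.Supp-h ext′ (G′.x∈Adjoin G′.scalars-isExtension w)))
        φy≈0 : φ y ≈ 0#
        φy≈0 = trans (φ-linear {suc m} (G′.s ∘ k) (Subrings.powers R′ (G′.h w))) (trans
          (sum-cong-≋ {suc m} λ i → *-cong (trans (φ-s (k i)) (sym (proj₂ (q∈ i)))) (trans (φ-^ (G′.h w) (toℕ i))
            (^-congˡ (toℕ i) (φ-h w))))
          relation)
        y≈0 : Dec (y R′.≈ R′.0#) → y R′.≈ R′.0#
        y≈0 (yes p) = p
        y≈0 (no y≉0) = let z , _ , yz≈1 = inverses y∈ y≉0 in
          contradiction (trans (sym φ-1) (trans (φ-cong (R′.sym yz≈1))
            (trans (φ-* y z) (trans (*-congʳ φy≈0) (zeroˡ _))))) 1≉0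
        k≈0 : y R′.≈ R′.0# → k i K.≈ K.0#
        k≈0 p = G′.s-injective (R′.trans (G′.Adjoin-independent G′.scalars-isExtension {x = w} {m = m} w^n order
          (G′.s ∘ k) (λ i → G′.Supp-s G′.scalars-isExtension (k i)) p i) (R′.sym G′.s-0))

      K[w]-span : K[w] ⊆ Span IsScalar (powers {suc m} w₀)
      K[w]-span (y , y∈ , x≈φy) =
        let q , q∈ , eq = G′.Adjoin-span G′.scalars-isExtension {x = w} {m = m} w^n y∈ in
        (λ i → φ (q i)) ,
        (λ i → let k , p = C′.Supp-scalars (q∈ i) in k , trans (φ-cong p) (φ-s k)) ,
        trans x≈φy (trans (φ-cong eq) (trans (φ-linear {suc m} q (Subrings.powers R′ (G′.h w)))
          (sum-cong-≋ {suc m} λ i → *-congˡ {φ (q i)} (trans (φ-^ (G′.h w) (toℕ i)) (^-congˡ (toℕ i) (φ-h w))))))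

    module _ {V : Pred U.Carrier f} (V-ext : IsExtension V) (V-inv : HasInverses (Supp V))
      {N : ℕ} {b : Fin N → U.Carrier} (basis : HasBasis V N b) where
      open HasBasis basis
      private module E = IsSubring (Supp-isSubring V-ext)

      -- N times the coefficient of w at 1 is the trace of w. In the basis wⁱ lⱼ, where the lⱼ form a
      -- basis over K[w], the diagonal entries of multiplication by w vanish.
      trace-zero : ∀ {w : Rˣ.Carrier} {m} → proj₁ w ∈ Supp V → (w^n : w ↑ suc (suc m) ∈ G′.scalars) →
        (∀ {j} → 0 ℕ.< j → j ℕ.< suc (suc m) → w ↑ j ∉ G′.scalars) →
        Subrings.HasInverses R′ (G′.Supp C′.K⟨ w ⟩) → coeff U.ε (proj₁ w) K.≈ K.0#
      trace-zero {w} {m} w∈ w^n@(a , w^n≈a) order inverses with extract-basis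
          (Cyclic.K[w]-isSubring w^n order inverses) (Cyclic.K[w]-inverses w^n order inverses) {E = Supp V} (h ∘ b)
            (λ d → Supp-h V-ext (member d))
      ... | t , l , l∈ , l-indep , l-span = no-multiple
        where
        open Cyclic {w} {suc m} w^n order inverses
        n = suc (suc m)
        w₀ = proj₁ w
        open Determinant R using (companion; companion-row; lastEntry; δ)
        μ : Fin N → Fin t → Carrier
        μ d = proj₁ (l-span d)
        μ∈ : ∀ d j → μ d j ∈ K[w]
        μ∈ d = proj₁ (proj₂ (l-span d))
        q : Fin N → Fin t → Fin n → Carrier
        q d j = proj₁ (K[w]-span (μ∈ d j))
        κ : Fin N → Fin t → Fin n → K.Carrier
        κ d j i = proj₁ (proj₁ (proj₂ (K[w]-span (μ∈ d j))) i)
        q≈κ : ∀ d j i → q d j i ≈ s (κ d j i)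
        q≈κ d j i = proj₂ (proj₁ (proj₂ (K[w]-span (μ∈ d j))) i)
        μ≈ : ∀ d j → μ d j ≈ linear (q d j) (powers w₀)
        μ≈ d j = proj₂ (proj₂ (K[w]-span (μ∈ d j)))
        image : Fin n → Fin t → Carrier
        image i j = w₀ ^ʳ suc (toℕ i) * l j
        image∈ : ∀ i j → image i j ∈ Supp V
        image∈ i j = E.*-closed (E.^-closed (suc (toℕ i)) w∈) (l∈ j)
        γ : Fin n → Fin t → Fin N → K.Carrier
        γ i j d = coeff (b d) (image i j)
        ρ : Fin n → Fin t → Fin t → Carrier
        ρ i j j′ = linear (s ∘ γ i j) (λ d → μ d j′)
        image-expanded : ∀ i j → image i j ≈ linear (ρ i j) l
        image-expanded i j = trans (expand (image∈ i j)) (trans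
          (sum-cong-≋ {N} λ d → *-congˡ (proj₂ (proj₂ (l-span d)))) (linear-⊡ (s ∘ γ i j) μ l))
        module M = IsSubring K[w]-isSubring
        diagonal : ∀ i j → ρ i j j ≈ w₀ ^ʳ suc (toℕ i)
        diagonal i j = begin
          ρ i j j                                              ≈⟨ solve 2 (λ x y → x := (x :- y) :+ y) refl _
            (W * δ j j) ⟩
          (ρ i j j - W * δ j j) + W * δ j j                    ≈⟨ +-cong (l-indep difference difference∈ relation j)
            (trans (*-congˡ (δ-diag j)) (*-identityʳ W)) ⟩
          0# + W                                               ≈⟨ +-identityˡ W ⟩
          W                                                    ∎
          where
          W = w₀ ^ʳ suc (toℕ i)
          δ-diag : ∀ {n} (j : Fin n) → δ j j ≈ 1#
          δ-diag zero = refl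
          δ-diag (suc j) = δ-diag j
          difference : Vector Carrier t
          difference j′ = ρ i j j′ - W * δ j j′
          difference∈ : ∀ j′ → difference j′ ∈ K[w]
          difference∈ j′ = M.+-closed (M.∑-closed {N} λ d → M.*-closed (scalar∈K[w] _) (μ∈ d j′))
            (M.-‿closed (M.*-closed (M.^-closed (suc (toℕ i)) w∈K[w]) (M.δ-closed j j′)))
          relation : linear difference l ≈ 0#
          relation = trans (linear-- (ρ i j) (λ j′ → W * δ j j′) l) (trans
            (+-cong (sym (image-expanded i j))
              (-‿cong (trans (sym (linear-*ˡ W (δ j) l)) (*-congˡ (linear-δ j l))))) (-‿inverseʳ _))
        powers-expanded : ∀ i j → w₀ ^ʳ suc (toℕ i) ≈ linear (λ i′ → linear (s ∘ γ i j) (λ d → q d j i′))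
          (powers {n} w₀)
        powers-expanded i j = trans (sym (diagonal i j)) (trans (sum-cong-≋ {N} λ d → *-congˡ (μ≈ d j))
          (linear-⊡ (s ∘ γ i j) (λ d → q d j) (powers {n} w₀)))
        A = s (proj₁ a)
        shifted : ∀ i → w₀ ^ʳ suc (toℕ i) ≈ linear (companion {suc m} A i) (powers {n} w₀)
        shifted i = sym (trans (+-cong (*-identityʳ _) (sum-cong-≋ {suc m} λ j → *-congˡ {δ (inject₁ j) i}
          (reflexive (≡.cong (λ k → w₀ ^ʳ suc k) (≡.sym (Fin.toℕ-inject₁ j))))))
          (companion-row A (λ i → w₀ ^ʳ suc (toℕ i)) i
            (trans (reflexive (≡.trans (≡.cong (λ k → w₀ ^ʳ suc k) (Fin.toℕ-fromℕ (suc m)))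
              (≡.sym (proj₁-↑ w n)))) w^n≈a)))
        companion-diagonal : ∀ i → companion {suc m} A i i ≈ 0#
        companion-diagonal zero = refl
        companion-diagonal (suc i) = off i
          where
          off : ∀ {n} (i : Fin n) → δ (inject₁ i) (suc i) ≈ 0#
          off zero = refl
          off (suc i) = off i
        companion-scalar : ∀ i j → IsScalar (companion {suc m} A i j)
        companion-scalar i zero = lastEntry-scalar i
          where
          lastEntry-scalar : ∀ {n} (i : Fin (suc n)) → IsScalar (lastEntry A i)
          lastEntry-scalar {zero} i = proj₁ a , refl
          lastEntry-scalar {suc n} zero = K.0# , sym s-0
          lastEntry-scalar {suc n} (suc i) = lastEntry-scalar i
        companion-scalar i (suc j) = δ-scalar (inject₁ j) i
          where
          δ-scalar : ∀ {n} (i j : Fin n) → IsScalar (δ i j)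
          δ-scalar zero zero = K.1# , sym s-1
          δ-scalar zero (suc j) = K.0# , sym s-0
          δ-scalar (suc i) zero = K.0# , sym s-0
          δ-scalar (suc i) (suc j) = δ-scalar i j
        s-sum : ∀ {n} (v : Vector K.Carrier n) → s (K.sum v) ≈ sum (s ∘ v)
        s-sum {zero} v = s-0
        s-sum {suc n} v = trans (s-+ _ _) (+-congˡ (s-sum (v ∘ suc)))
        entries : ∀ i j i′ → linear (s ∘ γ i j) (λ d → q d j i′) ≈ s (K.sum {N} (λ d → γ i j d K.* κ d j i′))
        entries i j i′ = trans (sum-cong-≋ {N} λ d → trans (*-congˡ (q≈κ d j i′)) (sym (s-* (γ i j d) (κ d j i′))))
          (sym (s-sum {N} (λ d → γ i j d K.* κ d j i′)))
        diagonal-zero : ∀ i j → K.sum {N} (λ d → γ i j d K.* κ d j i) K.≈ K.0#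
        diagonal-zero i j = s-injective (begin
          s (K.sum {N} (λ d → γ i j d K.* κ d j i))
            ≈⟨ entries i j i ⟨
          e i
            ≈⟨ solve 2 (λ x y → x := (x :- y) :+ y) refl _ (companion {suc m} A i i) ⟩
          (e i - companion {suc m} A i i) + companion {suc m} A i i
            ≈⟨ +-cong (scalars-independent (λ i′ → e i′ - companion {suc m} A i i′) scalar relation i)
              (companion-diagonal i) ⟩
          0# + 0#
            ≈⟨ trans (+-identityˡ _) (sym s-0) ⟩
          s K.0# ∎)
          where
          e : Vector Carrier n
          e i′ = linear (s ∘ γ i j) (λ d → q d j i′)
          scalar : ∀ i′ → IsScalar (e i′ - companion {suc m} A i i′)
          scalar i′ = let k , p = companion-scalar i i′ in _ K.- k ,
            trans (+-cong (entries i j i′) (-‿cong p)) (trans (+-congˡ (sym (s-‿- k))) (sym (s-+ _ (K.- k))))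
          relation : linear (λ i′ → e i′ - companion {suc m} A i i′) (powers {n} w₀) ≈ 0#
          relation = trans (linear-- e (companion {suc m} A i) (powers w₀)) (trans
            (+-cong (sym (powers-expanded i j)) (-‿cong (sym (shifted i)))) (-‿inverseʳ _))
        product-expanded : ∀ d → h (b d) * w₀ ≈ sum {t} (λ j → sum {n} (λ i → s (κ d j i) * image i j))
        product-expanded d = begin
          h (b d) * w₀
            ≈⟨ *-congʳ (proj₂ (proj₂ (l-span d))) ⟩
          linear (μ d) l * w₀
            ≈⟨ *-distribʳ-sum {t} w₀ (λ j → μ d j * l j) ⟩
          sum {t} (λ j → μ d j * l j * w₀)
            ≈⟨ sum-cong-≋ {t} (λ j → begin
                 μ d j * l j * w₀
                   ≈⟨ solve 3 (λ m l w → m :* l :* w := w :* l :* m) refl (μ d j) (l j) w₀ ⟩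
                 w₀ * l j * μ d j
                   ≈⟨ *-congˡ (μ≈ d j) ⟩
                 w₀ * l j * linear (q d j) (powers {n} w₀)
                   ≈⟨ *-distribˡ-sum {n} (w₀ * l j) (λ i → q d j i * powers w₀ i) ⟩
                 sum {n} (λ i → w₀ * l j * (q d j i * powers w₀ i))
                   ≈⟨ sum-cong-≋ {n} (λ i → trans
                     (solve 4 (λ w l q p → w :* l :* (q :* p) := q :* (w :* p :* l)) refl w₀ (l j) (q d j i)
                       (powers {n} w₀ i))
                        (*-congʳ (q≈κ d j i))) ⟩
                 sum {n} (λ i → s (κ d j i) * image i j) ∎) ⟩
          sum {t} (λ j → sum {n} (λ i → s (κ d j i) * image i j)) ∎
        module KR = Relation.Binary.Reasoning.Setoid K.setoid
        τ = coeff U.ε w₀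
        trace : ∀ d → τ K.≈ K.sum {t} (λ j → K.sum {n} (λ i → γ i j d K.* κ d j i))
        trace d = KR.begin
          τ
            KR.≈⟨ K.trans (coeff-cong (U.sym (U.identityʳ (b d))) refl) (coeff-shift (b d) U.ε w₀) ⟨
          coeff (b d) (h (b d) * w₀)
            KR.≈⟨ coeff-cong U.refl (product-expanded d) ⟩
          coeff (b d) (sum {t} (λ j → sum {n} (λ i → s (κ d j i) * image i j)))
            KR.≈⟨ coeff-sum {t} (b d) (λ j → sum {n} (λ i → s (κ d j i) * image i j)) ⟩
          K.sum {t} (λ j → coeff (b d) (sum {n} (λ i → s (κ d j i) * image i j)))
            KR.≈⟨ ΣK.sum-cong-≋ {t} (λ j → K.trans (coeff-sum {n} (b d) (λ i → s (κ d j i) * image i j))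
                 (ΣK.sum-cong-≋ {n} λ i → K.trans (coeff-* (b d) (κ d j i) (image i j))
                   (K.*-comm (κ d j i) (γ i j d)))) ⟩
          K.sum {t} (λ j → K.sum {n} (λ i → γ i j d K.* κ d j i)) KR.∎
        zeros : ∀ n (v : Vector K.Carrier n) → (∀ i → v i K.≈ K.0#) → K.sum v K.≈ K.0#
        zeros n v p = K.trans (ΣK.sum-cong-≋ {n} p) (ΣK.sum-replicate-zero n)
        multiple : K.sum {N} (λ _ → K.1#) K.* τ K.≈ K.0#
        multiple = KR.begin
          K.sum {N} (λ _ → K.1#) K.* τ
            KR.≈⟨ ΣK.*-distribʳ-sum {N} τ (λ _ → K.1#) ⟩
          K.sum {N} (λ _ → K.1# K.* τ)
            KR.≈⟨ ΣK.sum-cong-≋ {N} (λ d → K.trans (K.*-identityˡ τ) (trace d)) ⟩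
          K.sum {N} (λ d → K.sum {t} (λ j → K.sum {n} (λ i → γ i j d K.* κ d j i)))
            KR.≈⟨ ΣK.∑-comm (λ d j → K.sum {n} (λ i → γ i j d K.* κ d j i)) ⟩
          K.sum {t} (λ j → K.sum {N} (λ d → K.sum {n} (λ i → γ i j d K.* κ d j i)))
            KR.≈⟨ zeros t _ (λ j → K.trans (ΣK.∑-comm (λ d i → γ i j d K.* κ d j i))
              (zeros n _ λ i → diagonal-zero i j)) ⟩
          K.0# KR.∎
        no-multiple : τ K.≈ K.0#
        no-multiple with em {P = K.sum {N} (λ _ → K.1#) K.≈ K.0#}
        ... | yes p = contradiction p size≉0
        ... | no p = let y , eq = proj₂ K-field _ p in
          K.trans (K.sym (K.*-identityˡ τ)) (K.trans (K.*-congʳ (K.trans (K.sym eq) (K.*-comm _ y)))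
            (K.trans (K.*-assoc _ _ _) (K.trans (K.*-congˡ multiple) (K.zeroʳ y))))

      scalar-or-trace-zero : ∀ (w : Rˣ.Carrier) → proj₁ w ∈ Supp V → ∀ {M} → 0 ℕ.< M → w ↑ M ∈ Scalars →
        RootsAreScalar w → w ∈ Scalars ⊎ coeff U.ε (proj₁ w) K.≈ K.0#
      scalar-or-trace-zero w w∈ {M} 0<M w^M∈ roots =
        find (least em (λ j → 0 ℕ.< j × w ↑ j ∈ Scalars) (suc M))
        where
        find : (∃[ d ] (d ℕ.< suc M × (0 ℕ.< d × w ↑ d ∈ Scalars) ×
          (∀ j → j ℕ.< d → ¬ (0 ℕ.< j × w ↑ j ∈ Scalars)))) ⊎
               (∀ j → j ℕ.< suc M → ¬ (0 ℕ.< j × w ↑ j ∈ Scalars)) → w ∈ Scalars ⊎ coeff U.ε (proj₁ w) K.≈ K.0#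
        find (inj₂ never) = contradiction (0<M , w^M∈) (never M (ℕ.n<1+n M))
        find (inj₁ (suc zero , _ , (_ , (a , p)) , _)) = inj₁ (a , trans (sym (*-identityʳ (proj₁ w))) p)
        find (inj₁ (n@(suc (suc m)) , _ , (_ , w^n@(a , p)) , least)) = inj₂ (trace-zero w∈ w^n order
          (C′.cyclic-inverses n {w} {a} (record
            { positive = ℕ.z<s ; power = p ; order = order ; no-root = no-root ; no-fourth-root = no-fourth })))
          where
          order : ∀ {j} → 0 ℕ.< j → j ℕ.< n → w ↑ j ∉ Scalars
          order {j} 0<j j<n w^j∈ = least j j<n (0<j , w^j∈)
          power : ∀ j q → n ≡ j ℕ.* q → (w ↑ j) ↑ q Rˣ.≈ scalarUnit a
          power j q eq = trans (sym (↑-*′ w j q)) (trans (reflexive (≡.cong (λ m → proj₁ (w ↑ m)) (≡.sym eq))) p)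
          impossible : ∀ j q → 1 ℕ.< q → n ≡ j ℕ.* q → w ↑ j ∉ Scalars
          impossible zero q 1<q ()
          impossible j@(suc _) q 1<q eq = order {j} ℕ.z<s (≡.subst (j ℕ.<_) (≡.sym eq) (ℕ.m<m*n j q 1<q))
          no-root : ∀ {q} → Prime q → q ∣ n → ∀ e → ¬ (e K.^ʳ q K.≈ proj₁ a)
          no-root {q} q-prime (divides j eq) e e^q = impossible j q
            (ℕ.nonTrivial⇒n>1 q {{prime⇒nonTrivial q-prime}}) eq
            (proj₁ (roots j) q-prime {a} {e} (power j q eq) (K.sym e^q))
          no-fourth : 4 ∣ n → ∀ e → ¬ (proj₁ a K.≈ -4# K K.* e K.^ʳ 4)
          no-fourth (divides j eq) e a≈ = impossible j 4 (ℕ.s<s ℕ.z<s) eq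
            (proj₂ (roots j) {a} {e} (power j 4 eq) a≈)

prime-coprime : ∀ {p n} → Prime p → p ∤ n → Coprime p n
prime-coprime p-prime p∤n (d∣p , d∣n) with prime⇒irreducible p-prime d∣p
... | inj₁ d≡1 = d≡1
... | inj₂ ≡.refl = contradiction d∣n p∤n

prime∤prime : ∀ {p q} → Prime p → Prime q → p ≢ q → p ∤ q
prime∤prime p-prime q-prime p≢q p∣q with prime⇒irreducible q-prime p∣q
... | inj₁ ≡.refl = contradiction (ℕ.nonTrivial⇒n>1 1 {{prime⇒nonTrivial p-prime}}) (ℕ.<-irrefl ≡.refl)
... | inj₂ p≡q = p≢q p≡q

odd-prime∤4 : ∀ {p} → Prime p → 3 ℕ.≤ p → p ∤ 4
odd-prime∤4 p-prime 3≤p p∣4 with euclidsLemma 2 2 p-prime p∣4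
... | inj₁ p∣2 = contradiction (ℕ.≤-trans 3≤p (∣⇒≤ p∣2)) (ℕ.<-irrefl ≡.refl)
... | inj₂ p∣2 = contradiction (ℕ.≤-trans 3≤p (∣⇒≤ p∣2)) (ℕ.<-irrefl ≡.refl)

module PrimePowers (G : AbelianGroup a ℓ) {S : Pred (AbelianGroup.Carrier G) f} (S-sub : IsSubgroup G S) where
  open AbelianGroup G
  open Powers G
  open IsSubgroup S-sub

  power-closed : ∀ {x m} n → x ↑ m ∈ S → x ↑ (m ℕ.* n) ∈ S
  power-closed {x} {m} n p = resp (sym (↑-*′ x m n)) (↑-closed S-sub n p)

  power-closed′ : ∀ {x n} m → x ↑ n ∈ S → x ↑ (m ℕ.* n) ∈ S
  power-closed′ {x} {n} m p = resp (sym (↑-* x m n)) (↑-closed S-sub m p)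

  prime-power-coprime : ∀ {p n} → Prime p → p ∤ n → ∀ k {x} → x ↑ (p ℕ.^ k) ∈ S → x ↑ n ∈ S → x ∈ S
  prime-power-coprime p-prime p∤n zero {x} x^1 x^n = resp (↑-1 x) x^1
  prime-power-coprime {p} {n} p-prime p∤n (suc k) {x} x^ x^n =
    prime-power-coprime p-prime p∤n k
      (coprime-powers S-sub (prime-coprime p-prime p∤n)
        (resp (↑-* x p (p ℕ.^ k)) x^)
        (resp (trans (↑-*′ x n (p ℕ.^ k)) (trans (sym (↑-* x (p ℕ.^ k) n))
          (trans (reflexive (≡.cong (x ↑_) (ℕ.*-comm (p ℕ.^ k) n))) (↑-* x n (p ℕ.^ k)))))
          (power-closed {x} {n} (p ℕ.^ k) x^n))) x^n

module ScalarFacts (K : CommutativeRing c ℓ) (K-field : IsField K) where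
  open CommutativeRing K hiding (zero)
  open IntegerSolver K
  open Subrings K using (_^ʳ_; ^-congˡ; ^-distrib-*)
  open Relation.Binary.Reasoning.Setoid setoid
  private module Kˣ = AbelianGroup (units K)

  2# : Carrier
  2# = 1# + 1#

  unit-of : ∀ {k} → ¬ (k ≈ 0#) → Kˣ.Carrier
  unit-of {k} k≉0 = k , proj₂ K-field k k≉0

  unit-nonzero : (x : Kˣ.Carrier) → ¬ (proj₁ x ≈ 0#)
  unit-nonzero (x , y , p) x≈0 = proj₁ K-field (trans (sym p) (trans (*-congʳ x≈0) (zeroˡ y)))

  abstract
    -1*-1≈1 : - 1# * - 1# ≈ 1#
    -1*-1≈1 = solve 0 ((:- :1) :* (:- :1) := :1) refl

  -1-unit : Kˣ.Carrier
  -1-unit = - 1# , - 1# , -1*-1≈1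

id-isMonomorphism : ∀ (H : AbelianGroup a ℓ) → IsMonomorphism H H id
id-isMonomorphism H = record
  { isGroupHomomorphism = record
    { isMonoidHomomorphism = record
      { isMagmaHomomorphism = record { isRelHomomorphism = record { cong = id } ; homo = λ _ _ → refl }
      ; ε-homo = refl }
    ; ⁻¹-homo = λ _ → refl }
  ; injective = id
  }
  where open AbelianGroup H

-- The identity (1 + i)⁴ = -4 behind the exceptional case: if y⁴ = -4e⁴ then (y / e)² / 2 is a
-- square root i of -1, and (y / e)² = (1 + i)².
module FourthRoots (K : CommutativeRing c ℓ) (K-field : IsField K)
  (G : AbelianGroup a g) (ι : AbelianGroup.Carrier (units K) → AbelianGroup.Carrier G)
  (ι-mono : IsMonomorphism (units K) G ι) where

  open CommutativeRing K hiding (zero)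
  open IntegerSolver K
  open ScalarFacts K K-field
  open Subrings K using (_^ʳ_; ^-congˡ; ^-distrib-*)
  private
    module Kˣ = AbelianGroup (units K)
    module G = AbelianGroup G
    module GP = Powers G
    module ι = GroupMorphisms.IsGroupMonomorphism ι-mono

  ι-↑ : ∀ x n → ι (Powers._↑_ (units K) x n) G.≈ ι x GP.↑ n
  ι-↑ x zero = ι.ε-homo
  ι-↑ x (suc n) = G.trans (ι.∙-homo _ _) (G.∙-congˡ (ι-↑ x n))

  scalars : Pred G.Carrier _
  scalars = Image (units K) G ι

  ι-∙-closed : ∀ {y} x → y G.∙ ι x ∈ scalars → y ∈ scalars
  ι-∙-closed {y} x (z , p) = z Kˣ.∙ x Kˣ.⁻¹ , (G.trans (G.sym (G.identityʳ y)) (G.trans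
    (G.∙-congˡ (G.sym (G.inverseʳ (ι x)))) (G.trans (G.sym (G.assoc _ _ _))
      (G.trans (G.∙-cong p (G.sym (ι.⁻¹-homo x))) (G.sym (ι.∙-homo z (x Kˣ.⁻¹)))))))

  divide-power : ∀ {y x z} n → y GP.↑ n G.≈ ι x → (y G.∙ ι (z Kˣ.⁻¹)) GP.↑ n G.≈ ι (x Kˣ.∙ Powers._↑_ (units K)
    (z Kˣ.⁻¹) n)
  divide-power {y} {x} {z} n p = G.trans (GP.↑-∙ y _ n) (G.trans (G.∙-cong p (G.sym (ι-↑ (z Kˣ.⁻¹) n)))
    (G.sym (ι.∙-homo x _)))

  module _ {y x e} (y⁴ : y GP.↑ 4 G.≈ ι x) (x≈ : proj₁ x ≈ -4# K * e ^ʳ 4) where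
    private
      e≉0 : ¬ (e ≈ 0#)
      e≉0 e≈0 = unit-nonzero x (trans x≈ (trans (*-congˡ (trans (*-congʳ e≈0) (zeroˡ _))) (zeroʳ _)))
      2≉0 : ¬ (2# ≈ 0#)
      2≉0 2≈0 = unit-nonzero x
        (trans x≈ (trans (*-congʳ (trans (solve 0 (:- (:1 :+ :1 :+ :1 :+ :1) := (:1 :+ :1) :* (:- (:1 :+ :1))) refl)
          (trans (*-congʳ 2≈0) (zeroˡ _)))) (zeroˡ _)))
      ê = unit-of e≉0
      two = unit-of 2≉0
      e⁻¹ = proj₁ (proj₂ ê)
      half = proj₁ (proj₂ two)
      e*e⁻¹ : e * e⁻¹ ≈ 1#
      e*e⁻¹ = proj₂ (proj₂ ê)
      2*half : 2# * half ≈ 1#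
      2*half = proj₂ (proj₂ two)
      ρ = y G.∙ ι (ê Kˣ.⁻¹)
      r⁴-unit = x Kˣ.∙ Powers._↑_ (units K) (ê Kˣ.⁻¹) 4
      r⁴ : ρ GP.↑ 4 G.≈ ι r⁴-unit
      r⁴ = divide-power {z = ê} 4 y⁴
      r⁴≈-4 : proj₁ r⁴-unit ≈ -4# K
      r⁴≈-4 = trans (*-congʳ x≈) (trans
        (solve 3 (λ f e d → f :* (e :* (e :* (e :* (e :* :1)))) :* (d :* (d :* (d :* (d :* :1)))) :=
          f :* ((e :* d) :* (e :* d) :* ((e :* d) :* (e :* d)))) refl (-4# K) e e⁻¹)
        (trans (*-congˡ (trans (*-cong (*-cong e*e⁻¹ e*e⁻¹) (*-cong e*e⁻¹ e*e⁻¹))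
          (solve 0 (:1 :* :1 :* (:1 :* :1) := :1) refl))) (*-identityʳ _)))
    i : G.Carrier
    i = ρ GP.↑ 2 G.∙ ι (two Kˣ.⁻¹)
    i² : i GP.↑ 2 G.≈ ι -1-unit
    i² = G.trans (divide-power {x = r⁴-unit} {z = two} 2 (G.trans (G.sym (GP.↑-* ρ 2 2)) r⁴))
      (ι.⟦⟧-cong (trans (*-congʳ r⁴≈-4)
      (trans (solve 1 (λ h → :- (:1 :+ :1 :+ :1 :+ :1) :* (h :* (h :* :1)) := :-
        (((:1 :+ :1) :* h) :* ((:1 :+ :1) :* h))) refl half)
        (-‿cong (trans (*-cong 2*half 2*half) (*-identityˡ _))))))

    fourth-root :
      (∀ {y} x → y GP.↑ 2 G.≈ ι x GP.↑ 2 → y ∈ scalars) →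
      (¬ (2# ≈ 0#) → ∃[ y ] ∃[ x ] (proj₁ x ≈ -4# K × y GP.↑ 4 G.≈ ι x) → ∀ {y} → y GP.↑ 2 G.≈ ι -1-unit →
        y ∈ scalars) →
      y ∈ scalars
    fourth-root square i-scalar = ι-∙-closed (ê Kˣ.⁻¹) (square (unit-of 1+j≉0) y/e²)
      where
      i∈ : i ∈ scalars
      i∈ = i-scalar 2≉0 (ρ , r⁴-unit , r⁴≈-4 , r⁴) i²
      j₀ = proj₁ i∈
      j = proj₁ j₀
      j² : j * j ≈ - 1#
      j² = trans (*-congˡ (sym (*-identityʳ j)))
        (ι.injective (G.trans (ι-↑ j₀ 2) (G.trans (GP.↑-cong 2 (G.sym (proj₂ i∈))) i²)))
      2j = two Kˣ.∙ j₀
      square-1+j : (1# + j) * ((1# + j) * 1#) ≈ proj₁ 2j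
      square-1+j = trans (solve 1 (λ j → (:1 :+ j) :* ((:1 :+ j) :* :1) := (:1 :+ :1) :* j :+ (:1 :+ j :* j)) refl j)
        (trans (+-congˡ (trans (+-congˡ j²) (-‿inverseʳ 1#))) (+-identityʳ _))
      1+j≉0 : ¬ (1# + j ≈ 0#)
      1+j≉0 p = unit-nonzero 2j (trans (sym square-1+j) (trans (*-congʳ p) (zeroˡ _)))
      r² : ρ GP.↑ 2 G.≈ ι 2j
      r² = G.trans (G.sym (G.trans (G.assoc _ _ _)
        (G.trans (G.∙-congˡ (G.trans (G.sym (ι.∙-homo (two Kˣ.⁻¹) two))
          (G.trans (ι.⟦⟧-cong (trans (*-comm _ _) 2*half)) ι.ε-homo)))
        (G.identityʳ _)))) (G.trans (G.∙-congʳ (proj₂ i∈)) (G.trans (G.sym (ι.∙-homo j₀ two))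
          (ι.⟦⟧-cong (*-comm _ _))))
      y/e² : ρ GP.↑ 2 G.≈ ι (unit-of 1+j≉0) GP.↑ 2
      y/e² = G.trans r² (G.trans (ι.⟦⟧-cong (sym square-1+j)) (ι-↑ (unit-of 1+j≉0) 2))

  module _ {p : ℕ} (torsion : ∀ {x} → x GP.↑ p G.≈ G.ε → x ∈ scalars) where

    prime-root : ∀ {y} x → y GP.↑ p G.≈ ι x GP.↑ p → y ∈ scalars
    prime-root {y} x q = ι-∙-closed (x Kˣ.⁻¹) (torsion
      (G.trans (GP.↑-∙ y _ p) (G.trans (G.∙-cong q (G.trans (GP.↑-cong p (ι.⁻¹-homo x)) (GP.⁻¹-↑ (ι x) p)))
        (G.inverseʳ _))))

  prime-root′ : ∀ {p} → Prime p → (∀ {x} → x GP.↑ p G.≈ G.ε → x ∈ scalars) →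
    ∀ {y x e} → y GP.↑ p G.≈ ι x → proj₁ x ≈ e ^ʳ p → y ∈ scalars
  prime-root′ {suc p} p-prime torsion {y} {x} {e} q x≈ = prime-root {suc p} torsion ê
    (G.trans q (G.trans (ι.⟦⟧-cong (trans x≈ (reflexive (≡.sym (UnitPowers.proj₁-↑ K ê (suc p)))))) (ι-↑ ê (suc p))))
    where
    e≉0 : ¬ (e ≈ 0#)
    e≉0 e≈0 = unit-nonzero x (trans x≈ (trans (*-congʳ e≈0) (zeroˡ _)))
    ê = unit-of e≉0
  prime-root′ {zero} p-prime = contradiction ≡.refl (ℕ.≢-nonZero⁻¹ 0 {{prime⇒nonZero p-prime}})

module EssentialExtension (em : ∀ {e} → ExcludedMiddle e)
  (K : CommutativeRing c ℓ) (K-field : IsField K) (U : AbelianGroup u ℓu)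
  (ι : AbelianGroup.Carrier (units K) → AbelianGroup.Carrier U) (ι-mono : IsMonomorphism (units K) U ι)
  (essential : IsEssential (units K) U ι) where

  open FourthRoots K K-field U ι ι-mono using (scalars; ι-↑; ι-∙-closed; fourth-root; prime-root; prime-root′)
  open ScalarFacts K K-field
  private
    module K where
      open CommutativeRing K public
      open IntegerSolver K public
      open Subrings K public using (_^ʳ_)
    module Kˣ = AbelianGroup (units K)
    module KP = Powers (units K)
    module ι = GroupMorphisms.IsGroupMonomorphism ι-mono
  open AbelianGroup U
  open Powers U
  open Algebra.Properties.CommutativeSemigroup commutativeSemigroup using (interchange)
  open Algebra.Properties.Group group using (∙-cancelˡ)

  scalars-isSubgroup : IsSubgroup U scalars
  scalars-isSubgroup = record
    { resp = λ { p (x , q) → x , trans (sym p) q }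
    ; ε-closed = Kˣ.ε , sym ι.ε-homo
    ; ∙-closed = λ { (x , p) (y , q) → x Kˣ.∙ y , trans (∙-cong p q) (sym (ι.∙-homo x y)) }
    ; ⁻¹-closed = λ { (x , p) → x Kˣ.⁻¹ , trans (⁻¹-cong p) (sym (ι.⁻¹-homo x)) }
    }

  cyclic : Carrier → Pred Carrier _
  cyclic x y = Lift u (∃[ i ] ∃[ j ] y ∙ x ↑ i ≈ x ↑ j)

  cyclic-isSubgroup : ∀ x → IsSubgroup U (cyclic x)
  cyclic-isSubgroup x = record
    { resp = λ { p (lift (i , j , q)) → lift (i , j , trans (∙-congʳ (sym p)) q) }
    ; ε-closed = lift (0 , 0 , identityˡ _)
    ; ∙-closed = λ { (lift (i , j , p)) (lift (k , l , q)) → lift (i ℕ.+ k , j ℕ.+ l ,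
        trans (∙-congˡ (↑-+ x i k)) (trans (interchange _ _ _ _) (trans (∙-cong p q) (sym (↑-+ x j l))))) }
    ; ⁻¹-closed = λ { {y} (lift (i , j , p)) → lift (j , i , trans (∙-congˡ (sym p)) (trans (sym (assoc _ _ _))
        (trans (∙-congʳ (inverseˡ y)) (identityˡ _)))) }
    }

  x∈cyclic : ∀ x → x ∈ cyclic x
  x∈cyclic x = lift (0 , 1 , trans (identityʳ x) (sym (↑-1 x)))

  cyclic-trivial : ∀ x → (∀ n → x ↑ n ∈ scalars → x ↑ n ≈ ε) → x ∈ scalars
  cyclic-trivial x trivial = IsSubgroup.resp scalars-isSubgroup
    (sym (essential (cyclic x) (cyclic-isSubgroup x) (λ y → λ { (lift (i , j , p) , y∈) → go i j p y∈ }) x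
      (x∈cyclic x)))
    (IsSubgroup.ε-closed scalars-isSubgroup)
    where
    go : ∀ i j {y} → y ∙ x ↑ i ≈ x ↑ j → y ∈ scalars → y ≈ ε
    go i j {y} p y∈ with ℕ.≤-total i j
    ... | inj₁ i≤j = trans y≈ (trivial (j ℕ.∸ i) (IsSubgroup.resp scalars-isSubgroup y≈ y∈))
      where
      y≈ : y ≈ x ↑ (j ℕ.∸ i)
      y≈ = ∙-cancelˡ (x ↑ i) y _
        (trans (comm _ _) (trans p (trans (reflexive (≡.cong (x ↑_) (≡.sym (ℕ.m+[n∸m]≡n i≤j)))) (↑-+ x i (j ℕ.∸ i)))))
    ... | inj₂ j≤i = trans (sym (identityʳ y))
      (trans (∙-congˡ (sym (trivial (i ℕ.∸ j) (resp′ y⁻¹ (IsSubgroup.⁻¹-closed scalars-isSubgroup y∈))))) inv)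
      where
      resp′ = IsSubgroup.resp scalars-isSubgroup
      inv : y ∙ x ↑ (i ℕ.∸ j) ≈ ε
      inv = ∙-cancelˡ (x ↑ j) _ _ (trans (trans (sym (assoc _ _ _)) (trans (∙-congʳ (comm _ _)) (trans (assoc _ _ _)
        (trans (∙-congˡ (trans (sym (↑-+ x j (i ℕ.∸ j))) (reflexive (≡.cong (x ↑_) (ℕ.m+[n∸m]≡n j≤i))))) p))))
          (sym (identityʳ _)))
      y⁻¹ : y ⁻¹ ≈ x ↑ (i ℕ.∸ j)
      y⁻¹ = ∙-cancelˡ y _ _ (trans (inverseʳ y) (sym inv))

  torsion : ∀ x → ∃[ n ] (0 ℕ.< n × x ↑ n ∈ scalars)
  torsion x with em {P = ∃[ n ] (0 ℕ.< n × x ↑ n ∈ scalars)}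
  ... | yes p = p
  ... | no none = 1 , ℕ.z<s , IsSubgroup.resp scalars-isSubgroup (sym (↑-1 x))
    (cyclic-trivial x λ { zero _ → refl ; (suc n) x^n∈ → contradiction (suc n , ℕ.z<s , x^n∈) none })

  prime-torsion : ∀ {p} → Prime p → ∀ {x} → x ↑ p ≈ ε → x ∈ scalars
  prime-torsion {p} p-prime {x} x^p≈ε with em {P = x ∈ scalars}
  ... | yes x∈ = x∈
  ... | no x∉ = cyclic-trivial x λ n x^n∈ → trivial n x^n∈ (em {P = p ∣ n})
    where
    trivial : ∀ n → x ↑ n ∈ scalars → Dec (p ∣ n) → x ↑ n ≈ ε
    trivial n x^n∈ (yes (divides k ≡.refl)) = trans (↑-* x k p) (trans (↑-cong k x^p≈ε) (ε↑ k))
    trivial n x^n∈ (no p∤n) = contradiction (coprime-powers scalars-isSubgroup (prime-coprime p-prime p∤n)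
      (IsSubgroup.resp scalars-isSubgroup (sym x^p≈ε) (IsSubgroup.ε-closed scalars-isSubgroup)) x^n∈) x∉

  NewOrder4 : Set _
  NewOrder4 = ∃[ x ] (HasOrder U x 4 × ¬ (x ∈ scalars))

  i-scalar : ¬ NewOrder4 → ¬ (2# K.≈ K.0#) → ∀ {y} → y ↑ 2 ≈ ι -1-unit → y ∈ scalars
  i-scalar no-new 2≉0 {y} y² = decidable-stable em λ y∉ → no-new (new y∉)
    where
    ι-1≉ε : ¬ (ι -1-unit ≈ ε)
    ι-1≉ε p = 2≉0 (K.trans (K.+-congʳ (K.sym (ι.injective (trans p (sym ι.ε-homo))))) (K.-‿inverseˡ K.1#))
    -1² : K.- K.1# K.* (K.- K.1# K.* K.1#) K.≈ K.1#
    -1² = K.solve 0 ((K.:- K.:1) K.:* ((K.:- K.:1) K.:* K.:1) K.:= K.:1) K.refl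
    y⁴ : y ↑ 4 ≈ ε
    y⁴ = trans (↑-* y 2 2) (trans (↑-cong 2 y²) (trans (sym (ι-↑ -1-unit 2))
      (trans (ι.⟦⟧-cong { -1-unit KP.↑ 2} {Kˣ.ε} -1²) ι.ε-homo)))
    backwards : ∀ m → 4 ∣ m → y ↑ m ≈ ε
    backwards m (divides k ≡.refl) = trans (↑-* y k 4) (trans (↑-cong k y⁴) (ε↑ k))
    square : y ≈ ε → ι -1-unit ≈ ε
    square p = trans (sym y²) (trans (↑-cong 2 p) (ε↑ 2))
    remainder : ∀ r → r ℕ.< 4 → y ↑ r ≈ ε → r ≡ 0
    remainder 0 _ _ = ≡.refl
    remainder 1 _ p = contradiction (square (trans (sym (↑-1 y)) p)) ι-1≉ε
    remainder 2 _ p = contradiction (trans (sym y²) p) ι-1≉ε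
    remainder 3 _ p = contradiction (square (trans (sym (identityʳ y)) (trans (∙-congˡ (sym p)) y⁴))) ι-1≉ε
    remainder (suc (suc (suc (suc _)))) (ℕ.s≤s (ℕ.s≤s (ℕ.s≤s (ℕ.s≤s ()))))
    forwards : ∀ m → y ↑ m ≈ ε → 4 ∣ m
    forwards m p = divides (m / 4) (≡.trans (m≡m%n+[m/n]*n m 4) (≡.cong (ℕ._+ (m / 4) ℕ.* 4)
      (remainder (m % 4) (m%n<n m 4)
        (trans (sym (trans (∙-congˡ (backwards _ (divides (m / 4) ≡.refl))) (identityʳ _)))
        (trans (sym (↑-+ y (m % 4) _)) (trans (reflexive (≡.cong (y ↑_) (≡.sym (m≡m%n+[m/n]*n m 4)))) p))))))
    new : y ∉ scalars → NewOrder4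
    new y∉ = y , (λ m → mk⇔ (forwards m) (backwards m)) , y∉

  fourth-root′ : (NewOrder4 → ¬ (∃[ x ] ∃[ a ] (proj₁ a K.≈ -4# K × x ↑ 4 ≈ ι a))) →
    ∀ {y x e} → y ↑ 4 ≈ ι x → proj₁ x K.≈ -4# K K.* e K.^ʳ 4 → y ∈ scalars
  fourth-root′ exceptional {y} {x} {e} y⁴ x≈ = fourth-root {y} {x} {e} y⁴ x≈ (prime-root {2} (prime-torsion prime[2]))
    (λ 2≉0 -4∈U⁴ → i-scalar (λ new → exceptional new -4∈U⁴) 2≉0)

lookupIndex : ∀ {A : Set a} {P : Pred A r} {xs} → All P xs → ∀ i → P (lookup xs i)
lookupIndex (x ∷ xs) zero = x
lookupIndex (x ∷ xs) (suc i) = lookupIndex xs i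

private
  variable
    A B : Set a

module ListSum (R : CommutativeRing c ℓ) where
  open CommutativeRing R hiding (zero)
  open Algebra.Properties.Semiring.Sum semiring

  ∑ᴸ : (A → Carrier) → List A → Carrier
  ∑ᴸ f xs = sum (λ i → f (lookup xs i))

  ∑ᴸ-++ : ∀ (f : A → Carrier) xs ys → ∑ᴸ f (xs ++ ys) ≈ ∑ᴸ f xs + ∑ᴸ f ys
  ∑ᴸ-++ f [] ys = sym (+-identityˡ _)
  ∑ᴸ-++ f (x ∷ xs) ys = trans (+-congˡ (∑ᴸ-++ f xs ys)) (sym (+-assoc _ _ _))

  ∑ᴸ-map : ∀ (f : B → Carrier) (g : A → B) xs → ∑ᴸ f (map g xs) ≈ ∑ᴸ (f ∘ g) xs
  ∑ᴸ-map f g [] = refl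
  ∑ᴸ-map f g (x ∷ xs) = +-congˡ (∑ᴸ-map f g xs)

  ∑ᴸ-concat : ∀ (f : A → Carrier) n (g : Fin n → List A) → ∑ᴸ f (concat (tabulate g)) ≈ sum (λ i → ∑ᴸ f (g i))
  ∑ᴸ-concat f zero g = refl
  ∑ᴸ-concat f (suc n) g = trans (∑ᴸ-++ f (g zero) _) (+-congˡ (∑ᴸ-concat f n (g ∘ suc)))

  ∑ᴸ-cong : ∀ {f g : A → Carrier} {P : Pred A r} {xs} → All P xs → (∀ {x} → x ∈ P → f x ≈ g x) → ∑ᴸ f xs ≈ ∑ᴸ g xs
  ∑ᴸ-cong [] p = refl
  ∑ᴸ-cong (x ∷ xs) p = +-cong (p x) (∑ᴸ-cong xs p)

module Towers (em : ∀ {e} → ExcludedMiddle e)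
  {K : CommutativeRing c ℓ} {U : AbelianGroup u ℓu} {ι : AbelianGroup.Carrier (units K) → AbelianGroup.Carrier U}
  {R : CommutativeRing r ℓr}
  (K-field : IsField K) (ι-mono : IsMonomorphism (units K) U ι) (G : Graded K U ι R)
  {R′ : CommutativeRing r′ ℓr′} (G′ : Graded K (units R) (Trace.scalarUnit em K-field ι-mono G) R′)
  {φ : CommutativeRing.Carrier R′ → CommutativeRing.Carrier R} (φ-hom : IsRingHom R′ R φ)
  (φ-s : ∀ k → CommutativeRing._≈_ R (φ (Graded.s G′ k)) (Graded.s G k))
  (φ-h : ∀ w → CommutativeRing._≈_ R (φ (Graded.h G′ w)) (proj₁ w))
  (essential : IsEssential (units K) U ι)
  (exceptional : EssentialExtension.NewOrder4 em K K-field U ι ι-mono essential →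
    ¬ (∃[ x ] ∃[ a ] (CommutativeRing._≈_ K (proj₁ a) (-4# K) × AbelianGroup._≈_ U (_^_ U x 4) (ι a))))
  (char : ∀ {p} → Prime p → CommutativeRing._≈_ K (_^_ (CommutativeRing.+-abelianGroup K) (CommutativeRing.1# K) p)
    (CommutativeRing.0# K) →
    ∀ {x} → _^_ U x p ∈ Image (units K) U ι → x ∈ Image (units K) U ι)
  where

  open GradedProperties em K-field ι-mono G
  open CyclicExtension em K-field ι-mono G using (Supp-scalars; HasInverses-⇔; scalars-inverses; prime-step)
  open EssentialExtension em K K-field U ι ι-mono essential using (torsion; prime-torsion; i-scalar; fourth-root′)
  open Trace em K-field ι-mono G
  open CommutativeRing R hiding (zero)
  open IntegerSolver R
  open Algebra.Properties.Semiring.Sum semiring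
  open Subrings R
  open UnitPowers R
  open Powers (units R)
  open Relation.Binary.Reasoning.Setoid setoid
  private
    module Rˣ = AbelianGroup (units R)
    module LR = ListSum R
    module LK = ListSum K
    module ΣK = Algebra.Properties.Semiring.Sum K.semiring
    module G′ = GradedProperties em K-field scalarUnit-mono G′
    module S = IsExtension scalars-isExtension
    module FU = FourthRoots K K-field U ι ι-mono
    module FR = FourthRoots K K-field (units R) scalarUnit scalarUnit-mono

  Scalars-isSubgroup : IsSubgroup (units R) Scalars
  Scalars-isSubgroup = G′.IsExtension.isSubgroup G′.scalars-isExtension

  record Tower (V : Pred U.Carrier f) : Set (c ⊔ ℓ ⊔ u ⊔ ℓu ⊔ r ⊔ ℓr ⊔ f) where
    field
      isExtension : IsExtension V
      inverses : HasInverses (Supp V)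
      basis : List U.Carrier
      members : All (_∈ V) basis
      expand : ∀ {x} → x ∈ Supp V → x ≈ LR.∑ᴸ (λ b → s (coeff b x) * h b) basis
      size≉0 : ¬ (LK.∑ᴸ (λ _ → K.1#) basis K.≈ K.0#)

    hasBasis : HasBasis V (length basis) (lookup basis)
    hasBasis = record { member = lookupIndex members ; expand = expand ; size≉0 = size≉0 }

    open IsExtension isExtension public

  hUnit : U.Carrier → Rˣ.Carrier
  hUnit v = h v , h (v U.⁻¹) , h-inverse v

  hUnit-↑ : ∀ v n → hUnit (v U.↑ n) Rˣ.≈ hUnit v ↑ n
  hUnit-↑ v n = trans (h-↑ v n) (reflexive (≡.sym (proj₁-↑ (hUnit v) n)))

  hUnit-ι : ∀ x → hUnit (ι x) Rˣ.≈ scalarUnit x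
  hUnit-ι = h-ι

  Homogeneous : Pred U.Carrier f → Pred Rˣ.Carrier _
  Homogeneous V z = ∃[ v ] (v ∈ V × z Rˣ.≈ hUnit v)

  homogeneous-isSubgroup : ∀ {V : Pred U.Carrier f} → IsSubgroup U V → IsSubgroup (units R) (Homogeneous V)
  homogeneous-isSubgroup V-sub = record
    { resp = λ { p (v , v∈ , q) → v , v∈ , trans (sym p) q }
    ; ε-closed = U.ε , ε-closed , sym h-ε
    ; ∙-closed = λ { (v , v∈ , p) (w , w∈ , q) → v U.∙ w , ∙-closed v∈ w∈ , trans (*-cong p q) (sym (h-∙ v w)) }
    ; ⁻¹-closed = λ { {z} (v , v∈ , p) → v U.⁻¹ , ⁻¹-closed v∈ , Rˣ.⁻¹-cong {z} {hUnit v} p }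
    }
    where open IsSubgroup V-sub

  Scalars⊆Homogeneous : ∀ {V : Pred U.Carrier f} → IsExtension V → Scalars ⊆ Homogeneous V
  Scalars⊆Homogeneous V-ext (x , p) = ι x , IsExtension.contains V-ext x , trans p (sym (hUnit-ι x))

  homogeneous-scalar : ∀ {v} → v ∈ scalars → hUnit v ∈ Scalars
  homogeneous-scalar (x , p) = x , trans (h-cong p) (h-ι x)

  scalar-homogeneous : ∀ {v x} → hUnit v Rˣ.≈ scalarUnit x → v U.≈ ι x
  scalar-homogeneous {v} {x} p = h-injective (trans p (sym (h-ι x)))

  hUnit-torsion : ∀ v → ∃[ n ] (0 ℕ.< n × hUnit v ↑ n ∈ Scalars)
  hUnit-torsion v = let n , 0<n , x , p = torsion v in
    n , 0<n , x , trans (sym (hUnit-↑ v n)) (trans (h-cong p) (h-ι x))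

  -- The nonzero coefficients of z are the traces of the units h v⁻¹ * z.
  module _ {V : Pred U.Carrier f} (T : Tower V) where
    private module T = Tower T

    homogeneous-or-zero : ∀ z → proj₁ z ∈ Supp V → ∀ {M} → 0 ℕ.< M → z ↑ M ∈ Scalars →
      ∀ {v} → v ∈ V → RootsAreScalar (hUnit (v U.⁻¹) Rˣ.∙ z) → z ∈ Homogeneous V ⊎ coeff v (proj₁ z) K.≈ K.0#
    homogeneous-or-zero z z∈ {M} 0<M z^M∈ {v} v∈V roots =
      conclude (scalar-or-trace-zero G′ φ-hom φ-s φ-h T.isExtension T.inverses T.hasBasis w
        (Supp-* T.isExtension (Supp-h T.isExtension (T.⁻¹-closed v∈V)) z∈) 0<nM w^nM∈ roots)
      where
      open IsSubgroup Scalars-isSubgroup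
      open PrimePowers (units R) Scalars-isSubgroup
      w = hUnit (v U.⁻¹) Rˣ.∙ z
      n = proj₁ (hUnit-torsion (v U.⁻¹))
      0<nM : 0 ℕ.< n ℕ.* M
      0<nM = ℕ.>-nonZero⁻¹ (n ℕ.* M) {{ℕ.m*n≢0 n M {{ℕ.>-nonZero
        (proj₁ (proj₂ (hUnit-torsion (v U.⁻¹))))}} {{ℕ.>-nonZero 0<M}}}}
      w^nM∈ : w ↑ (n ℕ.* M) ∈ Scalars
      w^nM∈ = resp {hUnit (v U.⁻¹) ↑ (n ℕ.* M) Rˣ.∙ z ↑ (n ℕ.* M)} {w ↑ (n ℕ.* M)}
        (sym (↑-∙ (hUnit (v U.⁻¹)) z (n ℕ.* M)))
        (∙-closed {hUnit (v U.⁻¹) ↑ (n ℕ.* M)} {z ↑ (n ℕ.* M)} (power-closed {hUnit (v U.⁻¹)} {n} M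
          (proj₂ (proj₂ (hUnit-torsion (v U.⁻¹)))))
          (power-closed′ {z} {M} n z^M∈))
      conclude : w ∈ Scalars ⊎ coeff U.ε (proj₁ w) K.≈ K.0# → z ∈ Homogeneous V ⊎ coeff v (proj₁ z) K.≈ K.0#
      conclude (inj₁ scalar) = inj₁ (∙-cancelˡ-closed (homogeneous-isSubgroup T.isSubgroup) {hUnit (v U.⁻¹)} {z}
        (v U.⁻¹ , T.⁻¹-closed v∈V , refl) (Scalars⊆Homogeneous T.isExtension {w} scalar))
      conclude (inj₂ vanishes) = inj₂ (K.trans (K.sym (coeff-shift (v U.⁻¹) v (proj₁ z)))
        (K.trans (coeff-cong (U.inverseˡ v) refl) vanishes))

    homogeneous-unit : ∀ z → proj₁ z ∈ Supp V → ∀ {M} → 0 ℕ.< M → z ↑ M ∈ Scalars →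
      (z ∉ Homogeneous V → ∀ v → v ∈ V → RootsAreScalar (hUnit v Rˣ.∙ z)) → z ∈ Homogeneous V
    homogeneous-unit z z∈ {M} 0<M z^M∈ roots with em {P = z ∈ Homogeneous V}
    ... | yes hom = hom
    ... | no ¬hom = contradiction (coeff-zero⇒zero zeros) z≉0
      where
      z≉0 : ¬ (proj₁ z ≈ 0#)
      z≉0 z≈0 = 1≉0 (trans (sym (proj₂ (proj₂ z))) (trans (*-congʳ z≈0) (zeroˡ _)))
      zeros : ∀ v → coeff v (proj₁ z) K.≈ K.0#
      zeros v = cases em
        where
        in-V : z ∈ Homogeneous V ⊎ coeff v (proj₁ z) K.≈ K.0# → coeff v (proj₁ z) K.≈ K.0#
        in-V (inj₁ hom) = contradiction hom ¬hom
        in-V (inj₂ vanishes) = vanishes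
        cases : Dec (v ∈ V) → coeff v (proj₁ z) K.≈ K.0#
        cases (no v∉V) = coeff-off T.isExtension z∈ v∉V
        cases (yes v∈V) = in-V (homogeneous-or-zero z z∈ {M} 0<M z^M∈ v∈V (roots ¬hom (v U.⁻¹) (T.⁻¹-closed v∈V)))

    module _ {p : ℕ} {x : U.Carrier} (p-prime : Prime p) (x∉V : x ∉ V) (x^p∈V : x U.↑ p ∈ V)
      (z : Rˣ.Carrier) (z^p : z ↑ p Rˣ.≈ hUnit x ↑ p) (¬hom : z ∉ Homogeneous V) where
      private
        H = homogeneous-isSubgroup T.isSubgroup

        multiple : ∀ {j} → p ∣ j → z ↑ j Rˣ.≈ hUnit x ↑ j
        multiple (divides k ≡.refl) = Rˣ.trans {z ↑ (k ℕ.* p)} {(z ↑ p) ↑ k} {hUnit x ↑ (k ℕ.* p)} (↑-* z k p)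
          (Rˣ.trans {(z ↑ p) ↑ k} {(hUnit x ↑ p) ↑ k} {hUnit x ↑ (k ℕ.* p)} (↑-cong k {z ↑ p} {hUnit x ↑ p} z^p)
            (sym (↑-* (hUnit x) k p)))

      root-scalar : ∀ n {a} → (∀ {y} → y U.↑ n U.≈ ι a → y ∈ scalars) → ∀ {v} → v ∈ V → ∀ j →
        ((hUnit v Rˣ.∙ z) ↑ j) ↑ n Rˣ.≈ scalarUnit a → (hUnit v Rˣ.∙ z) ↑ j ∈ Scalars
      root-scalar n {a} reduce {v} v∈V j y^n with p ∣? j ℕ.* n
      ... | no p∤jn = contradiction (coprime-powers H (prime-coprime p-prime p∤jn)
              (x U.↑ p , x^p∈V , trans z^p (sym (hUnit-↑ x p)))
              (∙-cancelˡ-closed H {hUnit v ↑ (j ℕ.* n)} {z ↑ (j ℕ.* n)} (v U.↑ (j ℕ.* n) , U.↑-closed T.isSubgroup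
                (j ℕ.* n) v∈V , sym (hUnit-↑ v (j ℕ.* n)))
                (ι a , T.contains a , trans (sym (↑-∙ (hUnit v) z (j ℕ.* n))) (trans (↑-*′ (hUnit v Rˣ.∙ z) j n)
                  (trans y^n (sym (h-ι a))))))) ¬hom
      ... | yes p∣jn = finish (p ∣? j)
        where
        v′ = v U.↑ j U.∙ x U.↑ j
        v′^n : v′ U.↑ n U.≈ ι a
        v′^n = scalar-homogeneous (begin
          h (v′ U.↑ n)                                          ≈⟨ hUnit-↑ v′ n ⟩
          proj₁ (hUnit v′ ↑ n)                                  ≈⟨ ↑-cong n {hUnit v′} {(hUnit v Rˣ.∙ hUnit x) ↑ j}
            (trans (h-∙ _ _) (trans (*-cong (hUnit-↑ v j) (hUnit-↑ x j)) (sym (↑-∙ (hUnit v) (hUnit x) j)))) ⟩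
          proj₁ (((hUnit v Rˣ.∙ hUnit x) ↑ j) ↑ n)              ≈⟨ ↑-*′ (hUnit v Rˣ.∙ hUnit x) j n ⟨
          proj₁ ((hUnit v Rˣ.∙ hUnit x) ↑ (j ℕ.* n))            ≈⟨ ↑-∙ (hUnit v) (hUnit x) (j ℕ.* n) ⟩
          proj₁ (hUnit v ↑ (j ℕ.* n)) * proj₁ (hUnit x ↑ (j ℕ.* n)) ≈⟨ *-congˡ (multiple p∣jn) ⟨
          proj₁ (hUnit v ↑ (j ℕ.* n)) * proj₁ (z ↑ (j ℕ.* n))   ≈⟨ ↑-∙ (hUnit v) z (j ℕ.* n) ⟨
          proj₁ ((hUnit v Rˣ.∙ z) ↑ (j ℕ.* n))                  ≈⟨ ↑-*′ (hUnit v Rˣ.∙ z) j n ⟩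
          proj₁ (((hUnit v Rˣ.∙ z) ↑ j) ↑ n)                    ≈⟨ y^n ⟩
          s (proj₁ a)                                           ∎)
        v′∈ : v′ ∈ scalars
        v′∈ = reduce v′^n
        finish : Dec (p ∣ j) → (hUnit v Rˣ.∙ z) ↑ j ∈ Scalars
        finish (yes p∣j) = let b , q = homogeneous-scalar v′∈ in b , (begin
          proj₁ ((hUnit v Rˣ.∙ z) ↑ j)                     ≈⟨ ↑-∙ (hUnit v) z j ⟩
          proj₁ (hUnit v ↑ j) * proj₁ (z ↑ j)              ≈⟨ *-cong (sym (hUnit-↑ v j))
            (trans (multiple p∣j) (sym (hUnit-↑ x j))) ⟩
          h (v U.↑ j) * h (x U.↑ j)                        ≈⟨ h-∙ _ _ ⟨
          h v′                                             ≈⟨ q ⟩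
          s (proj₁ b)                                      ∎)
        finish (no p∤j) = contradiction (U.coprime-powers T.isSubgroup (prime-coprime p-prime p∤j) x^p∈V
          (U.∙-cancelˡ-closed T.isSubgroup (U.↑-closed T.isSubgroup j v∈V) (T.resp (U.sym (proj₂ v′∈))
            (T.contains (proj₁ v′∈))))) x∉V

      roots-scalar : ∀ v → v ∈ V → RootsAreScalar (hUnit v Rˣ.∙ z)
      roots-scalar v v∈V j =
        (λ {q} q-prime {a} {e} y^q a≈ → root-scalar q {a} (λ y^n → FU.prime-root′ q-prime
          (prime-torsion q-prime) y^n a≈) v∈V j y^q) ,
        (λ {a} {e} y^4 a≈ → root-scalar 4 {a} (λ y^n → fourth-root′ exceptional y^n a≈) v∈V j y^4)

    not-a-power : ∀ {p x} → Prime p → x ∉ V → x U.↑ p ∈ V → ∀ {z} → z ∈ Supp V → ¬ (z ^ʳ p ≈ h (x U.↑ p))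
    not-a-power {zero} p-prime = contradiction ≡.refl (ℕ.≢-nonZero⁻¹ 0 {{prime⇒nonZero p-prime}})
    not-a-power {p@(suc m)} {x} p-prime x∉V x^p∈V {z} z∈ z^p =
      x∉V (root-in-V (homogeneous-unit ẑ z∈ 0<M ẑ^M∈ (roots-scalar p-prime x∉V x^p∈V ẑ ẑ^p)))
      where
      ẑ : Rˣ.Carrier
      ẑ = z , z ^ʳ m * h ((x U.↑ p) U.⁻¹) , trans (sym (*-assoc _ _ _)) (trans (*-congʳ z^p) (h-inverse _))
      ẑ^p : ẑ ↑ p Rˣ.≈ hUnit x ↑ p
      ẑ^p = trans (reflexive (proj₁-↑ ẑ p)) (trans z^p (hUnit-↑ x p))
      M = proj₁ (hUnit-torsion x) ℕ.* p
      0<M : 0 ℕ.< M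
      0<M = ℕ.>-nonZero⁻¹ M {{ℕ.m*n≢0 _ p {{ℕ.>-nonZero (proj₁ (proj₂ (hUnit-torsion x)))}}}}
      ẑ^M∈ : ẑ ↑ M ∈ Scalars
      ẑ^M∈ = IsSubgroup.resp Scalars-isSubgroup {hUnit x ↑ (n ℕ.* p)} {ẑ ↑ (n ℕ.* p)}
        (trans (↑-* (hUnit x) n p) (trans (↑-cong n {hUnit x ↑ p} {ẑ ↑ p} (sym ẑ^p)) (sym (↑-* ẑ n p))))
        (PrimePowers.power-closed (units R) Scalars-isSubgroup {hUnit x} {n} p (proj₂ (proj₂ (hUnit-torsion x))))
        where n = proj₁ (hUnit-torsion x)
      root-in-V : ẑ ∈ Homogeneous V → x ∈ V
      root-in-V (v , v∈V , z≈hv) = U.∙-cancelʳ-closed T.isSubgroup (T.⁻¹-closed v∈V)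
        (T.resp (U.sym (proj₂ quotient∈)) (T.contains (proj₁ quotient∈)))
        where
        v^p≈x^p : v U.↑ p U.≈ x U.↑ p
        v^p≈x^p = h-injective (trans (h-↑ v p) (trans (^-congˡ p (sym z≈hv)) z^p))
        quotient∈ : x U.∙ v U.⁻¹ ∈ scalars
        quotient∈ = prime-torsion p-prime (U.trans (U.↑-∙ x (v U.⁻¹) p) (U.trans
          (U.∙-cong (U.sym v^p≈x^p) (U.⁻¹-↑ v p)) (U.inverseʳ _)))

    -- p is invertible in K: otherwise U / K^× has no p-torsion, and x would lie in V.
    characteristic-∤ : ∀ {p x} → Prime p → x ∉ V → x U.↑ p ∈ V → ¬ (K.sum {p} (λ _ → K.1#) K.≈ K.0#)
    characteristic-∤ {p} {x} p-prime x∉V x^p∈V p≈0 = let n , 0<n , x^n∈ = torsion x in go n (<-wellFounded n) 0<n x^n∈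
      where
      p·1≈0 = K.trans (K.sym (ΣK.sum-replicate p {K.1#})) p≈0
      go : ∀ n → Acc ℕ._<_ n → 0 ℕ.< n → ¬ (x U.↑ n ∈ scalars)
      go n (acc rec) 0<n x^n∈ with p ∣? n
      ... | no p∤n = x∉V (U.coprime-powers T.isSubgroup (prime-coprime p-prime p∤n) x^p∈V
        (T.resp (U.sym (proj₂ x^n∈)) (T.contains (proj₁ x^n∈))))
      ... | yes (divides zero ≡.refl) = contradiction 0<n λ ()
      ... | yes (divides k@(suc _) ≡.refl) = go k
        (rec (ℕ.m<m*n k p (ℕ.nonTrivial⇒n>1 p {{prime⇒nonTrivial p-prime}}))) ℕ.z<s
        (char p-prime p·1≈0 (S.resp (U.↑-*′ x k p) x^n∈))

    step : ∀ {p x} → Prime p → x ∉ V → x U.↑ p ∈ V → Tower (Adjoin T.isExtension x)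
    step {zero} p-prime = contradiction ≡.refl (ℕ.≢-nonZero⁻¹ 0 {{prime⇒nonZero p-prime}})
    step {p@(suc m)} {x} p-prime x∉V x^p∈V = record
      { isExtension = Adjoin-isExtension T.isExtension {x = x} {m = m} x^p∈V
      ; inverses = prime-step T.isExtension p-prime x∉V x^p∈V T.inverses (not-a-power p-prime x∉V x^p∈V)
      ; basis = concat (tabulate translate)
      ; members = All.concat⁺ (All.tabulate⁺ {n = p} λ j → All.map⁺ (All.map (λ b∈V → member j b∈V) T.members))
      ; expand = expand
      ; size≉0 = size≉0
      }
      where
      translate : Fin p → List U.Carrier
      translate j = map (x U.↑ toℕ j U.∙_) T.basis
      member : ∀ (j : Fin p) {b} → b ∈ V → x U.↑ toℕ j U.∙ b ∈ Adjoin T.isExtension x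
      member j {b} b∈V = toℕ j , b , b∈V , U.comm _ _
      size : LK.∑ᴸ (λ _ → K.1#) (concat (tabulate translate)) K.≈ K.sum {p} (λ _ → K.1#) K.* LK.∑ᴸ
        (λ _ → K.1#) T.basis
      size = K.trans (LK.∑ᴸ-concat (λ _ → K.1#) p translate) (K.trans
        (ΣK.sum-cong-≋ {p} λ j → K.trans (LK.∑ᴸ-map (λ _ → K.1#) (x U.↑ toℕ j U.∙_) T.basis)
          (K.sym (K.*-identityˡ (LK.∑ᴸ (λ _ → K.1#) T.basis))))
        (K.sym (ΣK.*-distribʳ-sum {p} (LK.∑ᴸ (λ _ → K.1#) T.basis) (λ _ → K.1#))))
      size≉0 : ¬ (LK.∑ᴸ (λ _ → K.1#) (concat (tabulate translate)) K.≈ K.0#)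
      size≉0 q = T.size≉0 (let y , p*y≈1 = proj₂ K-field _ (characteristic-∤ p-prime x∉V x^p∈V) in
        K.trans (K.sym (K.*-identityˡ _)) (K.trans (K.*-congʳ (K.trans (K.sym p*y≈1) (K.*-comm _ y)))
          (K.trans (K.*-assoc _ _ _) (K.trans (K.*-congˡ (K.trans (K.sym size) q)) (K.zeroʳ y)))))
      expand : ∀ {y} → y ∈ Supp (Adjoin T.isExtension x) → y ≈ LR.∑ᴸ (λ b → s (coeff b y) * h b)
        (concat (tabulate translate))
      expand {y} y∈ = trans y≈ (sym (trans (LR.∑ᴸ-concat (λ b → s (coeff b y) * h b) p translate)
        (sum-cong-≋ {p} column)))
        where
        q = proj₁ (Adjoin-span T.isExtension {x = x} {m = m} x^p∈V y∈)
        q∈ = proj₁ (proj₂ (Adjoin-span T.isExtension {x = x} {m = m} x^p∈V y∈))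
        y≈ : y ≈ linear q (powers (h x))
        y≈ = proj₂ (proj₂ (Adjoin-span T.isExtension {x = x} {m = m} x^p∈V y∈))
        column : ∀ j → LR.∑ᴸ (λ b → s (coeff b y) * h b) (translate j) ≈ q j * powers (h x) j
        column j = begin
          LR.∑ᴸ (λ b → s (coeff b y) * h b) (translate j)
            ≈⟨ LR.∑ᴸ-map (λ b → s (coeff b y) * h b) (x U.↑ toℕ j U.∙_) T.basis ⟩
          LR.∑ᴸ (λ b → s (coeff (x U.↑ toℕ j U.∙ b) y) * h (x U.↑ toℕ j U.∙ b)) T.basis
            ≈⟨ LR.∑ᴸ-cong {f = λ b → s (coeff (x U.↑ toℕ j U.∙ b) y) * h (x U.↑ toℕ j U.∙ b)}
                 {λ b → s (coeff b (q j)) * h b * powers (h x) j} T.members (λ {b} b∈V → trans (*-cong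
                 (s-cong (K.trans (coeff-cong U.refl y≈) (coeff-linear T.isExtension {x = x} {m = m} x^p∈V
                   (prime-order T.isExtension p-prime x∉V x^p∈V) q q∈ j b∈V)))
                 (trans (h-∙ _ _) (trans (*-congʳ (h-↑ x (toℕ j))) (*-comm _ _)))) (sym (*-assoc _ _ _))) ⟩
          LR.∑ᴸ (λ b → s (coeff b (q j)) * h b * powers (h x) j) T.basis
            ≈⟨ *-distribʳ-sum {length T.basis} (powers (h x) j) (λ i → s (coeff (lookup T.basis i) (q j)) * h
              (lookup T.basis i)) ⟨
          LR.∑ᴸ (λ b → s (coeff b (q j)) * h b) T.basis * powers (h x) j
            ≈⟨ *-congʳ (T.expand (q∈ j)) ⟨
          q j * powers (h x) j ∎

  Tower-level : Level
  Tower-level = c ⊔ ℓ ⊔ u ⊔ ℓu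

  -- K^× itself, at the universe level of its extensions.
  base : Pred U.Carrier Tower-level
  base = Adjoin scalars-isExtension U.ε

  base-tower : Tower base
  base-tower = record
    { isExtension = Adjoin-isExtension scalars-isExtension {x = U.ε} {m = 0} ε^1∈
    ; inverses = HasInverses-⇔ (V⊆Adjoin scalars-isExtension U.ε) base⊆scalars scalars-inverses
    ; basis = U.ε ∷ []
    ; members = V⊆Adjoin scalars-isExtension U.ε S.ε-closed ∷ []
    ; expand = λ {x} x∈ → let k , x≈k = Supp-scalars (Supp-mono base⊆scalars x∈) in
        trans x≈k (trans (s-cong (K.sym (K.trans (coeff-cong U.refl x≈k) (coeff-ε-s k))))
          (sym (trans (+-identityʳ _) (trans (*-congˡ h-ε) (*-identityʳ _)))))
    ; size≉0 = λ p → proj₁ K-field (K.trans (K.sym (K.+-identityʳ _)) p)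
    }
    where
    ε^1∈ : U.ε U.↑ 1 ∈ scalars
    ε^1∈ = S.resp (U.sym (U.↑-1 U.ε)) S.ε-closed
    base⊆scalars : base ⊆ scalars
    base⊆scalars (j , v , v∈ , p) = S.resp (U.sym (U.trans p (U.trans (U.∙-congˡ (U.ε↑ j)) (U.identityʳ v)))) v∈

  extend : ∀ {V : Pred U.Carrier Tower-level} → Tower V → ∀ x → ∃[ W ] (Tower {f = Tower-level} W × V ⊆ W × x ∈ W)
  extend {V} T x = let n , 0<n , x^n∈ = torsion x in
    go n (<-wellFounded n) T 0<n (Tower.resp T (U.sym (proj₂ x^n∈)) (Tower.contains T (proj₁ x^n∈)))
    where
    go : ∀ n → Acc ℕ._<_ n → ∀ {V : Pred U.Carrier Tower-level} → Tower V → 0 ℕ.< n → x U.↑ n ∈ V →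
      ∃[ W ] (Tower {f = Tower-level} W × V ⊆ W × x ∈ W)
    go (suc zero) _ {V} T _ x^1∈ = V , T , (λ v∈ → v∈) , Tower.resp T (U.↑-1 x) x^1∈
    go n@(suc (suc _)) (acc rec) {V} T _ x^n∈ = reduce (prime-divisor {n} (ℕ.s<s ℕ.z<s))
      where
      reduce : ∃[ p ] (Prime p × p ∣ n) → ∃[ W ] (Tower {f = Tower-level} W × V ⊆ W × x ∈ W)
      reduce (p , p-prime , divides (suc k-1) n≡kp) = cases (em {P = x U.↑ k ∈ V})
        where
        k = suc k-1
        k<n : k ℕ.< n
        k<n = ≡.subst (k ℕ.<_) (≡.sym n≡kp) (ℕ.m<m*n k p (ℕ.nonTrivial⇒n>1 p {{prime⇒nonTrivial p-prime}}))
        cases : Dec (x U.↑ k ∈ V) → ∃[ W ] (Tower {f = Tower-level} W × V ⊆ W × x ∈ W)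
        cases (yes x^k∈) = go k (rec k<n) T ℕ.z<s x^k∈
        cases (no x^k∉) =
          let W , TW , V′⊆W , x∈W = go k (rec k<n) (step T {p} {x U.↑ k} p-prime x^k∉
                (Tower.resp T (U.trans (U.reflexive (≡.cong (x U.↑_) n≡kp)) (U.↑-*′ x k p)) x^n∈)) ℕ.z<s
                  (x∈Adjoin (Tower.isExtension T) (x U.↑ k))
          in W , TW , (λ v∈ → V′⊆W (V⊆Adjoin (Tower.isExtension T) (x U.↑ k) v∈)) , x∈W

  containing : ∀ x → ∃[ V ] (Tower {f = Tower-level} V × x ∈ Supp V)
  containing x = let ts , x≈ = spans x
                     V , T , x∈ = go ts
                 in V , T , Supp-resp (Tower.isExtension T) (sym x≈) x∈
    where
    go : ∀ ts → ∃[ V ] (Tower {f = Tower-level} V × eval ts ∈ Supp V)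
    go [] = base , base-tower , none refl
    go ((k , v) ∷ ts) =
      let V , T , e∈ = go ts
          W , TW , V⊆W , v∈W = extend T v
      in W , TW , term k v∈W (Supp-mono V⊆W e∈) refl

  algebra-field : IsField R
  algebra-field = 1≉0 , λ x x≉0 →
    let V , T , x∈ = containing x
        y , _ , xy≈1 = Tower.inverses T x∈ x≉0
    in y , xy≈1

  module TorsionUnits {p : ℕ} (p-prime : Prime p) (p-group : ∀ v → ∃[ k ] v U.↑ (p ℕ.^ k) ∈ scalars) where
    private
      module SP = PrimePowers (units R) Scalars-isSubgroup
      module SS = IsSubgroup Scalars-isSubgroup

    PTorsion : Pred Rˣ.Carrier _
    PTorsion z = ∃[ k ] z ↑ (p ℕ.^ k) ∈ Scalars

    PTorsion-hUnit : ∀ v → PTorsion (hUnit v)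
    PTorsion-hUnit v = let k , a , q = p-group v in k , a , trans (sym (hUnit-↑ v (p ℕ.^ k))) (trans (h-cong q) (h-ι a))

    PTorsion-raise : ∀ {z} j → (t : PTorsion z) → z ↑ (p ℕ.^ (j ℕ.+ proj₁ t)) ∈ Scalars
    PTorsion-raise {z} j (k , z^) = SS.resp {z ↑ (p ℕ.^ j ℕ.* p ℕ.^ k)} {z ↑ (p ℕ.^ (j ℕ.+ k))}
      (reflexive (≡.cong (λ n → proj₁ (z ↑ n)) (≡.sym (ℕ.^-distribˡ-+-* p j k)))) (SP.power-closed′ {z} {p ℕ.^ k}
        (p ℕ.^ j) z^)

    PTorsion-∙ : ∀ {y z} → PTorsion y → PTorsion z → PTorsion (y Rˣ.∙ z)
    PTorsion-∙ {y} {z} y-torsion@(k , _) z-torsion@(l , _) = k ℕ.+ l ,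
      SS.resp {y ↑ n Rˣ.∙ z ↑ n} {(y Rˣ.∙ z) ↑ n} (sym (↑-∙ y z n)) (SS.∙-closed {y ↑ n} {z ↑ n}
        (≡.subst (λ m → y ↑ (p ℕ.^ m) ∈ Scalars) (ℕ.+-comm l k) (PTorsion-raise {y} l y-torsion))
          (PTorsion-raise {z} k z-torsion))
      where n = p ℕ.^ (k ℕ.+ l)

    PTorsion-~ : ∀ {z y v} → z Rˣ.≈ scalarUnit y Rˣ.∙ hUnit v → ∃[ k ] z ↑ (p ℕ.^ suc k) ∈ Scalars
    PTorsion-~ {z} {y} {v} z≈ = k , SS.resp {w ↑ (p ℕ.^ suc k)} {z ↑ (p ℕ.^ suc k)}
      (↑-cong (p ℕ.^ suc k) {w} {z} (sym z≈)) (PTorsion-raise {w} 1 w-torsion)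
      where
      w = scalarUnit y Rˣ.∙ hUnit v
      w-torsion : PTorsion w
      w-torsion = PTorsion-∙ {scalarUnit y} {hUnit v} (0 , y , *-identityʳ _) (PTorsion-hUnit v)
      k = proj₁ w-torsion

    PTorsion-↑ : ∀ {z} j → PTorsion z → PTorsion (z ↑ j)
    PTorsion-↑ {z} j (k , z^) = k , SS.resp {z ↑ (p ℕ.^ k ℕ.* j)} {(z ↑ j) ↑ (p ℕ.^ k)} (↑-* z (p ℕ.^ k) j)
      (SP.power-closed {z} {p ℕ.^ k} j z^)

    PTorsion-coprime : ∀ {n} → p ∤ n → ∀ {y x} → PTorsion y → y ↑ n Rˣ.≈ scalarUnit x → y ∈ Scalars
    PTorsion-coprime {n} p∤n {y} {x} (k , y^) y^n = SP.prime-power-coprime p-prime p∤n k {y} y^ (x , y^n)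

    0<p^ : ∀ k → 0 ℕ.< p ℕ.^ k
    0<p^ k = ℕ.m^n>0 p {{prime⇒nonZero p-prime}} k

    p-torsion-homogeneous :
      (∀ {y} → PTorsion y → ∀ {x e} → y ↑ p Rˣ.≈ scalarUnit x → proj₁ x K.≈ e K.^ʳ p → y ∈ Scalars) →
      (∀ {y} → PTorsion y → ∀ {x e} → y ↑ 4 Rˣ.≈ scalarUnit x → proj₁ x K.≈ -4# K K.* e K.^ʳ 4 → y ∈ Scalars) →
      ∀ {z} → PTorsion z → ∃[ v ] z Rˣ.≈ hUnit v
    p-torsion-homogeneous root-p root-4 {z} z-torsion@(k , z^) =
      let V , T , z∈ = containing (proj₁ z)
          v , _ , z≈ = homogeneous-unit T z z∈ {p ℕ.^ k} (0<p^ k) z^ λ _ v _ j →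
            let y-torsion = PTorsion-↑ {hUnit v Rˣ.∙ z} j (PTorsion-∙ {hUnit v} {z} (PTorsion-hUnit v) z-torsion) in
            roots j v y-torsion , (λ {x} {e} → root-4 {(hUnit v Rˣ.∙ z) ↑ j} y-torsion {x} {e})
      in v , z≈
      where
      roots : ∀ j v → let y = (hUnit v Rˣ.∙ z) ↑ j in PTorsion y →
        ∀ {q} → Prime q → ∀ {x e} → y ↑ q Rˣ.≈ scalarUnit x → proj₁ x K.≈ e K.^ʳ q → y ∈ Scalars
      roots j v y-torsion {q} q-prime {x} {e} y^q x≈ with p ℕ.≟ q
      ... | yes ≡.refl = root-p {(hUnit v Rˣ.∙ z) ↑ j} y-torsion {x} {e} y^q x≈
      ... | no p≢q = PTorsion-coprime (prime∤prime p-prime q-prime p≢q) {(hUnit v Rˣ.∙ z) ↑ j} {x} y-torsion y^q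

    module Odd (3≤p : 3 ℕ.≤ p) where

      unity-root-scalar : ∀ {ζ} → ζ ↑ p Rˣ.≈ Rˣ.ε → ζ ∈ Scalars
      unity-root-scalar {ζ} ζ^p = decidable-stable em λ ζ∉ →
        ζ∉ (isScalar⇒image ζ (let V , T , ζ∈ = containing (proj₁ ζ) in scalar ζ∉ T ζ∈))
        where
        ζ-multiple : ∀ {j} → p ∣ j → ζ ↑ j Rˣ.≈ Rˣ.ε
        ζ-multiple (divides k ≡.refl) = trans (↑-* ζ k p) (trans (↑-cong k {ζ ↑ p} {Rˣ.ε} ζ^p) (ε↑ k))
        ζ-torsion : PTorsion ζ
        ζ-torsion = 1 , AbelianGroup.ε (units K) , trans
          (ζ-multiple (divides 1 (≡.trans (ℕ.^-identityʳ p) (≡.sym (ℕ.*-identityˡ p))))) (sym s-1)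
        homogeneous⇒scalar : ∀ {V : Pred U.Carrier Tower-level} → ζ ∈ Homogeneous V → ζ ∈ Scalars
        homogeneous⇒scalar (v , _ , ζ≈) = SS.resp {hUnit v} {ζ} (sym ζ≈) (homogeneous-scalar (prime-torsion p-prime
          (h-injective (trans (hUnit-↑ v p) (trans (↑-cong p {hUnit v} {ζ} (sym ζ≈)) (trans ζ^p (sym h-ε)))))))
        roots : ∀ {v} → v ∉ scalars → RootsAreScalar (hUnit v Rˣ.∙ ζ)
        roots {v} v∉ j = root , λ {x} y^4 _ → PTorsion-coprime (odd-prime∤4 p-prime 3≤p) {y} {x} y-torsion y^4
          where
          y = (hUnit v Rˣ.∙ ζ) ↑ j
          y-torsion : PTorsion y
          y-torsion = PTorsion-↑ {hUnit v Rˣ.∙ ζ} j (PTorsion-∙ {hUnit v} {ζ} (PTorsion-hUnit v) ζ-torsion)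
          y≈ : y Rˣ.≈ hUnit (v U.↑ j) Rˣ.∙ ζ ↑ j
          y≈ = trans (↑-∙ (hUnit v) ζ j) (*-congʳ (sym (hUnit-↑ v j)))
          p-case : ∀ {x e} → y ↑ p Rˣ.≈ scalarUnit x → proj₁ x K.≈ e K.^ʳ p → y ∈ Scalars
          p-case {x} {e} y^p x≈ = finish (p ∣? j)
            where
            v^j∈ : v U.↑ j ∈ scalars
            v^j∈ = FU.prime-root′ p-prime (prime-torsion p-prime) (scalar-homogeneous {(v U.↑ j) U.↑ p} {x} (begin
              h ((v U.↑ j) U.↑ p)                                         ≈⟨ hUnit-↑ (v U.↑ j) p ⟩
              proj₁ (hUnit (v U.↑ j) ↑ p)                                 ≈⟨ *-identityʳ _ ⟨
              proj₁ (hUnit (v U.↑ j) ↑ p) * 1#                            ≈⟨ *-congˡ (trans (sym (↑-*′ ζ j p))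
                (ζ-multiple (divides j ≡.refl))) ⟨
              proj₁ (hUnit (v U.↑ j) ↑ p) * proj₁ ((ζ ↑ j) ↑ p)           ≈⟨ ↑-∙ (hUnit (v U.↑ j)) (ζ ↑ j) p ⟨
              proj₁ ((hUnit (v U.↑ j) Rˣ.∙ ζ ↑ j) ↑ p)                    ≈⟨ ↑-cong p {y} {hUnit
                (v U.↑ j) Rˣ.∙ ζ ↑ j} y≈ ⟨
              proj₁ (y ↑ p)                                               ≈⟨ y^p ⟩
              s (proj₁ x)                                                 ∎)) x≈
            finish : Dec (p ∣ j) → y ∈ Scalars
            finish (yes p∣j) = SS.resp {hUnit (v U.↑ j)} {y}
              (sym (trans y≈ (trans (*-congˡ (ζ-multiple p∣j)) (*-identityʳ _))))
              (homogeneous-scalar v^j∈)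
            finish (no p∤j) = contradiction (PrimePowers.prime-power-coprime U S.isSubgroup p-prime p∤j
              (proj₁ (p-group v)) (proj₂ (p-group v)) v^j∈) v∉
          root : ∀ {q} → Prime q → ∀ {x e} → y ↑ q Rˣ.≈ scalarUnit x → proj₁ x K.≈ e K.^ʳ q → y ∈ Scalars
          root {q} q-prime {x} {e} y^q x≈ with p ℕ.≟ q
          ... | yes ≡.refl = p-case {x} {e} y^q x≈
          ... | no p≢q = PTorsion-coprime (prime∤prime p-prime q-prime p≢q) {y} {x} y-torsion y^q
        scalar : ζ ∉ Scalars → ∀ {V : Pred U.Carrier Tower-level} → Tower V → proj₁ ζ ∈ Supp V → IsScalar (proj₁ ζ)
        scalar ζ∉ {V} T ζ∈ = let k , eq = sum-scalar (Tower.basis T) (Tower.members T) in k , trans (Tower.expand T ζ∈) eq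
          where
          module T = Tower T
          term-scalar : ∀ b → b ∈ V → IsScalar (s (coeff b (proj₁ ζ)) * h b)
          term-scalar b b∈V = cases em
            where
            nonscalar : ζ ∈ Homogeneous V ⊎ coeff b (proj₁ ζ) K.≈ K.0# → IsScalar (s (coeff b (proj₁ ζ)) * h b)
            nonscalar (inj₁ hom) = contradiction (homogeneous⇒scalar hom) ζ∉
            nonscalar (inj₂ vanishes) = K.0# , trans (*-congʳ (trans (s-cong vanishes) s-0))
              (trans (zeroˡ _) (sym s-0))
            cases : Dec (b ∈ scalars) → IsScalar (s (coeff b (proj₁ ζ)) * h b)
            cases (yes (a , b≈)) = coeff b (proj₁ ζ) K.* proj₁ a , trans (*-congˡ (trans (h-cong b≈) (h-ι a)))
              (sym (s-* _ (proj₁ a)))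
            cases (no b∉) = nonscalar (homogeneous-or-zero T ζ ζ∈ {p ℕ.^ 1} (0<p^ 1) (proj₂ ζ-torsion) b∈V
              (roots λ b⁻¹∈ → b∉ (S.resp (U.⁻¹-involutive b) (S.⁻¹-closed b⁻¹∈))))
          sum-scalar : ∀ bs → All (_∈ V) bs → IsScalar (LR.∑ᴸ (λ b → s (coeff b (proj₁ ζ)) * h b) bs)
          sum-scalar [] [] = K.0# , sym s-0
          sum-scalar (b ∷ bs) (b∈ ∷ bs∈) = let k , p = term-scalar b b∈ ; l , q = sum-scalar bs bs∈ in
            k K.+ l , trans (+-cong p q) (sym (s-+ k l))

      odd-torsion : ∀ {z} → PTorsion z → ∃[ v ] z Rˣ.≈ hUnit v
      odd-torsion = p-torsion-homogeneous
        (λ {y} _ {x} {e} y^p x≈ → FR.prime-root′ p-prime (λ {ζ} → unity-root-scalar {ζ}) {y} {x} {e} y^p x≈)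
        (λ {y} y-torsion {x} y^4 _ → PTorsion-coprime (odd-prime∤4 p-prime 3≤p) {y} {x} y-torsion y^4)

  module Even (2-group : ∀ v → ∃[ k ] v U.↑ (2 ℕ.^ k) ∈ scalars)
    (no-new : ¬ (EssentialExtension.NewOrder4 em K K-field U ι ι-mono essential)) where
    open TorsionUnits prime[2] 2-group
    open ScalarFacts K K-field using (2#; -1-unit; unit-of)
    private
      module SS = IsSubgroup Scalars-isSubgroup
      module FK = FourthRoots K K-field (units K) id (id-isMonomorphism (units K))

    square-one-scalar : ∀ {y} → y ↑ 2 Rˣ.≈ Rˣ.ε → y ∈ Scalars
    square-one-scalar {y} y²≈1 = isScalar⇒image y (cases em)
      where
      y₀ = proj₁ y
      product≈0 : (y₀ - 1#) * (y₀ + 1#) ≈ 0#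
      product≈0 = trans (solve 1 (λ y → (y :- :1) :* (y :+ :1) := y :* (y :* :1) :- :1) refl y₀)
        (trans (+-congʳ y²≈1) (-‿inverseʳ 1#))
      cases : Dec (y₀ - 1# ≈ 0#) → IsScalar y₀
      cases (yes y-1≈0) = K.1# , trans (solve 1 (λ y → y := (y :- :1) :+ :1) refl y₀)
        (trans (+-congʳ y-1≈0) (trans (+-identityˡ 1#) (sym s-1)))
      cases (no y-1≉0) = let t , eq = proj₂ algebra-field _ y-1≉0 in K.- K.1# ,
        trans (solve 3 (λ y t u → y := (:1 :- u) :* (y :+ :1) :+ t :* ((y :- :1) :* (y :+ :1)) :+
          (u :- (y :- :1) :* t) :* (y :+ :1) :- :1) refl y₀ t 1#)
          (trans (+-cong (+-cong (+-cong (trans (*-congʳ (-‿inverseʳ 1#)) (zeroˡ _)) (trans (*-congˡ product≈0)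
            (zeroʳ t)))
            (trans (*-congʳ (trans (+-congˡ (-‿cong eq)) (-‿inverseʳ 1#))) (zeroˡ _))) refl)
            (trans (solve 0 (:0 :+ :0 :+ :0 :- :1 := :- :1) refl) (sym (trans (s-‿- K.1#) (-‿cong s-1)))))

    2-root : ∀ {y x e} → y ↑ 2 Rˣ.≈ scalarUnit x → proj₁ x K.≈ e K.^ʳ 2 → y ∈ Scalars
    2-root {y} {x} {e} = FR.prime-root′ prime[2] (λ {ζ} → square-one-scalar {ζ}) {y} {x} {e}

    2-root-unit : ∀ {y} x → y ↑ 2 Rˣ.≈ scalarUnit x ↑ 2 → y ∈ Scalars
    2-root-unit {y} = FR.prime-root {2} (λ {ζ} → square-one-scalar {ζ}) {y}

    i-unit-scalar : ¬ (2# K.≈ K.0#) → ∀ {i} → i ↑ 2 Rˣ.≈ scalarUnit -1-unit → i ∈ Scalars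
    i-unit-scalar 2≉0 {i} i² = let V , T , i∈ = containing (proj₁ i)
                                   v , _ , i≈ = homogeneous-unit T i i∈ {2} ℕ.z<s (-1-unit , i²) λ _ v _ → roots v
                               in SS.resp {hUnit v} {i} (sym i≈) (homogeneous-scalar (i-scalar no-new 2≉0
                                    (scalar-homogeneous {v U.↑ 2} { -1-unit}
                                      (trans (hUnit-↑ v 2) (trans (↑-cong 2 {hUnit v} {i} (sym i≈)) i²)))))
      where
      i⁴ : i ↑ 4 Rˣ.≈ Rˣ.ε
      i⁴ = trans (↑-* i 2 2) (trans (↑-cong 2 {i ↑ 2} {scalarUnit -1-unit} i²)
        (trans (*-cong (trans (s-‿- K.1#) (-‿cong s-1)) (*-congʳ (trans (s-‿- K.1#) (-‿cong s-1))))
          (solve 0 ((:- :1) :* ((:- :1) :* :1) := :1) refl)))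
      roots : ∀ v → RootsAreScalar (hUnit v Rˣ.∙ i)
      roots v j = root , λ {x} {e} → fourth {x} {e}
        where
        y = (hUnit v Rˣ.∙ i) ↑ j
        y-torsion : PTorsion y
        y-torsion = PTorsion-↑ {hUnit v Rˣ.∙ i} j (PTorsion-∙ {hUnit v} {i} (PTorsion-hUnit v) (1 , -1-unit , i²))
        y≈ : y Rˣ.≈ hUnit (v U.↑ j) Rˣ.∙ i ↑ j
        y≈ = trans (↑-∙ (hUnit v) i j) (*-congʳ (sym (hUnit-↑ v j)))
        root : ∀ {q} → Prime q → ∀ {x e} → y ↑ q Rˣ.≈ scalarUnit x → proj₁ x K.≈ e K.^ʳ q → y ∈ Scalars
        root {q} q-prime {x} {e} y^q x≈ with 2 ℕ.≟ q
        ... | yes ≡.refl = 2-root {y} {x} {e} y^q x≈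
        ... | no 2≢q = PTorsion-coprime (prime∤prime prime[2] q-prime 2≢q) {y} {x} y-torsion y^q
        fourth : ∀ {x e} → y ↑ 4 Rˣ.≈ scalarUnit x → proj₁ x K.≈ -4# K K.* e K.^ʳ 4 → y ∈ Scalars
        fourth {x} {e} y⁴ x≈ = SS.resp {hUnit (v U.↑ j) Rˣ.∙ i ↑ j} {y} (sym y≈)
          (SS.∙-closed {hUnit (v U.↑ j)} {i ↑ j} (homogeneous-scalar v^j∈) (↑-closed Scalars-isSubgroup {i} j i∈))
          where
          v^j⁴ : (v U.↑ j) U.↑ 4 U.≈ ι x
          v^j⁴ = scalar-homogeneous {(v U.↑ j) U.↑ 4} {x} (begin
            h ((v U.↑ j) U.↑ 4)                                    ≈⟨ hUnit-↑ (v U.↑ j) 4 ⟩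
            proj₁ (hUnit (v U.↑ j) ↑ 4)                            ≈⟨ *-identityʳ _ ⟨
            proj₁ (hUnit (v U.↑ j) ↑ 4) * 1#                       ≈⟨ *-congˡ (trans (sym (↑-*′ i j 4))
              (trans (↑-* i j 4) (trans (↑-cong j {i ↑ 4} {Rˣ.ε} i⁴) (ε↑ j)))) ⟨
            proj₁ (hUnit (v U.↑ j) ↑ 4) * proj₁ ((i ↑ j) ↑ 4)      ≈⟨ ↑-∙ (hUnit (v U.↑ j)) (i ↑ j) 4 ⟨
            proj₁ ((hUnit (v U.↑ j) Rˣ.∙ i ↑ j) ↑ 4)               ≈⟨ ↑-cong 4 {y} {hUnit (v U.↑ j) Rˣ.∙ i ↑ j} y≈ ⟨
            proj₁ (y ↑ 4)                                          ≈⟨ y⁴ ⟩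
            s (proj₁ x)                                            ∎)
          v^j∈ : v U.↑ j ∈ scalars
          v^j∈ = fourth-root′ exceptional v^j⁴ x≈
          b = proj₁ v^j∈
          b⁴ : AbelianGroup._≈_ (units K) (Powers._↑_ (units K) b 4) x
          b⁴ = ι.injective (U.trans (FU.ι-↑ b 4) (U.trans (U.↑-cong 4 (U.sym (proj₂ v^j∈))) v^j⁴))
          i₀ : AbelianGroup.Carrier (units K)
          i₀ = FK.i {y = b} {x = x} {e = e} b⁴ x≈
          i∈ : i ∈ Scalars
          i∈ = 2-root-unit {i} i₀ (trans i² (trans (s-cong (K.sym (FK.i² {y = b} {x = x} {e = e} b⁴ x≈)))
            (FR.ι-↑ i₀ 2)))

    even-torsion : ∀ {z} → PTorsion z → ∃[ v ] z Rˣ.≈ hUnit v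
    even-torsion = p-torsion-homogeneous
      (λ {y} _ {x} {e} y² x≈ → 2-root {y} {x} {e} y² x≈)
      (λ {y} _ {x} {e} y⁴ x≈ → FR.fourth-root {y} {x} {e} y⁴ x≈ (λ {y} → 2-root-unit {y})
        (λ 2≉0 _ {i} → i-unit-scalar 2≉0 {i}))

module Coefficients (em : ∀ {e} → ExcludedMiddle e) (K : CommutativeRing c ℓ) (U : AbelianGroup u ℓu)
  (ι : AbelianGroup.Carrier (units K) → AbelianGroup.Carrier U) (ι-mono : IsMonomorphism (units K) U ι) where

  open UniversalAlgebra K U ι
  private
    module K where
      open CommutativeRing K public
      open IntegerSolver K public
    module U = AbelianGroup U
    module A = CommutativeRing algebra
    module Kˣ = AbelianGroup (units K)
    module ι = GroupMorphisms.IsGroupMonomorphism ι-mono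
    open Algebra.Properties.Group U.group using (∙-cancelʳ)

  Multiple : U.Carrier → U.Carrier → Set _
  Multiple v w = ∃[ a ] w U.≈ ι a U.∙ v

  ratio : ∀ {v w} → Dec (Multiple v w) → K.Carrier
  ratio (yes (a , _)) = proj₁ a
  ratio (no _) = K.0#

  weight : U.Carrier → U.Carrier → K.Carrier
  weight v w = ratio (em {P = Multiple v w})

  weight-unique : ∀ {v w} a → w U.≈ ι a U.∙ v → weight v w K.≈ proj₁ a
  weight-unique {v} {w} a p = go em
    where
    go : (d : Dec (Multiple v w)) → ratio d K.≈ proj₁ a
    go (yes (b , q)) = ι.injective (∙-cancelʳ v _ _ (U.trans (U.sym q) p))
    go (no ¬m) = contradiction (a , p) ¬m

  weight-zero : ∀ {v w} → ¬ Multiple v w → weight v w K.≈ K.0#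
  weight-zero {v} {w} ¬m = go em
    where
    go : (d : Dec (Multiple v w)) → ratio d K.≈ K.0#
    go (yes m) = contradiction m ¬m
    go (no _) = K.refl

  weight-∙ : ∀ {v w v′ w′} a → v U.≈ v′ → w U.≈ ι a U.∙ w′ → weight v w K.≈ proj₁ a K.* weight v′ w′
  weight-∙ {v} {w} {v′} {w′} a p q = go em
    where
    go : Dec (Multiple v′ w′) → weight v w K.≈ proj₁ a K.* weight v′ w′
    go (yes (b , s)) = K.trans (weight-unique (a Kˣ.∙ b)
      (U.trans q (U.trans (U.∙-congˡ (U.trans s (U.∙-congˡ (U.sym p))))
      (U.trans (U.sym (U.assoc _ _ _)) (U.∙-congʳ (U.sym (ι.∙-homo a b))))))) (K.*-congˡ (K.sym (weight-unique b s)))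
    go (no ¬m) = K.trans (weight-zero λ { (b , s) → ¬m (a Kˣ.⁻¹ Kˣ.∙ b , U.trans (U.sym (cancel w′))
      (U.trans (U.∙-congˡ (U.trans (U.sym q) (U.trans s (U.∙-congˡ p))))
      (U.trans (U.sym (U.assoc _ _ _)) (U.∙-congʳ (U.sym (ι.∙-homo (a Kˣ.⁻¹) b)))))) })
        (K.sym (K.trans (K.*-congˡ (weight-zero ¬m)) (K.zeroʳ _)))
      where
      cancel : ∀ t → ι (a Kˣ.⁻¹) U.∙ (ι a U.∙ t) U.≈ t
      cancel t = U.trans (U.sym (U.assoc _ _ _)) (U.trans (U.∙-congʳ (U.trans (U.sym (ι.∙-homo (a Kˣ.⁻¹) a))
        (U.trans (ι.⟦⟧-cong (Kˣ.inverseˡ a)) ι.ε-homo))) (U.identityˡ t))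

  weight-cong : ∀ {v w v′ w′} → v U.≈ v′ → w U.≈ w′ → weight v w K.≈ weight v′ w′
  weight-cong p q = K.trans (weight-∙ Kˣ.ε p (U.trans q (U.sym (U.trans (U.∙-congʳ ι.ε-homo) (U.identityˡ _)))))
    (K.*-identityˡ _)

  coefficient : U.Carrier → Sum → K.Carrier
  coefficient v [] = K.0#
  coefficient v ((k , w) ∷ xs) = k K.* weight v w K.+ coefficient v xs

  coefficient-index : ∀ {v w} → v U.≈ w → ∀ xs → coefficient v xs K.≈ coefficient w xs
  coefficient-index p [] = K.refl
  coefficient-index p (x ∷ xs) = K.+-cong (K.*-congˡ (weight-cong p U.refl)) (coefficient-index p xs)

  coefficient-cong : ∀ v {xs ys} → xs ≋ ys → coefficient v xs K.≈ coefficient v ys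
  coefficient-cong v refl = K.refl
  coefficient-cong v (sym p) = K.sym (coefficient-cong v p)
  coefficient-cong v (trans p q) = K.trans (coefficient-cong v p) (coefficient-cong v q)
  coefficient-cong v (prep k≈l v≈w p) = K.+-cong (K.*-cong k≈l (weight-cong U.refl v≈w)) (coefficient-cong v p)
  coefficient-cong v (swap (k , w) (l , t) {xs}) =
    K.solve 3 (λ x y z → x K.:+ (y K.:+ z) K.:= y K.:+ (x K.:+ z)) K.refl (k K.* weight v w) (l K.* weight v t)
      (coefficient v xs)
  coefficient-cong v (drop w) = K.trans (K.+-congʳ (K.zeroˡ _)) (K.+-identityˡ _)
  coefficient-cong v (merge k l w {xs}) =
    K.solve 4 (λ k l w z → k K.:* w K.:+ (l K.:* w K.:+ z) K.:= (k K.:+ l) K.:* w K.:+ z) K.refl k l (weight v w)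
      (coefficient v xs)
  coefficient-cong v (balance k a w) = K.+-congʳ (K.trans (K.*-assoc k (proj₁ a) _)
    (K.*-congˡ (K.sym (weight-∙ a U.refl U.refl))))

  coefficient-++ : ∀ v xs ys → coefficient v (xs ++ ys) K.≈ coefficient v xs K.+ coefficient v ys
  coefficient-++ v [] ys = K.sym (K.+-identityˡ _)
  coefficient-++ v (x ∷ xs) ys = K.trans (K.+-congˡ (coefficient-++ v xs ys)) (K.sym (K.+-assoc _ _ _))

  coefficient-· : ∀ v k xs → coefficient v ((k , U.ε) · xs) K.≈ k K.* coefficient v xs
  coefficient-· v k [] = K.sym (K.zeroʳ k)
  coefficient-· v k ((l , w) ∷ xs) = K.trans (K.+-cong (K.trans (K.*-congˡ (weight-cong U.refl (U.identityˡ w)))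
    (K.*-assoc k l _)) (coefficient-· v k xs))
    (K.sym (K.distribˡ k _ _))

  graded : Graded K U ι algebra
  graded = record
    { s = λ k → (k , U.ε) ∷ []
    ; s-cong = λ p → prep p U.refl refl
    ; s-+ = λ k l → sym (merge k l U.ε)
    ; s-* = λ k l → prep K.refl (U.sym (U.identityˡ U.ε)) refl
    ; s-1 = refl
    ; h = λ v → (K.1# , v) ∷ []
    ; h-cong = λ p → prep K.refl p refl
    ; h-∙ = λ v w → prep (K.sym (K.*-identityˡ K.1#)) U.refl refl
    ; h-ε = refl
    ; h-ι = λ a → trans (prep K.refl (U.sym (U.identityʳ (ι a))) refl)
        (trans (sym (balance K.1# a U.ε)) (prep (K.*-identityˡ _) U.refl refl))
    ; coeff = coefficient
    ; coeff-cong = λ {v} {w} {x} {y} p q → K.trans (coefficient-index p x) (coefficient-cong w q)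
    ; coeff-+ = coefficient-++
    ; coeff-* = λ v k x → K.trans (coefficient-++ v ((k , U.ε) · x) []) (K.trans (K.+-identityʳ _)
      (coefficient-· v k x))
    ; coeff-same = λ v → K.trans (K.+-identityʳ _) (K.trans (K.*-identityˡ _)
        (weight-unique Kˣ.ε (U.sym (U.trans (U.∙-congʳ ι.ε-homo) (U.identityˡ v)))))
    ; coeff-other = λ ¬m → K.trans (K.+-identityʳ _) (K.trans (K.*-identityˡ _) (weight-zero ¬m))
    ; spans = λ x → x , spanned x
    }
    where
    spanned : ∀ x → x ≋ Data.List.Base.foldr (λ (k , v) y → ((k , U.ε) ∷ []) ⊛ ((K.1# , v) ∷ []) ++ y) [] x
    spanned [] = refl
    spanned ((k , v) ∷ x) = prep (K.sym (K.*-identityʳ k)) (U.sym (U.identityˡ v)) (spanned x)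

module Evaluation (em : ∀ {e} → ExcludedMiddle e)
  {K : CommutativeRing c ℓ} {U : AbelianGroup u ℓu} {ι : AbelianGroup.Carrier (units K) → AbelianGroup.Carrier U}
  {R : CommutativeRing r ℓr}
  (K-field : IsField K) (ι-mono : IsMonomorphism (units K) U ι) (G : Graded K U ι R) where

  open Trace em K-field ι-mono G using (scalarUnit)
  open Graded G using (s; s-cong; s-+; s-*; s-1)
  open GradedProperties em K-field ι-mono G using (s-0)
  open CommutativeRing R hiding (zero)
  open IntegerSolver R
  private
    module K = CommutativeRing K
    module Rˣ = AbelianGroup (units R)
    module A = UniversalAlgebra K (units R) scalarUnit

  φ : A.Sum → Carrier
  φ [] = 0#
  φ ((k , w) ∷ xs) = s k * proj₁ w + φ xs

  φ-≋ : ∀ {xs ys} → xs A.≋ ys → φ xs ≈ φ ys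
  φ-≋ A.refl = refl
  φ-≋ (A.sym p) = sym (φ-≋ p)
  φ-≋ (A.trans p q) = trans (φ-≋ p) (φ-≋ q)
  φ-≋ (A.prep k≈l v≈w p) = +-cong (*-cong (s-cong k≈l) v≈w) (φ-≋ p)
  φ-≋ (A.swap (k , v) (l , w) {xs}) = solve 3 (λ x y z → x :+ (y :+ z) := y :+ (x :+ z)) refl (s k * proj₁ v)
    (s l * proj₁ w) (φ xs)
  φ-≋ (A.drop v) = trans (+-congʳ (trans (*-congʳ s-0) (zeroˡ _))) (+-identityˡ _)
  φ-≋ (A.merge k l v {xs}) = trans (solve 4 (λ k l w z → k :* w :+ (l :* w :+ z) := (k :+ l) :* w :+ z) refl (s k)
    (s l) (proj₁ v) (φ xs))
    (+-congʳ (*-congʳ (sym (s-+ k l))))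
  φ-≋ (A.balance k a v) = +-congʳ (trans (*-congʳ (s-* k (proj₁ a))) (*-assoc _ _ _))

  φ-++ : ∀ xs ys → φ (xs ++ ys) ≈ φ xs + φ ys
  φ-++ [] ys = sym (+-identityˡ _)
  φ-++ (x ∷ xs) ys = trans (+-congˡ (φ-++ xs ys)) (sym (+-assoc _ _ _))

  φ-· : ∀ k v ys → φ ((k , v) A.· ys) ≈ s k * proj₁ v * φ ys
  φ-· k v [] = sym (zeroʳ _)
  φ-· k v ((l , w) ∷ ys) = trans (+-cong (*-congʳ (s-* k l)) (φ-· k v ys))
    (solve 5 (λ k l v w y → k :* l :* (v :* w) :+ k :* v :* y := k :* v :* (l :* w :+ y)) refl (s k) (s l) (proj₁ v)
      (proj₁ w) (φ ys))

  φ-⊛ : ∀ xs ys → φ (xs A.⊛ ys) ≈ φ xs * φ ys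
  φ-⊛ [] ys = sym (zeroˡ _)
  φ-⊛ ((k , v) ∷ xs) ys = trans (φ-++ ((k , v) A.· ys) (xs A.⊛ ys)) (trans (+-cong (φ-· k v ys) (φ-⊛ xs ys))
    (sym (distribʳ _ _ _)))

  φ-isRingHom : IsRingHom A.algebra R φ
  φ-isRingHom = record
    { φ-cong = φ-≋ ; φ-+ = φ-++ ; φ-* = φ-⊛ ; φ-1 = trans (+-identityʳ _) (trans (*-identityʳ _) s-1) }

  φ-scalar : ∀ k → φ ((k , Rˣ.ε) ∷ []) ≈ s k
  φ-scalar k = trans (+-identityʳ _) (*-identityʳ _)

  φ-unit : ∀ w → φ ((K.1# , w) ∷ []) ≈ proj₁ w
  φ-unit w = trans (+-identityʳ _) (trans (*-congʳ s-1) (*-identityˡ _))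

module FieldConsequences (em : ∀ {e} → ExcludedMiddle e)
  {K : CommutativeRing c ℓ} {U : AbelianGroup u ℓu} {ι : AbelianGroup.Carrier (units K) → AbelianGroup.Carrier U}
  {R : CommutativeRing r ℓr}
  (K-field : IsField K) (ι-mono : IsMonomorphism (units K) U ι) (G : Graded K U ι R) (R-field : IsField R) where

  open GradedProperties em K-field ι-mono G
  open CommutativeRing R hiding (zero)
  open IntegerSolver R
  open Algebra.Properties.Group +-group using (x∙y⁻¹≈ε⇒x≈y)
  private
    module Kˣ = AbelianGroup (units K)
    module KI = IntegerSolver K

  kernel-trivial : ∀ {R′ : CommutativeRing r′ ℓr′} {φ : Carrier → CommutativeRing.Carrier R′} → IsRingHom R R′ φ →
    ¬ (CommutativeRing._≈_ R′ (CommutativeRing.1# R′) (CommutativeRing.0# R′)) →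
    ∀ x → CommutativeRing._≈_ R′ (φ (h x)) (CommutativeRing.1# R′) → x U.≈ U.ε
  kernel-trivial {R′ = R′} {φ} φ-hom 1≉0′ x φx≈1 = h-injective
    (trans (x∙y⁻¹≈ε⇒x≈y (h x) 1# (decidable-stable em nonunit)) (sym h-ε))
    where
    open IsRingHom φ-hom
    module R′ = CommutativeRing R′
    φd≈0 : φ (h x - 1#) R′.≈ R′.0#
    φd≈0 = R′.trans (φ-+ (h x) (- 1#)) (R′.trans (R′.+-cong φx≈1 (R′.trans (φ-‿- 1#) (R′.-‿cong φ-1)))
      (R′.-‿inverseʳ R′.1#))
    nonunit : ¬ ¬ (h x - 1# ≈ 0#)
    nonunit d≉0 = let y , dy≈1 = proj₂ R-field (h x - 1#) d≉0 in
      1≉0′ (R′.trans (R′.sym φ-1) (R′.trans (φ-cong (sym dy≈1)) (R′.trans (φ-* (h x - 1#) y)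
        (R′.trans (R′.*-congʳ φd≈0) (R′.zeroˡ (φ y))))))

  domain : ∀ x y → x * y ≈ 0# → x ≈ 0# ⊎ y ≈ 0#
  domain x y xy≈0 = cases em
    where
    cases : Dec (x ≈ 0#) → x ≈ 0# ⊎ y ≈ 0#
    cases (yes p) = inj₁ p
    cases (no x≉0) = let t , xt≈1 = proj₂ R-field x x≉0 in
      inj₂ (trans (sym (*-identityˡ y)) (trans (*-congʳ (trans (sym xt≈1) (*-comm x t)))
        (trans (*-assoc t x y) (trans (*-congˡ xy≈0) (zeroʳ t)))))

  -- Y⁴ + 4 = ((Y + 1)² + 1)((Y - 1)² + 1), so a fourth root of -4 has the form ±1 ± i, which is not homogeneous.
  module _ (i : U.Carrier) (i-order : HasOrder U i 4) (i∉ : ¬ (i ∈ Image (units K) U ι)) where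

    I = h i

    I²≈-1 : I * I + 1# ≈ 0#
    I²≈-1 = cases (domain (I * I - 1#) (I * I + 1#) (trans
      (solve 1 (λ i → (i :* i :- :1) :* (i :* i :+ :1) := i :* (i :* (i :* (i :* :1))) :- :1) refl I)
      (trans (+-congʳ (trans (sym (h-↑ i 4))
        (trans (h-cong (Equivalence.from (i-order 4) (divides 1 ≡.refl))) h-ε))) (-‿inverseʳ 1#))))
      where
      cases : I * I - 1# ≈ 0# ⊎ I * I + 1# ≈ 0# → I * I + 1# ≈ 0#
      cases (inj₂ p) = p
      cases (inj₁ p) = contradiction (∣⇒≤ (Equivalence.to (i-order 2) (h-injective {i U.↑ 2} {U.ε} (trans (h-↑ i 2)
        (trans (*-congˡ (*-identityʳ I)) (trans (x∙y⁻¹≈ε⇒x≈y (I * I) 1# p) (sym h-ε))))))) λ { (ℕ.s≤s (ℕ.s≤s ())) }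

    not-homogeneous : ∀ y α β → ¬ (α K.≈ K.0#) → ¬ (β K.≈ K.0#) → ¬ (h y ≈ s α + s β * I)
    not-homogeneous y α β α≉0 β≉0 p = cases em
      where
      at-1 : coeff U.ε (h y) K.≈ α
      at-1 = K.trans (coeff-cong U.refl p) (K.trans (coeff-+ U.ε (s α) (s β * I))
        (K.trans (K.+-cong (coeff-ε-s α) (K.trans (coeff-* U.ε β I)
        (K.trans (K.*-congˡ (coeff-other λ { (a , q) → i∉ (a , U.trans q (U.identityʳ _)) })) (K.zeroʳ β))))
          (K.+-identityʳ α)))
      at-i : coeff i (h y) K.≈ β
      at-i = K.trans (coeff-cong U.refl p) (K.trans (coeff-+ i (s α) (s β * I)) (K.trans (K.+-cong
        (K.trans (coeff-cong U.refl (trans (sym (*-identityʳ (s α))) (*-congˡ (sym h-ε))))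
          (K.trans (coeff-* i α (h U.ε)) (K.trans (K.*-congˡ (coeff-other {i} {U.ε} λ { (a , q) →
          i∉ (a Kˣ.⁻¹ , U.trans (inverse-of a q) (U.sym (ι.⁻¹-homo a))) })) (K.zeroʳ α))))
        (K.trans (coeff-* i β I) (K.trans (K.*-congˡ (coeff-same i)) (K.*-identityʳ β)))) (K.+-identityˡ β)))
        where
        inverse-of : ∀ a → U.ε U.≈ ι a U.∙ i → i U.≈ ι a U.⁻¹
        inverse-of a q = U.trans (U.sym (U.trans (U.sym (U.assoc _ _ _)) (U.trans (U.∙-congʳ (U.inverseˡ (ι a)))
          (U.identityˡ i))))
          (U.trans (U.∙-congˡ (U.sym q)) (U.identityʳ _))
      cases : ¬ Dec (∃[ a ] y U.≈ ι a U.∙ U.ε)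
      cases (no y≁1) = α≉0 (K.trans (K.sym at-1) (coeff-other y≁1))
      cases (yes (a , y≈a)) = β≉0 (K.trans (K.sym at-i) (coeff-other λ { (b , y≈bi) → i∉ (b Kˣ.⁻¹ Kˣ.∙ a ,
        U.trans (U.sym (U.trans (U.sym (U.assoc _ _ _))
          (U.trans (U.∙-congʳ (U.trans (U.∙-congʳ (ι.⁻¹-homo b)) (U.inverseˡ (ι b)))) (U.identityˡ i))))
          (U.trans (U.∙-congˡ (U.trans (U.sym y≈bi) (U.trans y≈a (U.identityʳ _))))
            (U.sym (ι.∙-homo (b Kˣ.⁻¹) a)))) }))

    -1≉0 : ¬ (K.- K.1# K.≈ K.0#)
    -1≉0 p = proj₁ K-field (K.trans (KI.solve 1 (λ x → x KI.:= KI.:- (KI.:- x)) K.refl K.1#)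
      (K.trans (K.-‿cong p) (KI.solve 0 (KI.:- KI.:0 KI.:= KI.:0) K.refl)))

    no-fourth-root : ∀ y a → proj₁ a K.≈ -4# K → ¬ (y U.↑ 4 U.≈ ι a)
    no-fourth-root y a a≈-4 y⁴ = outer (domain (quadratic 1#) (quadratic (- 1#)) product≈0)
      where
      Y = h y
      s-1′ : s (K.- K.1#) ≈ - 1#
      s-1′ = trans (s-‿- K.1#) (-‿cong s-1)
      quadratic : Carrier → Carrier
      quadratic e = (Y + e - I) * (Y + e + I)
      Y⁴ : Y * (Y * (Y * (Y * 1#))) ≈ - (1# + 1# + 1# + 1#)
      Y⁴ = trans (sym (h-↑ y 4)) (trans (h-cong y⁴) (trans (h-ι a)
        (trans (s-cong a≈-4) (trans (s-‿- _)
          (-‿cong (trans (s-+ _ _)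
            (+-cong (trans (s-+ _ _) (+-cong (trans (s-+ _ _) (+-cong s-1 s-1)) s-1)) s-1)))))))
      product≈0 : quadratic 1# * quadratic (- 1#) ≈ 0#
      product≈0 = trans (solve 2 (λ y i →
          ((y :+ :1 :- i) :* (y :+ :1 :+ i)) :* ((y :+ :- :1 :- i) :* (y :+ :- :1 :+ i)) :=
          (y :* (y :* (y :* (y :* :1))) :+ (:1 :+ :1 :+ :1 :+ :1)) :+
          (i :* i :+ :1) :* (i :* i :- :1 :- y :* y :- y :* y :- :1 :- :1)) refl Y I)
        (trans (+-cong (trans (+-congʳ Y⁴) (-‿inverseˡ _)) (trans (*-congʳ I²≈-1) (zeroˡ _))) (+-identityˡ 0#))
      reach : ∀ α β → ¬ (α K.≈ K.0#) → ¬ (β K.≈ K.0#) → ∀ e → s β ≈ e → ∀ d → s α ≈ - d → ¬ (Y + d - e * I ≈ 0#)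
      reach α β α≉0 β≉0 e β≈e d α≈-d p = not-homogeneous y α β α≉0 β≉0 (trans
        (solve 3 (λ y d f → y := (y :+ d :- f) :+ (:- d :+ f)) refl Y d (e * I))
        (trans (+-congʳ p) (trans (+-identityˡ _) (+-cong (sym α≈-d) (*-congʳ (sym β≈e))))))
      plus : ∀ α d → ¬ (α K.≈ K.0#) → s α ≈ - d → ¬ (Y + d - I ≈ 0#)
      plus α d α≉0 α≈ p = reach α K.1# α≉0 (proj₁ K-field) 1# s-1 d α≈ (trans (+-congˡ (-‿cong (*-identityˡ I))) p)
      minus : ∀ α d → ¬ (α K.≈ K.0#) → s α ≈ - d → ¬ (Y + d + I ≈ 0#)
      minus α d α≉0 α≈ p = reach α (K.- K.1#) α≉0 -1≉0 (- 1#) s-1′ d α≈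
        (trans (+-congˡ (solve 1 (λ i → :- ((:- :1) :* i) := i) refl I)) p)
      inner : ∀ α d → ¬ (α K.≈ K.0#) → s α ≈ - d → ¬ (quadratic d ≈ 0#)
      inner α d α≉0 α≈ p = cases (domain (Y + d - I) (Y + d + I) p)
        where
        cases : ¬ (Y + d - I ≈ 0# ⊎ Y + d + I ≈ 0#)
        cases (inj₁ q) = plus α d α≉0 α≈ q
        cases (inj₂ q) = minus α d α≉0 α≈ q
      outer : ¬ (quadratic 1# ≈ 0# ⊎ quadratic (- 1#) ≈ 0#)
      outer (inj₁ q) = inner (K.- K.1#) 1# -1≉0 s-1′ q
      outer (inj₂ q) = inner K.1# (- 1#) (proj₁ K-field) (trans s-1 (solve 1 (λ x → x := :- (:- x)) refl 1#)) q

  exceptional : ∃[ i ] (HasOrder U i 4 × ¬ (i ∈ Image (units K) U ι)) → ¬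
    (∃[ y ] ∃[ a ] (proj₁ a K.≈ -4# K × y U.↑ 4 U.≈ ι a))
  exceptional (i , i-order , i∉) (y , a , a≈-4 , y⁴) = no-fourth-root i i-order i∉ y a a≈-4 y⁴

module Necessity (em : ∀ {e} → ExcludedMiddle e) (K : CommutativeRing c ℓ) (K-field : IsField K) (U : AbelianGroup u ℓu)
  (ι : AbelianGroup.Carrier (units K) → AbelianGroup.Carrier U) (ι-mono : IsMonomorphism (units K) U ι)
  (A-field : IsField (UniversalAlgebra.algebra K U ι)) where

  private
    module A = UniversalAlgebra K U ι
    module U = AbelianGroup U
    module Kˣ = AbelianGroup (units K)
    module ι = GroupMorphisms.IsGroupMonomorphism ι-mono
  -- x ∈ F becomes 1 in K⟨U/F⟩, which is nonzero because K^× still embeds in U/F; so x - 1 is not a unit.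
  essential : IsEssential (units K) U ι
  essential F F-sub trivial x x∈F =
    FieldConsequences.kernel-trivial em K-field ι-mono (Coefficients.graded em K U ι ι-mono) A-field project-isRingHom
      (GradedProperties.1≉0 em K-field ι/F-mono (Coefficients.graded em K U/F ι ι/F-mono))
      x (A/F.prep (CommutativeRing.refl K) ((x , x∈F) , U.sym (U.identityʳ x)) A/F.refl)
    where
    open IsSubgroup F-sub
    subgroup : AbelianGroup _ _
    subgroup = record
      { Carrier = ∃[ y ] y ∈ F
      ; _≈_ = λ y z → proj₁ y U.≈ proj₁ z
      ; _∙_ = λ (y , y∈) (z , z∈) → y U.∙ z , ∙-closed y∈ z∈
      ; ε = U.ε , ε-closed
      ; _⁻¹ = λ (y , y∈) → y U.⁻¹ , ⁻¹-closed y∈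
      ; isAbelianGroup = record
        { isGroup = record
          { isMonoid = record
            { isSemigroup = record
              { isMagma = record { isEquivalence = record { refl = U.refl ; sym = U.sym ; trans = U.trans } ; ∙-cong = U.∙-cong }
              ; assoc = λ _ _ _ → U.assoc _ _ _ }
            ; identity = (λ _ → U.identityˡ _) , λ _ → U.identityʳ _ }
          ; inverse = (λ _ → U.inverseˡ _) , λ _ → U.inverseʳ _
          ; ⁻¹-cong = U.⁻¹-cong }
        ; comm = λ _ _ → U.comm _ _ }
      }
    inclusion : IsHomomorphism subgroup U proj₁
    inclusion = record
      { isMonoidHomomorphism = record
        { isMagmaHomomorphism = record { isRelHomomorphism = record { cong = id } ; homo = λ _ _ → U.refl }
        ; ε-homo = U.refl }
      ; ⁻¹-homo = λ _ → U.refl }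
    U/F = quotient subgroup U proj₁ inclusion
    module U/F = AbelianGroup U/F
    ≈⇒~ : ∀ {y z} → y U.≈ z → y U/F.≈ z
    ≈⇒~ p = (U.ε , ε-closed) , U.trans p (U.sym (U.identityˡ _))
    ι/F-mono : IsMonomorphism (units K) U/F ι
    ι/F-mono = record
      { isGroupHomomorphism = record
        { isMonoidHomomorphism = record
          { isMagmaHomomorphism = record { isRelHomomorphism = record { cong = λ p → ≈⇒~ (ι.⟦⟧-cong p) } ; homo = λ a b → ≈⇒~ (ι.∙-homo a b) }
          ; ε-homo = ≈⇒~ ι.ε-homo }
        ; ⁻¹-homo = λ a → ≈⇒~ (ι.⁻¹-homo a) }
      ; injective = λ { {a} {b} ((y , y∈) , p) → ι.injective
        (U.trans p (U.trans (U.∙-congʳ (trivial y (y∈ , a Kˣ.∙ b Kˣ.⁻¹ ,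
          U.trans (U.sym (U.trans (U.assoc _ _ _) (U.trans (U.∙-congˡ (U.inverseʳ (ι b))) (U.identityʳ y))))
            (U.trans (U.∙-cong (U.sym p) (U.sym (ι.⁻¹-homo b))) (U.sym (ι.∙-homo a (b Kˣ.⁻¹))))))) (U.identityˡ _))) }
      }
    module A/F = UniversalAlgebra K U/F ι
    project : ∀ {xs ys} → xs A.≋ ys → xs A/F.≋ ys
    project A.refl = A/F.refl
    project (A.sym p) = A/F.sym (project p)
    project (A.trans p q) = A/F.trans (project p) (project q)
    project (A.prep p q r) = A/F.prep p (≈⇒~ q) (project r)
    project (A.swap y z) = A/F.swap y z
    project (A.drop v) = A/F.drop v
    project (A.merge k l v) = A/F.merge k l v
    project (A.balance k a v) = A/F.balance k a v
    ⊛-same : ∀ xs ys → xs A.⊛ ys ≡ xs A/F.⊛ ys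
    ⊛-same [] ys = ≡.refl
    ⊛-same (x ∷ xs) ys = ≡.cong (x A/F.· ys ++_) (⊛-same xs ys)
    project-isRingHom : IsRingHom A.algebra A/F.algebra id
    project-isRingHom = record { φ-cong = project ; φ-+ = λ _ _ → A/F.refl ; φ-* = λ xs ys → ≡.subst (λ zs → (xs A.⊛ ys) A/F.≋ zs) (⊛-same xs ys) A/F.refl ; φ-1 = A/F.refl }

quotient-^ : ∀ (H : AbelianGroup a ℓ₁) (G : AbelianGroup f ℓ₂) (f : AbelianGroup.Carrier H → AbelianGroup.Carrier G)
  (f-hom : IsHomomorphism H G f) x n → _^_ (quotient H G f f-hom) x n ≡ _^_ G x n
quotient-^ H G f f-hom x zero = ≡.refl
quotient-^ H G f f-hom x (suc n) = ≡.cong (AbelianGroup._∙_ G x) (quotient-^ H G f f-hom x n)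

prime-characteristic : ∀ (K : CommutativeRing c ℓ) → IsField K → ∀ {p} → Prime p →
  let open CommutativeRing K in _^_ +-abelianGroup 1# p ≈ 0# → HasCharacteristic K p
prime-characteristic K K-field {p} p-prime p≈0 m = mk⇔ (λ m≈0 → decidable-stable (p ∣? m) λ p∤m →
    proj₁ K-field (coprime-powers zero-isSubgroup (prime-coprime p-prime p∤m) p≈0 m≈0))
  λ { (divides k ≡.refl) → trans (↑-* 1# k p) (trans (↑-cong k p≈0) (ε↑ k)) }
  where
  open CommutativeRing K hiding (zero)
  open Powers +-abelianGroup
  zero-isSubgroup : IsSubgroup +-abelianGroup (_≈ 0#)
  zero-isSubgroup = record
    { resp = λ p q → trans (sym p) q
    ; ε-closed = refl
    ; ∙-closed = λ p q → trans (+-cong p q) (+-identityˡ 0#)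
    ; ⁻¹-closed = λ p → trans (-‿cong p) (trans (sym (+-identityˡ _)) (-‿inverseʳ 0#))
    }

module Assembly (em : ∀ {e} → ExcludedMiddle e) (K : CommutativeRing c ℓ) (K-field : IsField K) (U : AbelianGroup u ℓu)
  (ι : AbelianGroup.Carrier (units K) → AbelianGroup.Carrier U) (ι-mono : IsMonomorphism (units K) U ι) where

  open Extension K U ι ι-mono
  private
    module K = CommutativeRing K
    module U = AbelianGroup U
    module Rˣ = AbelianGroup (units K⟨U⟩)
    module R = CommutativeRing K⟨U⟩
    G = Coefficients.graded em K U ι ι-mono
    scalarUnit = Trace.scalarUnit em K-field ι-mono G
    scalarUnit-mono = Trace.scalarUnit-mono em K-field ι-mono G
    G′ = Coefficients.graded em K (units K⟨U⟩) scalarUnit scalarUnit-mono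
    module E = Evaluation em K-field ι-mono G

  U/K^×-↑ : ∀ x n → _^_ U/K^× x n ≡ _^_ U x n
  U/K^×-↑ = quotient-^ (units K) U ι (GroupMorphisms.IsGroupMonomorphism.isGroupHomomorphism ι-mono)

  K⟨U⟩^×/K^×-↑ : ∀ z n → _^_ K⟨U⟩^×/K^× z n ≡ _^_ (units K⟨U⟩) z n
  K⟨U⟩^×/K^×-↑ = quotient-^ (units K) (units K⟨U⟩) scalar scalar-isHomomorphism

  module _ (char : ∀ p → 0 < p → HasCharacteristic K p → IsTrivial U/K^× (U/K^× [ p ^∞]))
    (essential : IsEssential (units K) U ι) (exceptional : HasNewOrder4 → ¬ -4∈U⁴) where

    no-p-torsion : ∀ {p} → Prime p → _^_ K.+-abelianGroup K.1# p K.≈ K.0# →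
      ∀ {x} → _^_ U x p ∈ Image (units K) U ι → x ∈ Image (units K) U ι
    no-p-torsion {p} p-prime p≈0 {x} (y , q) =
      let z , eq = char p (ℕ.>-nonZero⁻¹ p {{prime⇒nonZero p-prime}}) (prime-characteristic K K-field p-prime p≈0) x
            (1 , ℕ.≤-refl , y , U.trans
              (U.reflexive (≡.trans (U/K^×-↑ x (p ℕ.^ 1)) (≡.cong (_^_ U x) (ℕ.^-identityʳ p))))
                (U.trans q (U.sym (U.identityʳ _))))
      in z , U.trans eq (U.identityʳ _)

    module T = Towers em K-field ι-mono G G′ E.φ-isRingHom E.φ-scalar E.φ-unit essential exceptional no-p-torsion

    p-group-elements : ∀ {p} → IsPGroup U/K^× p → ∀ v → ∃[ k ] _^_ U v (p ℕ.^ k) ∈ Image (units K) U ι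
    p-group-elements {p} p-group v = let k , b , q = p-group v in
      k , b , U.trans (U.reflexive (≡.sym (U/K^×-↑ v (p ℕ.^ k)))) (U.trans q (U.identityʳ _))

    p-torsion-units : ∀ {p} (p-prime : Prime p) (p-group : IsPGroup U/K^× p) →
      (∀ {z} → T.TorsionUnits.PTorsion p-prime (p-group-elements p-group) z → ∃[ v ] z Rˣ.≈ homogeneous v) →
      (K⟨U⟩^×/K^× [ p ^∞]) ≐ U/K^×-in-K⟨U⟩^×/K^×
    p-torsion-units {p} p-prime p-group torsion = forwards , backwards
      where
      forwards : (K⟨U⟩^×/K^× [ p ^∞]) ⊆ U/K^×-in-K⟨U⟩^×/K^×
      forwards {z} (k , _ , y , q) =
        let v , z≈v = torsion {z} (k , y , R.trans (≡.subst (λ w → w Rˣ.≈ scalar y Rˣ.∙ Rˣ.ε) (K⟨U⟩^×/K^×-↑ z (p ℕ.^ k)) q) (Rˣ.identityʳ (scalar y)))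
        in v , AbelianGroup.ε (units K) , R.trans z≈v (R.sym (Rˣ.identityˡ (homogeneous v)))
      backwards : U/K^×-in-K⟨U⟩^×/K^× ⊆ (K⟨U⟩^×/K^× [ p ^∞])
      backwards {z} (v , y , z≈) =
        let k , x , q = T.TorsionUnits.PTorsion-~ p-prime (p-group-elements p-group) {z} {y} {v} z≈
        in suc k , ℕ.s≤s ℕ.z≤n , x , ≡.subst (λ w → w Rˣ.≈ scalar x Rˣ.∙ Rˣ.ε)
             (≡.sym (K⟨U⟩^×/K^×-↑ z (p ℕ.^ suc k))) (R.trans q (R.sym (Rˣ.identityʳ (scalar x))))

    odd : ∀ p → Prime p → 3 ≤ p → IsPGroup U/K^× p → (K⟨U⟩^×/K^× [ p ^∞]) ≐ U/K^×-in-K⟨U⟩^×/K^×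
    odd p p-prime 3≤p p-group = p-torsion-units p-prime p-group
      (λ {z} → T.TorsionUnits.Odd.odd-torsion p-prime (p-group-elements p-group) 3≤p {z})

    even : IsPGroup U/K^× 2 → ¬ HasNewOrder4 → (K⟨U⟩^×/K^× [ 2 ^∞]) ≐ U/K^×-in-K⟨U⟩^×/K^×
    even 2-group no-new = p-torsion-units prime[2] 2-group
      (λ {z} → T.Even.even-torsion (p-group-elements 2-group) no-new {z})

theorem2p9 : (∀ {e : Level} → ExcludedMiddle e) →
    ∀ {c ℓ u ℓu : Level}
    (K : CommutativeRing c ℓ) → IsField K →
    (U : AbelianGroup u ℓu)
    (ι : AbelianGroup.Carrier (units K) → AbelianGroup.Carrier U)
    (ι-mono : IsMonomorphism (units K) U ι) →
    let open Extension K U ι ι-mono in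
    (∀ (p : ℕ) → 0 < p → HasCharacteristic K p → IsTrivial U/K^× (U/K^× [ p ^∞])) →
    (IsField K⟨U⟩ ⇔ (IsEssential (units K) U ι × (HasNewOrder4 → ¬ -4∈U⁴)))
    ×
    (IsField K⟨U⟩ →
    (∀ (p : ℕ) → Prime p → 3 ≤ p → IsPGroup U/K^× p →
    (K⟨U⟩^×/K^× [ p ^∞]) ≐ U/K^×-in-K⟨U⟩^×/K^×)
    ×
    (IsPGroup U/K^× 2 → ¬ HasNewOrder4 →
    (K⟨U⟩^×/K^× [ 2 ^∞]) ≐ U/K^×-in-K⟨U⟩^×/K^×))
theorem2p9 em K K-field U ι ι-mono char =
  mk⇔ (λ A-field → essential A-field , exceptional A-field) (λ (ess , exc) → A.T.algebra-field char ess exc) ,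
  λ A-field → A.odd char (essential A-field) (exceptional A-field) , A.even char (essential A-field) (exceptional A-field)
  where
  open Extension K U ι ι-mono
  module A = Assembly em K K-field U ι ι-mono
  essential : IsField K⟨U⟩ → IsEssential (units K) U ι
  essential = Necessity.essential em K K-field U ι ι-mono
  exceptional : IsField K⟨U⟩ → HasNewOrder4 → ¬ -4∈U⁴
  exceptional = FieldConsequences.exceptional em K-field ι-mono (Coefficients.graded em K U ι ι-mono)
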